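{- Let $M$ be a $2$-neighborly combinatorial $3$-manifold with vertex set $V$, $n:=|V|$, let $V=V_1\dot\cup V_2$ be a partition with $|V_1|+c=|V_2|-c$ for some $c\in\frac12\mathbb{N}_0$, and let $S=S_{(V_1,V_2)}$ be the associated slicing, with $q$ quadrilaterals and genus $g$ (defined by $\chi(S)=2-2g$). Then \[ q\ \ge\ 4g+\frac{3n}{2}-(4+2c^2). \] Moreover, for $c=0$ this inequality is sharp for all values $g=\binom{n/2-1}{2}$: for every integer $k\ge 3$ there exist a $2$-neighborly combinatorial $3$-manifold $M$ with $n=2k$ vertices and a partition $V=V_1\dot\cup V_2$ with $|V_1|=|V_2|=k$ whose slicing has genus $g=\binom{k-1}{2}$ and exactly $q=4g+3k-4$ quadrilaterals.
   Context: A combinatorial $3$-manifold is a finite pure $3$-dimensional simplicial complex in which the link of every vertex is a combinatorial $2$-sphere; it is $2$-neighborly if every pair of vertices spans an edge. A function $f:M\to\mathbb{R}$ is regular simplexwise linear (rsl) if it is linear on every simplex and takes pairwise distinct values on the vertices. Given a partition $V=V_1\dot\cup V_2$ of the vertex set into nonempty sets, choose an rsl-function $f$ with $f(v)<f(w)$ for all $v\in V_1$, $w\in V_2$ and $x_0$ strictly between $\max f(V_1)$ and $\min f(V_2)$; the slicing $S_{(V_1,V_2)}$ is the polyhedral surface $f^{ -1}(x_0)$, whose facets are the triangles and quadrilaterals obtained by intersecting $f^{ -1}(x_0)$ with the tetrahedra of $M$ meeting both $V_1$ and $V_2$ (a quadrilateral arises from a tetrahedron with exactly two vertices in each part). -}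

module Defs where

open import Algebra.Bundles using (CommutativeRing)
open import Data.Bool.Base using (if_then_else_)
open import Data.Empty using (⊥-elim)
open import Data.Fin.Base using (Fin; zero; suc)
open import Data.Fin.Subset
  using (Subset; inside; outside; ⊥; ⊤; ⁅_⁆; _∈_; _∉_; _⊆_; _⊈_; _⊂_; _∪_; _∩_; ∣_∣; Nonempty)
open import Data.Fin.Subset.Properties
open import Data.List.Base using (List; []; _∷_; _++_; map; filter; length)
open import Data.Nat.Base as ℕ using (ℕ; zero; suc)
import Data.Nat.Properties as ℕ
open import Data.Product using (∃; _×_; _,_; proj₁; proj₂)
open import Data.Rational hiding (∣_∣)
open import Data.Rational.Properties hiding (_≟_)
open import Data.Sum.Base using (_⊎_; inj₁; inj₂; [_,_]′)
open import Data.Vec.Base using ([]; _∷_; here; there)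
open import Function.Base using (_∘_)
open import Function.Definitions using (Injective)
open import Level using (0ℓ)
open import Relation.Binary.Construct.Closure.Equivalence using (EqClosure)
open import Relation.Binary.PropositionalEquality
  using (_≡_; _≢_; refl; sym; trans; cong; cong₂; subst; subst₂; module ≡-Reasoning)
open import Relation.Nullary.Decidable using (yes; no; does; _×-dec_; ¬?; map′)
open import Relation.Nullary.Negation using (¬_)
open import Relation.Unary using (Pred; Decidable)

open import Algebra.Properties.Semiring.Sum (CommutativeRing.semiring +-*-commutativeRing)
  using (sum; sum-cong-≗; ∑-distrib-+; *-distribˡ-sum; *-distribʳ-sum) public

private
  variable
    n m : ℕ

------------------------------------------------------------------------
-- Finite simplicial complexes

-- Simplices are given by their vertex sets, the empty simplex included, so a
-- simplex σ has dimension ∣ σ ∣ - 1.  An element v of Fin n is a vertex of K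
-- only if ⁅ v ⁆ is a face; links and stellar subdivisions leave some labels
-- unused.
record Complex (n : ℕ) : Set₁ where
  field
    Face     : Pred (Subset n) 0ℓ
    Face?    : Decidable Face
    ∅-face   : Face ⊥
    downward : ∀ {σ τ} → σ ⊆ τ → Face τ → Face σ

open Complex public

∪-lub : {σ τ ρ : Subset n} → σ ⊆ ρ → τ ⊆ ρ → σ ∪ τ ⊆ ρ
∪-lub {σ = σ} {τ} σ⊆ρ τ⊆ρ x∈ = [ σ⊆ρ , τ⊆ρ ]′ (x∈p∪q⁻ σ τ x∈)

∪-monoˡ-⊆ : {σ τ : Subset n} (ρ : Subset n) → σ ⊆ τ → σ ∪ ρ ⊆ τ ∪ ρ
∪-monoˡ-⊆ {τ = τ} ρ σ⊆τ = ∪-lub (λ x∈ → p⊆p∪q ρ (σ⊆τ x∈)) (q⊆p∪q τ ρ)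

link : (K : Complex n) (v : Fin n) → Face K ⁅ v ⁆ → Complex n
link K v v∈K = record
  { Face     = λ σ → v ∉ σ × Face K (σ ∪ ⁅ v ⁆)
  ; Face?    = λ σ → ¬? (v ∈? σ) ×-dec Face? K (σ ∪ ⁅ v ⁆)
  ; ∅-face   = ∉⊥ , downward K (∪-lub (⊥-elim ∘ ∉⊥) (λ x∈ → x∈)) v∈K
  ; downward = λ σ⊆τ (v∉τ , τ∪v∈K) →
      (λ v∈σ → v∉τ (σ⊆τ v∈σ)) , downward K (∪-monoˡ-⊆ ⁅ v ⁆ σ⊆τ) τ∪v∈K
  }

∂Δ : (n : ℕ) → Complex (suc n)
∂Δ n = record
  { Face     = _⊂ ⊤
  ; Face?    = _⊂? ⊤
  ; ∅-face   = ⊥-elim ∘ ∉⊥ , zero , here , λ ()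
  ; downward = ⊆-⊂-trans
  }

------------------------------------------------------------------------
-- Combinatorial spheres and manifolds

image : (Fin n → Fin m) → Subset n → Subset m
image f []            = ⊥
image f (inside  ∷ σ) = ⁅ f zero ⁆ ∪ image (f ∘ suc) σ
image f (outside ∷ σ) = image (f ∘ suc) σ

-- The values of `to` and `from` on labels that are not vertices do not matter.
record _≅_ (K : Complex n) (L : Complex m) : Set where
  field
    to        : Fin n → Fin m
    from      : Fin m → Fin n
    to-face   : ∀ {σ} → Face K σ → Face L (image to σ)
    from-face : ∀ {σ} → Face L σ → Face K (image from σ)
    from-to   : ∀ {v} → Face K ⁅ v ⁆ → from (to v) ≡ v
    to-from   : ∀ {w} → Face L ⁅ w ⁆ → to (from w) ≡ w

-- Starring K at A: the open star of A is replaced by a ∗ ∂A ∗ link(A), where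
-- a is a new vertex, here with label zero.  For τ ∌ a, the simplex a ∗ τ lies
-- in a ∗ ∂A ∗ link(A) exactly when τ ∪ A is a face of K and τ does not
-- contain A.
StarredFace : Complex n → Subset n → Pred (Subset (suc n)) 0ℓ
StarredFace K A (outside ∷ τ) = Face K τ × A ⊈ τ
StarredFace K A (inside  ∷ τ) = Face K (τ ∪ A) × A ⊈ τ

starredFace? : (K : Complex n) (A : Subset n) → Decidable (StarredFace K A)
starredFace? K A (outside ∷ τ) = Face? K τ ×-dec ¬? (A ⊆? τ)
starredFace? K A (inside  ∷ τ) = Face? K (τ ∪ A) ×-dec ¬? (A ⊆? τ)

starredFace-downward : (K : Complex n) (A : Subset n) → ∀ {σ τ} →
                       σ ⊆ τ → StarredFace K A τ → StarredFace K A σ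
starredFace-downward K A {outside ∷ σ} {outside ∷ τ} σ⊆τ (τ∈K , A⊈τ) =
  downward K (drop-∷-⊆ σ⊆τ) τ∈K , λ A⊆σ → A⊈τ (λ x∈A → drop-∷-⊆ σ⊆τ (A⊆σ x∈A))
starredFace-downward K A {outside ∷ σ} {inside ∷ τ} σ⊆τ (τ∪A∈K , A⊈τ) =
  downward K (λ x∈σ → p⊆p∪q A (drop-∷-⊆ σ⊆τ x∈σ)) τ∪A∈K ,
  λ A⊆σ → A⊈τ (λ x∈A → drop-∷-⊆ σ⊆τ (A⊆σ x∈A))
starredFace-downward K A {inside ∷ σ} {outside ∷ τ} σ⊆τ _ with () ← σ⊆τ here
starredFace-downward K A {inside ∷ σ} {inside ∷ τ} σ⊆τ (τ∪A∈K , A⊈τ) =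
  downward K (∪-monoˡ-⊆ A (drop-∷-⊆ σ⊆τ)) τ∪A∈K ,
  λ A⊆σ → A⊈τ (λ x∈A → drop-∷-⊆ σ⊆τ (A⊆σ x∈A))

star-at : (K : Complex n) (A : Subset n) → Nonempty A → Complex (suc n)
star-at K A (a , a∈A) = record
  { Face     = StarredFace K A
  ; Face?    = starredFace? K A
  ; ∅-face   = ∅-face K , λ A⊆∅ → ∉⊥ (A⊆∅ a∈A)
  ; downward = λ {σ} {τ} → starredFace-downward K A {σ} {τ}
  }

data StellarMove : ∃ Complex → ∃ Complex → Set₁ where
  relabel : {K : Complex n} {L : Complex m} → K ≅ L →
            StellarMove (n , K) (m , L)
  starring : (K : Complex n) (A : Subset n) (A≢∅ : Nonempty A) → Face K A →
             StellarMove (n , K) (suc n , star-at K A A≢∅)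

-- Two complexes are PL homeomorphic exactly when stellar subdivisions and
-- their inverses transform one into the other (Alexander, Newman).
StellarEquivalent : Complex n → Complex m → Set₁
StellarEquivalent K L = EqClosure StellarMove (_ , K) (_ , L)

-- ∂Δ (suc d) is the boundary of the (d + 1)-simplex.
CombinatorialSphere : (d : ℕ) → Complex n → Set₁
CombinatorialSphere d K = StellarEquivalent K (∂Δ (suc d))

record Pure (d : ℕ) (K : Complex n) : Set where
  field
    dimension : ∀ {σ} → Face K σ → ∣ σ ∣ ℕ.≤ suc d
    facet     : ∀ {σ} → Face K σ → ∃ λ τ → σ ⊆ τ × Face K τ × ∣ τ ∣ ≡ suc d

-- The vertex set is all of Fin n.
record Combinatorial3Manifold (M : Complex n) : Set₁ where
  field
    vertex : ∀ v → Face M ⁅ v ⁆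
    pure   : Pure 3 M
    links  : ∀ v → CombinatorialSphere 2 (link M v (vertex v))

TwoNeighborly : Complex n → Set
TwoNeighborly K = ∀ v w → v ≢ w → Face K (⁅ v ⁆ ∪ ⁅ w ⁆)

------------------------------------------------------------------------
-- Partitions and rsl-functions

record Bipartition (n : ℕ) : Set where
  field
    V₁ V₂    : Subset n
    cover    : V₁ ∪ V₂ ≡ ⊤
    disjoint : V₁ ∩ V₂ ≡ ⊥
    V₁≢∅     : Nonempty V₁
    V₂≢∅     : Nonempty V₂

-- An rsl-function is determined by its values on the vertices.
record SeparatingRsl (P : Bipartition n) : Set where
  open Bipartition P
  field
    f           : Fin n → ℚ
    f-injective : Injective _≡_ _≡_ f
    x₀          : ℚ
    below       : ∀ {v} → v ∈ V₁ → f v < x₀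
    above       : ∀ {w} → w ∈ V₂ → x₀ < f w

-- Barycentric coordinates of a point in the relative interior of σ.
record InInterior (σ : Subset n) (p : Fin n → ℚ) : Set where
  field
    positive-on : ∀ {v} → v ∈ σ → 0ℚ < p v
    zero-off    : ∀ {v} → v ∉ σ → p v ≡ 0ℚ
    total       : sum p ≡ 1ℚ

extend : (Fin n → ℚ) → (Fin n → ℚ) → ℚ
extend f p = sum (λ v → p v * f v)

MeetsLevel : (Fin n → ℚ) → ℚ → Subset n → Set
MeetsLevel f x₀ σ = ∃ λ p → InInterior σ p × extend f p ≡ x₀

BothSides : Bipartition n → Subset n → Set
BothSides P σ = Nonempty (σ ∩ V₁) × Nonempty (σ ∩ V₂)
  where open Bipartition P

------------------------------------------------------------------------
-- The level set meets the interior of σ if and only if σ has vertices in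
-- both parts

sum-nonneg : (g : Fin n → ℚ) → (∀ v → 0ℚ ≤ g v) → 0ℚ ≤ sum g
sum-nonneg {zero}  g g≥0 = ≤-refl
sum-nonneg {suc n} g g≥0 = +-mono-≤ (g≥0 zero) (sum-nonneg (g ∘ suc) (g≥0 ∘ suc))

sum-pos : (g : Fin n → ℚ) → (∀ v → 0ℚ ≤ g v) → ∀ v → 0ℚ < g v → 0ℚ < sum g
sum-pos g g≥0 zero    gv>0 = +-mono-<-≤ gv>0 (sum-nonneg (g ∘ suc) (g≥0 ∘ suc))
sum-pos g g≥0 (suc v) gv>0 = +-mono-≤-< (g≥0 zero) (sum-pos (g ∘ suc) (g≥0 ∘ suc) v gv>0)

sum-zero : (g : Fin n → ℚ) → (∀ v → g v ≡ 0ℚ) → sum g ≡ 0ℚ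
sum-zero {zero}  g g≡0 = refl
sum-zero {suc n} g g≡0 = cong₂ _+_ (g≡0 zero) (sum-zero (g ∘ suc) (g≡0 ∘ suc))

sum-mono-< : (g h : Fin n → ℚ) → (∀ v → g v ≤ h v) → ∀ v → g v < h v → sum g < sum h
sum-mono-≤ : (g h : Fin n → ℚ) → (∀ v → g v ≤ h v) → sum g ≤ sum h
sum-mono-≤ {zero}  g h g≤h = ≤-refl
sum-mono-≤ {suc n} g h g≤h = +-mono-≤ (g≤h zero) (sum-mono-≤ (g ∘ suc) (h ∘ suc) (g≤h ∘ suc))
sum-mono-< g h g≤h zero    lt = +-mono-<-≤ lt (sum-mono-≤ (g ∘ suc) (h ∘ suc) (g≤h ∘ suc))
sum-mono-< g h g≤h (suc v) lt =
  +-mono-≤-< (g≤h zero) (sum-mono-< (g ∘ suc) (h ∘ suc) (g≤h ∘ suc) v lt)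

y+[x-y]≡x : ∀ y x → y + (x - y) ≡ x
y+[x-y]≡x y x = trans (+-comm y (x - y)) (trans (+-assoc x (- y) y)
  (trans (cong (x +_) (+-inverseˡ y)) (+-identityʳ x)))

x<y⇒0<y-x : ∀ {x y} → x < y → 0ℚ < y - x
x<y⇒0<y-x {x} {y} x<y = subst (_< y - x) (+-inverseʳ x) (+-monoˡ-< (- x) x<y)

pos*pos>0 : ∀ {x y} → 0ℚ < x → 0ℚ < y → 0ℚ < x * y
pos*pos>0 {x} {y} x>0 y>0 = subst (_< x * y) (*-zeroʳ x) (*-monoʳ-<-pos x {{positive x>0}} y>0)

interior-average : {σ : Subset n} {p : Fin n → ℚ} → InInterior σ p →
                   ∀ x → sum (λ v → p v * x) ≡ x
interior-average {p = p} int x = trans (sym (*-distribʳ-sum x p))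
  (trans (cong (_* x) (InInterior.total int)) (*-identityˡ x))

interior-nonempty : {σ : Subset n} {p : Fin n → ℚ} → InInterior σ p → Nonempty σ
interior-nonempty {σ = σ} {p} int with nonempty? σ
... | yes σ≢∅ = σ≢∅
... | no  σ≡∅ = ⊥-elim (1≢0 (trans (sym total) (sum-zero p (λ v → zero-off (λ v∈σ → σ≡∅ (v , v∈σ))))))
  where open InInterior int

module _ {P : Bipartition n} (s : SeparatingRsl P) where
  open Bipartition P
  open SeparatingRsl s

  side : ∀ v → v ∈ V₁ ⊎ v ∈ V₂
  side v = x∈p∪q⁻ V₁ V₂ (subst (v ∈_) (sym cover) ∈⊤)

  not-both : ∀ {v} → v ∈ V₁ → v ∉ V₂
  not-both {v} v∈V₁ v∈V₂ = ∉⊥ (subst (v ∈_) disjoint (x∈p∩q⁺ (v∈V₁ , v∈V₂)))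

  meets⇒bothSides : ∀ {σ} → MeetsLevel f x₀ σ → BothSides P σ
  meets⇒bothSides {σ} (p , int , eq) = left , right
    where
    open InInterior int

    strictly : ∀ (g h : Fin n → ℚ) → (∀ {v} → v ∈ σ → g v < h v) →
               sum (λ v → p v * g v) < sum (λ v → p v * h v)
    strictly g h g<h = sum-mono-< _ _ weak (proj₁ σ≢∅) (strict (proj₂ σ≢∅))
      where
      σ≢∅ = interior-nonempty int
      strict : ∀ {v} → v ∈ σ → p v * g v < p v * h v
      strict {v} v∈σ = *-monoʳ-<-pos (p v) {{positive (positive-on v∈σ)}} (g<h v∈σ)
      weak : ∀ v → p v * g v ≤ p v * h v
      weak v with v ∈? σ
      ... | yes v∈σ = <⇒≤ (strict v∈σ)
      ... | no  v∉σ = ≤-reflexive (trans (z (g v)) (sym (z (h v))))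
        where
        z : ∀ y → p v * y ≡ 0ℚ
        z y = trans (cong (_* y) (zero-off v∉σ)) (*-zeroˡ y)

    left : Nonempty (σ ∩ V₁)
    left with nonempty? (σ ∩ V₁)
    ... | yes ne = ne
    ... | no  em = ⊥-elim (<-irrefl refl
          (subst₂ _<_ (interior-average int x₀) eq (strictly (λ _ → x₀) f x₀<f)))
      where
      x₀<f : ∀ {v} → v ∈ σ → x₀ < f v
      x₀<f {v} v∈σ = [ (λ v∈V₁ → ⊥-elim (em (v , x∈p∩q⁺ (v∈σ , v∈V₁)))) , above ]′ (side v)

    right : Nonempty (σ ∩ V₂)
    right with nonempty? (σ ∩ V₂)
    ... | yes ne = ne
    ... | no  em = ⊥-elim (<-irrefl refl
          (subst₂ _<_ eq (interior-average int x₀) (strictly f (λ _ → x₀) f<x₀)))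
      where
      f<x₀ : ∀ {v} → v ∈ σ → f v < x₀
      f<x₀ {v} v∈σ = [ below , (λ v∈V₂ → ⊥-elim (em (v , x∈p∩q⁺ (v∈σ , v∈V₂)))) ]′ (side v)

  bothSides⇒meets : ∀ {σ} → BothSides P σ → MeetsLevel f x₀ σ
  bothSides⇒meets {σ} ((v₁ , v₁∈) , (v₂ , v₂∈)) = p , interior , level
    where
    g h q : Fin n → ℚ
    g v = if does (v ∈? σ ∩ V₁) then x₀ - f v else 0ℚ
    h v = if does (v ∈? σ ∩ V₂) then f v - x₀ else 0ℚ

    a b : ℚ
    a = sum g
    b = sum h

    g-pos : ∀ {v} → v ∈ σ ∩ V₁ → 0ℚ < g v
    g-pos {v} v∈ with v ∈? σ ∩ V₁
    ... | yes _  = x<y⇒0<y-x (below (proj₂ (x∈p∩q⁻ σ V₁ v∈)))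
    ... | no  v∉ = ⊥-elim (v∉ v∈)

    g≥0 : ∀ v → 0ℚ ≤ g v
    g≥0 v with v ∈? σ ∩ V₁
    ... | yes v∈ = <⇒≤ (x<y⇒0<y-x (below (proj₂ (x∈p∩q⁻ σ V₁ v∈))))
    ... | no  _  = ≤-refl

    h-pos : ∀ {v} → v ∈ σ ∩ V₂ → 0ℚ < h v
    h-pos {v} v∈ with v ∈? σ ∩ V₂
    ... | yes _  = x<y⇒0<y-x (above (proj₂ (x∈p∩q⁻ σ V₂ v∈)))
    ... | no  v∉ = ⊥-elim (v∉ v∈)

    h≥0 : ∀ v → 0ℚ ≤ h v
    h≥0 v with v ∈? σ ∩ V₂
    ... | yes v∈ = <⇒≤ (x<y⇒0<y-x (above (proj₂ (x∈p∩q⁻ σ V₂ v∈))))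
    ... | no  _  = ≤-refl

    a>0 : 0ℚ < a
    a>0 = sum-pos g g≥0 v₁ (g-pos v₁∈)

    b>0 : 0ℚ < b
    b>0 = sum-pos h h≥0 v₂ (h-pos v₂∈)

    q v = if does (v ∈? σ ∩ V₁) then b else if does (v ∈? σ ∩ V₂) then a else 0ℚ

    q-pos : ∀ {v} → v ∈ σ → 0ℚ < q v
    q-pos {v} v∈σ with v ∈? σ ∩ V₁ | v ∈? σ ∩ V₂
    ... | yes _   | _       = b>0
    ... | no  _   | yes _   = a>0
    ... | no  v∉₁ | no  v∉₂ = ⊥-elim
      ([ (λ v∈V₁ → v∉₁ (x∈p∩q⁺ (v∈σ , v∈V₁))) , (λ v∈V₂ → v∉₂ (x∈p∩q⁺ (v∈σ , v∈V₂))) ]′ (side v))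

    q-off : ∀ {v} → v ∉ σ → q v ≡ 0ℚ
    q-off {v} v∉σ with v ∈? σ ∩ V₁ | v ∈? σ ∩ V₂
    ... | yes v∈ | _      = ⊥-elim (v∉σ (proj₁ (x∈p∩q⁻ σ V₁ v∈)))
    ... | no  _  | yes v∈ = ⊥-elim (v∉σ (proj₁ (x∈p∩q⁻ σ V₂ v∈)))
    ... | no  _  | no  _  = refl

    q≥0 : ∀ v → 0ℚ ≤ q v
    q≥0 v with v ∈? σ
    ... | yes v∈σ = <⇒≤ (q-pos v∈σ)
    ... | no  v∉σ = ≤-reflexive (sym (q-off v∉σ))

    Z : ℚ
    Z = sum q

    Z>0 : 0ℚ < Z
    Z>0 = sum-pos q q≥0 v₁ (q-pos (proj₁ (x∈p∩q⁻ σ V₁ v₁∈)))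

    instance
      Z-pos : Positive Z
      Z-pos = positive Z>0
      Z-nonZero : NonZero Z
      Z-nonZero = pos⇒nonZero Z

    1/Z>0 : 0ℚ < 1/ Z
    1/Z>0 = positive⁻¹ (1/ Z) {{1/pos⇒pos Z}}

    balance : ∀ v → q v * f v + b * g v ≡ q v * x₀ + a * h v
    balance v with v ∈? σ ∩ V₁ | v ∈? σ ∩ V₂
    ... | yes v∈₁ | yes v∈₂ = ⊥-elim (not-both (proj₂ (x∈p∩q⁻ σ V₁ v∈₁)) (proj₂ (x∈p∩q⁻ σ V₂ v∈₂)))
    ... | yes _   | no  _   = begin
      b * f v + b * (x₀ - f v)  ≡⟨ *-distribˡ-+ b (f v) (x₀ - f v) ⟨
      b * (f v + (x₀ - f v))    ≡⟨ cong (b *_) (y+[x-y]≡x (f v) x₀) ⟩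
      b * x₀                    ≡⟨ +-identityʳ (b * x₀) ⟨
      b * x₀ + 0ℚ               ≡⟨ cong (λ t → b * x₀ + t) (*-zeroʳ a) ⟨
      b * x₀ + a * 0ℚ           ∎
      where open ≡-Reasoning
    ... | no  _   | yes _   = begin
      a * f v + b * 0ℚ            ≡⟨ cong (λ t → a * f v + t) (*-zeroʳ b) ⟩
      a * f v + 0ℚ                ≡⟨ +-identityʳ (a * f v) ⟩
      a * f v                     ≡⟨ cong (a *_) (y+[x-y]≡x x₀ (f v)) ⟨
      a * (x₀ + (f v - x₀))       ≡⟨ *-distribˡ-+ a x₀ (f v - x₀) ⟩
      a * x₀ + a * (f v - x₀)     ∎
      where open ≡-Reasoning
    ... | no  _   | no  _   = cong₂ _+_ (trans (*-zeroˡ (f v)) (sym (*-zeroˡ x₀)))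
                                        (trans (*-zeroʳ b) (sym (*-zeroʳ a)))

    q-level : sum (λ v → q v * f v) ≡ Z * x₀
    q-level = cancel (begin
      sum (λ v → q v * f v) + b * a                    ≡⟨ cong (sum (λ v → q v * f v) +_) (*-distribˡ-sum b g) ⟩
      sum (λ v → q v * f v) + sum (λ v → b * g v)      ≡⟨ ∑-distrib-+ (λ v → q v * f v) (λ v → b * g v) ⟨
      sum (λ v → q v * f v + b * g v)                  ≡⟨ sum-cong-≗ balance ⟩
      sum (λ v → q v * x₀ + a * h v)                   ≡⟨ ∑-distrib-+ (λ v → q v * x₀) (λ v → a * h v) ⟩
      sum (λ v → q v * x₀) + sum (λ v → a * h v)       ≡⟨ cong₂ _+_ (*-distribʳ-sum x₀ q) (*-distribˡ-sum a h) ⟨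
      Z * x₀ + a * b                                   ≡⟨ cong (Z * x₀ +_) (*-comm a b) ⟩
      Z * x₀ + b * a                                   ∎)
      where
      open ≡-Reasoning
      undo : ∀ x y → (x + y) - y ≡ x
      undo x y = trans (+-assoc x y (- y)) (trans (cong (x +_) (+-inverseʳ y)) (+-identityʳ x))
      cancel : ∀ {x y z} → x + z ≡ y + z → x ≡ y
      cancel {x} {y} {z} e = trans (sym (undo x z)) (trans (cong (_- z) e) (undo y z))

    p : Fin n → ℚ
    p v = 1/ Z * q v

    interior : InInterior σ p
    interior = record
      { positive-on = λ v∈σ → pos*pos>0 1/Z>0 (q-pos v∈σ)
      ; zero-off = λ v∉σ → trans (cong (1/ Z *_) (q-off v∉σ)) (*-zeroʳ (1/ Z))
      ; total    = trans (sym (*-distribˡ-sum (1/ Z) q)) (*-inverseˡ Z)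
      }

    level : extend f p ≡ x₀
    level = begin
      sum (λ v → 1/ Z * q v * f v)      ≡⟨ sum-cong-≗ (λ v → *-assoc (1/ Z) (q v) (f v)) ⟩
      sum (λ v → 1/ Z * (q v * f v))    ≡⟨ *-distribˡ-sum (1/ Z) (λ v → q v * f v) ⟨
      1/ Z * sum (λ v → q v * f v)      ≡⟨ cong (1/ Z *_) q-level ⟩
      1/ Z * (Z * x₀)                   ≡⟨ *-assoc (1/ Z) Z x₀ ⟨
      1/ Z * Z * x₀                     ≡⟨ cong (_* x₀) (*-inverseˡ Z) ⟩
      1ℚ * x₀                           ≡⟨ *-identityˡ x₀ ⟩
      x₀                                ∎
      where open ≡-Reasoning

  meetsLevel? : Decidable (MeetsLevel f x₀)
  meetsLevel? σ = map′ bothSides⇒meets meets⇒bothSides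
                       (nonempty? (σ ∩ V₁) ×-dec nonempty? (σ ∩ V₂))

------------------------------------------------------------------------
-- The slicing f⁻¹(x₀)

open import Data.Integer.Base as ℤ using (ℤ; +_)

subsets : (n : ℕ) → List (Subset n)
subsets zero    = [] ∷ []
subsets (suc n) = map (outside ∷_) (subsets n) ++ map (inside ∷_) (subsets n)

count : {P : Pred (Subset n) 0ℓ} → Decidable P → ℕ
count {n} P? = length (filter P? (subsets n))

module Slicing (M : Complex n) {P : Bipartition n} (s : SeparatingRsl P) where
  open Bipartition P
  open SeparatingRsl s

  -- The d-cells of the slicing are the sections by f⁻¹(x₀) of the faces of M
  -- whose relative interior meets f⁻¹(x₀).  As x₀ is not the value of a vertex,
  -- the section has dimension one less than the face, which therefore has
  -- d + 2 vertices.
  Cell : ℕ → Pred (Subset n) 0ℓ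
  Cell d σ = Face M σ × MeetsLevel f x₀ σ × ∣ σ ∣ ≡ 2 ℕ.+ d

  cell? : ∀ d → Decidable (Cell d)
  cell? d σ = Face? M σ ×-dec meetsLevel? s σ ×-dec (∣ σ ∣ ℕ.≟ 2 ℕ.+ d)

  Quadrilateral : Pred (Subset n) 0ℓ
  Quadrilateral σ = Cell 2 σ × ∣ σ ∩ V₁ ∣ ≡ 2 × ∣ σ ∩ V₂ ∣ ≡ 2

  quadrilateral? : Decidable Quadrilateral
  quadrilateral? σ = cell? 2 σ ×-dec (∣ σ ∩ V₁ ∣ ℕ.≟ 2) ×-dec (∣ σ ∩ V₂ ∣ ℕ.≟ 2)

  quadrilaterals : ℕ
  quadrilaterals = count quadrilateral?

  χ : ℤ
  χ = + count (cell? 0) ℤ.- + count (cell? 1) ℤ.+ + count (cell? 2)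

  -- A slicing need not be connected or orientable, so the genus is rational.
  HasGenus : ℚ → Set
  HasGenus g = χ / 1 ≡ + 2 / 1 - + 2 / 1 * g

fromℕ : ℕ → ℚ
fromℕ k = + k / 1

{-# OPTIONS --safe #-}

-- Let f₀, ..., f₃ be the face numbers of M, and let v, e, t, q be the numbers of vertices, edges,
-- triangles and quadrilaterals of the slicing.  Stellar moves preserve the property that the sum
-- of (-1)^∣τ∣ over the faces τ ⊇ σ is the same sign for all faces σ, so it passes from ∂Δ³ to the
-- vertex links, and in M this sum is 1 for every face σ ≠ ∅.  Summed over the vertices and over the
-- triangles of M it yields f₃ = f₁ - f₀ = n(n - 3)/2, and summed over the triangles meeting both
-- V₁ and V₂ it yields 2e = 3t + 4q.  As v = ∣V₁∣∣V₂∣, the inequality then says that t + q ≤ f₃.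
--
-- Equality thus means that no tetrahedron lies in V₁ or in V₂.  For n = 2k take the boundary of
-- the cyclic 4-polytope with vertices alternating between V₁ and V₂: its facets are the unions of two
-- disjoint edges of a 2k-cycle, hence all of them give quadrilaterals, and the vertex links arise
-- from ∂Δ³ by starring triangles.

module Submission where

open import Defs hiding (sum; sum-cong-≗; ∑-distrib-+; *-distribˡ-sum; *-distribʳ-sum)
open import Algebra.Bundles using (CommutativeRing)
import Algebra.Properties.CommutativeSemigroup
import Algebra.Properties.Ring
open import Algebra.Structures using (IsCommutativeRing)
open import Data.Empty using (⊥-elim)
open import Data.Fin.Base using (Fin; zero; suc; toℕ; fromℕ<; _↑ˡ_; _↑ʳ_; splitAt)
import Data.Fin.Properties as Fin
open import Data.Fin.Subset
  using (Subset; inside; outside; ⊥; ⊤; ⁅_⁆; _∈_; _∉_; _⊆_; _⊈_; _⊂_; _∪_; _∩_; ∁; ∣_∣; Nonempty)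
import Data.Fin.Subset as Subset
open import Data.Fin.Subset.Properties
import Data.Integer.Base as ℤ
import Data.Integer.Properties as ℤ
import Data.Integer.Tactic.RingSolver as ℤSolver
open import Data.List.Base
  using (List; []; _∷_; _++_; _∷ʳ_; [_]; map; filter; length; lookup; allFin; tabulate; InitLast; initLast; _∷ʳ′_)
import Data.List.Properties as List
open import Data.List.Membership.Propositional using (find; lose) renaming (_∈_ to _∈ₗ_; _∉_ to _∉ₗ_)
open import Data.List.Membership.Propositional.Properties
  using (∈-allFin; ∈-∃++; ∈-++⁺ˡ; ∈-++⁺ʳ; ∈-++⁻; ∈-lookup)
open import Data.List.Relation.Binary.Permutation.Propositional as ↭ using (_↭_; ↭-sym; prep; ↭⇒↭ₛ)
import Data.List.Relation.Binary.Permutation.Propositional.Properties as ↭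
import Data.List.Relation.Binary.Permutation.Setoid.Properties as ↭ₛ
open import Data.List.Relation.Unary.All as All using (All; []; _∷_)
open import Data.List.Relation.Unary.AllPairs using ([]; _∷_)
open import Data.List.Relation.Unary.Any as Any using (Any; here; there; any?)
open import Data.List.Relation.Unary.Any.Properties using (lookup-index)
open import Data.List.Relation.Unary.Unique.Propositional using (Unique)
import Data.List.Relation.Unary.Unique.Propositional.Properties as Unique
open import Data.Nat.Base as ℕ using (ℕ; zero; suc)
open import Data.Nat.Combinatorics using (_C_; nCk+nC[k+1]≡[n+1]C[k+1])
import Data.Nat.Properties as ℕ
open import Data.Product using (∃; ∃₂; Σ; _×_; _,_; proj₁; proj₂)
open import Data.Rational.Solver using (module +-*-Solver)
open import Data.Sum.Base using (_⊎_; inj₁; inj₂; [_,_]′)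
open import Data.Vec.Base using ([]; _∷_; here; there)
open import Data.Vec.Properties using (∷-injectiveʳ; ≡-dec)
open import Function.Base using (_∘_; id)
open import Level using (0ℓ)
open import Relation.Binary.Construct.Closure.ReflexiveTransitive using (Star; ε; _◅_)
open import Relation.Binary.Construct.Closure.Symmetric using (SymClosure; fwd; bwd)
open import Relation.Binary.PropositionalEquality hiding ([_])
open import Relation.Nullary.Decidable
  using (Dec; yes; no; does; True; toWitness; _×-dec_; _⊎-dec_; _→-dec_; ¬?)
open import Relation.Nullary.Negation using (¬_)
open import Relation.Unary using (Pred; Decidable)

-- A chain of stellar moves may subdivide and undo subdivisions in any order, so what is used of the
-- links has to survive both directions. The signed sums do, by pure cancellation: if `a` lies in
-- `A`, adding or removing `a` keeps `τ ∪ A` and flips the sign.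
--
-- To sum over the faces, give each face `σ` a weight that depends only on its numbers of vertices
-- in the two parts and count the pairs `σ ⊆ τ` twice. Each weight yields a linear relation between
-- face counts, whose coefficients are functions of two numbers `a` and `b` with `a + b ≤ 4`; they
-- are compared by evaluation.
--
-- The constants arise as follows. With f = t + q for the number of 2-cells, 2e = 3f + q turns 2χ =
-- 2v - 2e + 2f into q + f = 2v - 2χ, that is 2∣V₁∣∣V₂∣ + 4g - 4. As the two parts differ in size by
-- 2c, 2∣V₁∣∣V₂∣ - n(n - 3)/2 = 3n/2 - 2c². So the right-hand side of the inequality is exactly q +
-- f minus the number of tetrahedra of M.

private
  variable
    n m : ℕ

infixl 1 _∙_
_∙_ : {A : Set} {x y z : A} → x ≡ y → y ≡ z → x ≡ z
_∙_ = trans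

-- Finite subsets

∪-absorb : {σ A : Subset n} → A ⊆ σ → σ ∪ A ≡ σ
∪-absorb {A = A} A⊆σ = ⊆-antisym (∪-lub id A⊆σ) (p⊆p∪q A)

0∉outside : {p : Subset n} → zero ∉ outside ∷ p
0∉outside ()

x∉p-x : ∀ (p : Subset n) x → x ∉ p Subset.- x
x∉p-x (outside ∷ p) zero    ()
x∉p-x (inside  ∷ p) zero    ()
x∉p-x (_       ∷ p) (suc x) (there x∈) = x∉p-x p x x∈

p-x∪⁅x⁆≡p : ∀ {p : Subset n} {x} → x ∈ p → (p Subset.- x) ∪ ⁅ x ⁆ ≡ p
p-x∪⁅x⁆≡p {p = p} {x} x∈p = ⊆-antisym
  (∪-lub (p─q⊆p p ⁅ x ⁆) (λ y∈ → subst (_∈ p) (sym (x∈⁅y⁆⇒x≡y x y∈)) x∈p)) restore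
  where
  restore : p ⊆ (p Subset.- x) ∪ ⁅ x ⁆
  restore {y} y∈p with y ∈? ⁅ x ⁆
  ... | yes y∈ = q⊆p∪q (p Subset.- x) ⁅ x ⁆ y∈
  ... | no  y∉ = p⊆p∪q ⁅ x ⁆ (x∈p∧x∉q⇒x∈p─q y∈p y∉)

⁅x⁆⊆ : ∀ {p : Subset n} {x} → x ∈ p → ⁅ x ⁆ ⊆ p
⁅x⁆⊆ {p = p} {x} x∈p y∈ = subst (_∈ p) (sym (x∈⁅y⁆⇒x≡y x y∈)) x∈p

⊤⊈⇒⊂⊤ : {p : Subset n} → ⊤ ⊈ p → p ⊂ ⊤
⊤⊈⇒⊂⊤ {p = p} ⊤⊈p with p ⊂? ⊤
... | yes p⊂⊤ = p⊂⊤
... | no  p⊄⊤ = ⊥-elim (⊤⊈p λ {x} _ → [ id , (λ x∉p → ⊥-elim (p⊄⊤ (⊆⊤ , x , ∈⊤ , x∉p))) ]′ (dec x))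
  where
  dec : ∀ x → x ∈ p ⊎ x ∉ p
  dec x with x ∈? p
  ... | yes x∈p = inj₁ x∈p
  ... | no  x∉p = inj₂ x∉p

∣p∪q∣≤∣p∣+∣q∣ : ∀ (p q : Subset n) → ∣ p ∪ q ∣ ℕ.≤ ∣ p ∣ ℕ.+ ∣ q ∣
∣p∪q∣≤∣p∣+∣q∣ []            []            = ℕ.z≤n
∣p∪q∣≤∣p∣+∣q∣ (outside ∷ p) (outside ∷ q) = ∣p∪q∣≤∣p∣+∣q∣ p q
∣p∪q∣≤∣p∣+∣q∣ (outside ∷ p) (inside  ∷ q) =
  subst (suc ∣ p ∪ q ∣ ℕ.≤_) (sym (ℕ.+-suc ∣ p ∣ ∣ q ∣)) (ℕ.s≤s (∣p∪q∣≤∣p∣+∣q∣ p q))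
∣p∪q∣≤∣p∣+∣q∣ (inside  ∷ p) (outside ∷ q) = ℕ.s≤s (∣p∪q∣≤∣p∣+∣q∣ p q)
∣p∪q∣≤∣p∣+∣q∣ (inside  ∷ p) (inside  ∷ q) =
  ℕ.s≤s (ℕ.≤-trans (∣p∪q∣≤∣p∣+∣q∣ p q) (ℕ.+-monoʳ-≤ ∣ p ∣ (ℕ.n≤1+n ∣ q ∣)))

∈-image⁺ : ∀ (f : Fin n → Fin m) {σ v} → v ∈ σ → f v ∈ image f σ
∈-image⁺ f {inside ∷ σ}  {zero}  here       = p⊆p∪q (image (f ∘ suc) σ) (x∈⁅x⁆ (f zero))
∈-image⁺ f {inside ∷ σ}  {suc v} (there v∈) = q⊆p∪q ⁅ f zero ⁆ (image (f ∘ suc) σ) (∈-image⁺ (f ∘ suc) v∈)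
∈-image⁺ f {outside ∷ σ} {suc v} (there v∈) = ∈-image⁺ (f ∘ suc) v∈

∈-image⁻ : ∀ (f : Fin n → Fin m) σ {w} → w ∈ image f σ → ∃ λ v → v ∈ σ × f v ≡ w
∈-image⁻ f []            w∈ = ⊥-elim (∉⊥ w∈)
∈-image⁻ f (outside ∷ σ) w∈ with v , v∈ , eq ← ∈-image⁻ (f ∘ suc) σ w∈ = suc v , there v∈ , eq
∈-image⁻ f (inside  ∷ σ) w∈ with x∈p∪q⁻ ⁅ f zero ⁆ (image (f ∘ suc) σ) w∈
... | inj₁ w∈f0 = zero , here , sym (x∈⁅y⁆⇒x≡y (f zero) w∈f0)
... | inj₂ w∈fσ with v , v∈ , eq ← ∈-image⁻ (f ∘ suc) σ w∈fσ = suc v , there v∈ , eq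

image-mono : ∀ (f : Fin n → Fin m) {σ τ} → σ ⊆ τ → image f σ ⊆ image f τ
image-mono f {σ} σ⊆τ w∈ with v , v∈ , refl ← ∈-image⁻ f σ w∈ = ∈-image⁺ f (σ⊆τ v∈)

∣image∣≤ : ∀ (f : Fin n → Fin m) σ → ∣ image f σ ∣ ℕ.≤ ∣ σ ∣
∣image∣≤ {m = m} f [] = ℕ.≤-reflexive (∣⊥∣≡0 m)
∣image∣≤ f (outside ∷ σ) = ∣image∣≤ (f ∘ suc) σ
∣image∣≤ f (inside  ∷ σ) = ℕ.≤-trans (∣p∪q∣≤∣p∣+∣q∣ ⁅ f zero ⁆ _)
  (ℕ.+-mono-≤ (ℕ.≤-reflexive (∣⁅x⁆∣≡1 (f zero))) (∣image∣≤ (f ∘ suc) σ))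

complement : (V W : Subset n) → V ∪ W ≡ ⊤ → V ∩ W ≡ ⊥ → W ≡ ∁ V
complement []            []            c d = refl
complement (outside ∷ V) (inside ∷ W)  c d = cong (inside ∷_) (complement V W (∷-injectiveʳ c) (∷-injectiveʳ d))
complement (inside ∷ V)  (outside ∷ W) c d = cong (outside ∷_) (complement V W (∷-injectiveʳ c) (∷-injectiveʳ d))

∣∩∣+∣∩∁∣ : (σ V : Subset n) → ∣ σ ∩ V ∣ ℕ.+ ∣ σ ∩ ∁ V ∣ ≡ ∣ σ ∣
∣∩∣+∣∩∁∣ []            []            = refl
∣∩∣+∣∩∁∣ (outside ∷ σ) (_ ∷ V)       = ∣∩∣+∣∩∁∣ σ V
∣∩∣+∣∩∁∣ (inside  ∷ σ) (outside ∷ V) = ℕ.+-suc _ _ ∙ cong suc (∣∩∣+∣∩∁∣ σ V)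
∣∩∣+∣∩∁∣ (inside  ∷ σ) (inside ∷ V)  = cong suc (∣∩∣+∣∩∁∣ σ V)

nonempty-∣∣ : {σ : Subset n} → Nonempty σ → 1 ℕ.≤ ∣ σ ∣
nonempty-∣∣ {σ = inside  ∷ σ} (zero  , here)     = ℕ.s≤s ℕ.z≤n
nonempty-∣∣ {σ = inside  ∷ σ} (suc v , there v∈) = ℕ.s≤s ℕ.z≤n
nonempty-∣∣ {σ = outside ∷ σ} (suc v , there v∈) = nonempty-∣∣ (v , v∈)

∣∣-nonempty : {σ : Subset n} → 1 ℕ.≤ ∣ σ ∣ → Nonempty σ
∣∣-nonempty {σ = inside  ∷ σ} _ = zero , here
∣∣-nonempty {σ = outside ∷ σ} h with v , v∈ ← ∣∣-nonempty {σ = σ} h = suc v , there v∈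

∣σ∣≡0⇒σ≡⊥ : (σ : Subset n) → ∣ σ ∣ ≡ 0 → σ ≡ ⊥
∣σ∣≡0⇒σ≡⊥ []            _ = refl
∣σ∣≡0⇒σ≡⊥ (outside ∷ σ) e = cong (outside ∷_) (∣σ∣≡0⇒σ≡⊥ σ e)

∣σ∣≡1⇒σ≡⁅v⁆ : (σ : Subset n) → ∣ σ ∣ ≡ 1 → ∃ λ v → σ ≡ ⁅ v ⁆
∣σ∣≡1⇒σ≡⁅v⁆ (inside  ∷ σ) e = zero , cong (inside ∷_) (∣σ∣≡0⇒σ≡⊥ σ (ℕ.suc-injective e))
∣σ∣≡1⇒σ≡⁅v⁆ (outside ∷ σ) e with v , eq ← ∣σ∣≡1⇒σ≡⁅v⁆ σ e = suc v , cong (outside ∷_) eq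

∣σ∣≡2⇒σ≡⁅v,w⁆ : (σ : Subset n) → ∣ σ ∣ ≡ 2 → ∃ λ v → ∃ λ w → v ≢ w × σ ≡ ⁅ v ⁆ ∪ ⁅ w ⁆
∣σ∣≡2⇒σ≡⁅v,w⁆ (inside  ∷ σ) e with w , refl ← ∣σ∣≡1⇒σ≡⁅v⁆ σ (ℕ.suc-injective e) =
  zero , suc w , (λ ()) , cong (inside ∷_) (sym (∪-identityˡ ⁅ w ⁆))
∣σ∣≡2⇒σ≡⁅v,w⁆ (outside ∷ σ) e with v , w , v≢w , eq ← ∣σ∣≡2⇒σ≡⁅v,w⁆ σ e =
  suc v , suc w , (λ { refl → v≢w refl }) , cong (outside ∷_) eq

-- Isomorphisms of complexes

module _ {K : Complex n} {L : Complex m} (K≅L : K ≅ L) where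
  open _≅_ K≅L

  ≅-sym : L ≅ K
  ≅-sym = record
    { to = from ; from = to ; to-face = from-face ; from-face = to-face
    ; from-to = to-from ; to-from = from-to }

  image-from-to : ∀ {σ} → Face K σ → image from (image to σ) ≡ σ
  image-from-to {σ} σ∈K = ⊆-antisym back forth
    where
    vertex : ∀ {v} → v ∈ σ → from (to v) ≡ v
    vertex v∈σ = from-to (downward K (⁅x⁆⊆ v∈σ) σ∈K)
    back : image from (image to σ) ⊆ σ
    back w∈ with u , u∈ , refl ← ∈-image⁻ from (image to σ) w∈
            with v , v∈ , refl ← ∈-image⁻ to σ u∈ = subst (_∈ σ) (sym (vertex v∈)) v∈
    forth : σ ⊆ image from (image to σ)
    forth v∈ = subst (_∈ _) (vertex v∈) (∈-image⁺ from (∈-image⁺ to v∈))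

  -- Taking images can only merge vertices, and `from` undoes `to` on faces, so the size is squeezed
  -- from both sides.
  ∣image-to∣ : ∀ {σ} → Face K σ → ∣ image to σ ∣ ≡ ∣ σ ∣
  ∣image-to∣ {σ} σ∈K = ℕ.≤-antisym (∣image∣≤ to σ)
    (subst (λ x → ∣ x ∣ ℕ.≤ ∣ image to σ ∣) (image-from-to σ∈K) (∣image∣≤ from (image to σ)))

-- Alternating sums over the faces of a complex

-- Over an abstract ring, unlike over ℤ, the operations do not reduce, so the summands can be inferred.
module EulerSums {Z : Set} {add mul : Z → Z → Z} {neg : Z → Z} {0z 1z : Z}
                 (isCommutativeRing : IsCommutativeRing _≡_ add mul neg 0z 1z) where

  private
    R : CommutativeRing 0ℓ 0ℓ
    R = record { isCommutativeRing = isCommutativeRing }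

  open CommutativeRing R
    using (_+_; _*_; -_; _-_; 0#; 1#; +-assoc; +-identityˡ; +-identityʳ; -‿inverseˡ; -‿inverseʳ;
           *-assoc; *-comm; *-identityˡ; *-identityʳ; distribˡ; distribʳ; zeroˡ; zeroʳ)

  open Algebra.Properties.CommutativeSemigroup (CommutativeRing.+-commutativeSemigroup R) using (interchange)
  open Algebra.Properties.CommutativeSemigroup (CommutativeRing.*-commutativeSemigroup R) using (x∙yz≈y∙xz)
  open Algebra.Properties.Ring (CommutativeRing.ring R) using (-‿+-comm; -‿distribˡ-*; -‿distribʳ-*; -‿involutive)

  private
    0+0 : 0# + 0# ≡ 0#
    0+0 = +-identityʳ 0#

    0-0 : 0# - 0# ≡ 0#
    0-0 = -‿inverseʳ 0#

    neg0 : - 0# ≡ 0#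
    neg0 = trans (sym (+-identityˡ (- 0#))) 0-0

  ind : {P : Set} → Dec P → Z
  ind (yes _) = 1#
  ind (no _)  = 0#

  ind-yes : {P : Set} (P? : Dec P) → P → ind P? ≡ 1#
  ind-yes (yes _) p = refl
  ind-yes (no ¬p) p = ⊥-elim (¬p p)

  ind-no : {P : Set} (P? : Dec P) → ¬ P → ind P? ≡ 0#
  ind-no (yes p) ¬p = ⊥-elim (¬p p)
  ind-no (no _)  ¬p = refl

  ind-cong : {P Q : Set} {P? : Dec P} {Q? : Dec Q} → (P → Q) → (Q → P) → ind P? ≡ ind Q?
  ind-cong {P? = yes p} {Q?} f g = sym (ind-yes Q? (f p))
  ind-cong {P? = no ¬p} {Q?} f g = sym (ind-no Q? (¬p ∘ g))

  ind-⊆ : {σ τ : Subset n} {σ₁ τ₁ : Subset m} → (σ ⊆ τ → σ₁ ⊆ τ₁) → (σ₁ ⊆ τ₁ → σ ⊆ τ) →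
          ind (σ ⊆? τ) ≡ ind (σ₁ ⊆? τ₁)
  ind-⊆ {σ = σ} {τ} {σ₁} {τ₁} f g = ind-cong {P = σ ⊆ τ} {Q = σ₁ ⊆ τ₁} f g

  ind-× : {P Q : Set} (P? : Dec P) (Q? : Dec Q) → ind (P? ×-dec Q?) ≡ ind P? * ind Q?
  ind-× (yes _) (yes _) = sym (*-identityˡ 1#)
  ind-× (yes _) (no _)  = sym (*-identityˡ 0#)
  ind-× (no _)  (yes _) = sym (zeroˡ 1#)
  ind-× (no _)  (no _)  = sym (zeroˡ 0#)

  ind-¬ : {P : Set} (P? : Dec P) → ind (¬? P?) ≡ 1# - ind P?
  ind-¬ (yes _) = sym (-‿inverseʳ 1#)
  ind-¬ (no _)  = sym (trans (cong (1# +_) neg0) (+-identityʳ 1#))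

  Σ⊆ : (Subset n → Z) → Z
  Σ⊆ {zero}  f = f []
  Σ⊆ {suc n} f = Σ⊆ (f ∘ (outside ∷_)) + Σ⊆ (f ∘ (inside ∷_))

  Σ⊆-cong : {f g : Subset n → Z} → (∀ σ → f σ ≡ g σ) → Σ⊆ f ≡ Σ⊆ g
  Σ⊆-cong {zero}  f≗g = f≗g []
  Σ⊆-cong {suc n} f≗g = cong₂ _+_ (Σ⊆-cong (f≗g ∘ (outside ∷_))) (Σ⊆-cong (f≗g ∘ (inside ∷_)))

  Σ⊆-+ : (f g : Subset n → Z) → Σ⊆ (λ σ → f σ + g σ) ≡ Σ⊆ f + Σ⊆ g
  Σ⊆-+ {zero}  f g = refl
  Σ⊆-+ {suc n} f g = trans (cong₂ _+_ (Σ⊆-+ (f ∘ (outside ∷_)) (g ∘ (outside ∷_)))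
                                      (Σ⊆-+ (f ∘ (inside ∷_)) (g ∘ (inside ∷_))))
    (interchange _ _ _ _)

  Σ⊆-*ˡ : ∀ c (f : Subset n → Z) → Σ⊆ (λ σ → c * f σ) ≡ c * Σ⊆ f
  Σ⊆-*ˡ {zero}  c f = refl
  Σ⊆-*ˡ {suc n} c f = trans (cong₂ _+_ (Σ⊆-*ˡ c (f ∘ (outside ∷_))) (Σ⊆-*ˡ c (f ∘ (inside ∷_))))
    (sym (distribˡ c _ _))

  Σ⊆-0 : {f : Subset n → Z} → (∀ σ → f σ ≡ 0#) → Σ⊆ f ≡ 0#
  Σ⊆-0 {zero}  f≗0 = f≗0 []
  Σ⊆-0 {suc n} f≗0 = trans (cong₂ _+_ (Σ⊆-0 (f≗0 ∘ (outside ∷_))) (Σ⊆-0 (f≗0 ∘ (inside ∷_)))) 0+0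

  Σ⊆-neg : (f : Subset n → Z) → Σ⊆ (λ σ → - f σ) ≡ - Σ⊆ f
  Σ⊆-neg {zero}  f = refl
  Σ⊆-neg {suc n} f = trans (cong₂ _+_ (Σ⊆-neg (f ∘ (outside ∷_))) (Σ⊆-neg (f ∘ (inside ∷_))))
    (-‿+-comm _ _)

  Σ⊆-swap : (f : Subset n → Subset m → Z) →
            Σ⊆ (λ σ → Σ⊆ (f σ)) ≡ Σ⊆ (λ τ → Σ⊆ (λ σ → f σ τ))
  Σ⊆-swap {zero}  f = refl
  Σ⊆-swap {suc n} {m} f = trans (cong₂ _+_ (Σ⊆-swap (f ∘ (outside ∷_))) (Σ⊆-swap (f ∘ (inside ∷_))))
    (sym (Σ⊆-+ {m} _ _))

  _≟ˢ_ : (σ τ : Subset n) → Dec (σ ≡ τ)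
  _≟ˢ_ = ≡-dec _≟ᵇ_
    where open import Data.Bool.Properties using () renaming (_≟_ to _≟ᵇ_)

  Σ⊆-δ : ∀ σ (f : Subset n → Z) → Σ⊆ (λ τ → ind (σ ≟ˢ τ) * f τ) ≡ f σ
  Σ⊆-δ []            f = *-identityˡ (f [])
  Σ⊆-δ (outside ∷ σ) f = trans (cong₂ _+_
    (trans (Σ⊆-cong λ τ → cong (_* f (outside ∷ τ)) (ind-cong ∷-injectiveʳ (cong (outside ∷_))))
           (Σ⊆-δ σ (f ∘ (outside ∷_))))
    (Σ⊆-0 λ τ → cong (_* f (inside ∷ τ)) (ind-no ((outside ∷ σ) ≟ˢ (inside ∷ τ)) λ ()) ∙ zeroˡ _))
    (+-identityʳ _)
  Σ⊆-δ (inside ∷ σ)  f = trans (cong₂ _+_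
    (Σ⊆-0 λ τ → cong (_* f (outside ∷ τ)) (ind-no ((inside ∷ σ) ≟ˢ (outside ∷ τ)) λ ()) ∙ zeroˡ _)
    (trans (Σ⊆-cong λ τ → cong (_* f (inside ∷ τ)) (ind-cong ∷-injectiveʳ (cong (inside ∷_))))
           (Σ⊆-δ σ (f ∘ (inside ∷_)))))
    (+-identityˡ _)

  -- E k σ = Σ_{τ ⊇ σ} (-1)^∣τ∣ k τ; for the indicator k of a complex this is, up to
  -- sign, the reduced Euler characteristic of the link of σ.
  E : (Subset n → Z) → Subset n → Z
  E k []            = k []
  E k (outside ∷ σ) = E (k ∘ (outside ∷_)) σ - E (k ∘ (inside ∷_)) σ
  E k (inside  ∷ σ) = - E (k ∘ (inside ∷_)) σ

  E-cong : {k l : Subset n → Z} → (∀ τ → k τ ≡ l τ) → ∀ σ → E k σ ≡ E l σ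
  E-cong k≗l []            = k≗l []
  E-cong k≗l (outside ∷ σ) = cong₂ _-_ (E-cong (k≗l ∘ (outside ∷_)) σ) (E-cong (k≗l ∘ (inside ∷_)) σ)
  E-cong k≗l (inside  ∷ σ) = cong -_ (E-cong (k≗l ∘ (inside ∷_)) σ)

  E-minus : ∀ (k l : Subset n → Z) σ → E (λ τ → k τ - l τ) σ ≡ E k σ - E l σ
  E-minus k l []            = refl
  E-minus k l (outside ∷ σ) = trans (cong₂ _-_ (E-minus _ _ σ) (E-minus _ _ σ)) (lem _ _ _ _)
    where
    lem : ∀ a b c d → (a - b) - (c - d) ≡ (a - c) - (b - d)
    lem a b c d = cong ((a - b) +_) (sym (-‿+-comm c (- d))) ∙ interchange a (- b) (- c) (- (- d))
                  ∙ cong ((a - c) +_) (-‿+-comm b (- d))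
  E-minus k l (inside  ∷ σ) = trans (cong -_ (E-minus _ _ σ)) (sym (-‿+-comm _ _))

  E-zero : {k : Subset n → Z} → ∀ σ → (∀ τ → σ ⊆ τ → k τ ≡ 0#) → E k σ ≡ 0#
  E-zero []            k≡0 = k≡0 [] id
  E-zero (outside ∷ σ) k≡0 = cong₂ _-_ (E-zero σ (λ τ σ⊆τ → k≡0 (outside ∷ τ) (out⊆ σ⊆τ)))
                                       (E-zero σ (λ τ σ⊆τ → k≡0 (inside ∷ τ) (out⊆ σ⊆τ))) ∙ 0-0
  E-zero (inside  ∷ σ) k≡0 = cong -_ (E-zero σ (λ τ σ⊆τ → k≡0 (inside ∷ τ) (in⊆in σ⊆τ))) ∙ neg0

  sgn : Subset n → Z
  sgn []            = 1#
  sgn (outside ∷ τ) = sgn τ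
  sgn (inside  ∷ τ) = - sgn τ

  -- The recursion defining `E` follows the order of the labels and so cannot follow a relabelling;
  -- this closed form can.
  E-Σ⊆ : (k : Subset n → Z) (σ : Subset n) →
         E k σ ≡ Σ⊆ (λ τ → k τ * (ind (σ ⊆? τ) * sgn τ))
  E-Σ⊆ k []            = sym (trans (cong (λ x → k [] * (x * 1#)) (ind-yes ([] ⊆? []) id))
    (cong (k [] *_) (*-identityʳ _) ∙ *-identityʳ _))
  E-Σ⊆ {suc n} k (outside ∷ σ) = cong₂ _+_
    (trans (E-Σ⊆ (k ∘ (outside ∷_)) σ) (Σ⊆-cong λ τ →
      cong (λ x → k (outside ∷ τ) * (x * sgn τ)) (ind-⊆ (λ h → out⊆ h) (λ h → drop-∷-⊆ h))))
    (trans (trans (cong -_ (E-Σ⊆ (k ∘ (inside ∷_)) σ)) (sym (Σ⊆-neg {n} _))) (Σ⊆-cong λ τ →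
      trans (lem (k (inside ∷ τ)) (ind (σ ⊆? τ)) (sgn τ))
        (cong (λ x → k (inside ∷ τ) * (x * - sgn τ)) (ind-⊆ (λ h → out⊆ h) (λ h → drop-∷-⊆ h)))))
    where
    lem : ∀ a b c → - (a * (b * c)) ≡ a * (b * - c)
    lem a b c = -‿distribʳ-* a (b * c) ∙ cong (a *_) (-‿distribʳ-* b c)
  E-Σ⊆ {suc n} k (inside ∷ σ) = sym (trans (cong₂ _+_
    (Σ⊆-0 λ τ → trans (cong (λ x → k (outside ∷ τ) * (x * sgn τ))
                            (ind-no ((inside ∷ σ) ⊆? (outside ∷ τ)) (λ h → 0∉outside (h here))))
                      (cong (k (outside ∷ τ) *_) (zeroˡ _) ∙ zeroʳ _))
    (trans (Σ⊆-cong λ τ → trans (cong (λ x → k (inside ∷ τ) * (x * - sgn τ)) (ind-⊆ (λ h → drop-∷-⊆ h) (λ h → in⊆in h)))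
                                (lem (k (inside ∷ τ)) (ind (σ ⊆? τ)) (sgn τ)))
      (trans (Σ⊆-neg {n} _) (cong -_ (sym (E-Σ⊆ (k ∘ (inside ∷_)) σ))))))
    (+-identityˡ _))
    where
    lem : ∀ a b c → a * (b * - c) ≡ - (a * (b * c))
    lem a b c = sym (-‿distribʳ-* a (b * c) ∙ cong (a *_) (-‿distribʳ-* b c))

  -- Some element of `A` is missing from `σ`. Toggling it in `τ` leaves `τ ∪ A` unchanged and
  -- reverses the sign, so the terms cancel in pairs.
  E-∪ : ∀ (k : Subset n → Z) A σ → A ⊈ σ → E (λ τ → k (τ ∪ A)) σ ≡ 0#
  E-∪ k []            []            A⊈σ = ⊥-elim (A⊈σ id)
  E-∪ k (outside ∷ A) (outside ∷ σ) A⊈σ =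
    cong₂ _-_ (E-∪ (k ∘ (outside ∷_)) A σ (λ h → A⊈σ (out⊆ h)))
              (E-∪ (k ∘ (inside ∷_)) A σ (λ h → A⊈σ (out⊆ h))) ∙ 0-0
  E-∪ k (outside ∷ A) (inside ∷ σ)  A⊈σ =
    cong -_ (E-∪ (k ∘ (inside ∷_)) A σ (λ h → A⊈σ (out⊆ h))) ∙ neg0
  E-∪ k (inside ∷ A)  (outside ∷ σ) A⊈σ = -‿inverseʳ (E (λ τ → k (inside ∷ (τ ∪ A))) σ)
  E-∪ k (inside ∷ A)  (inside ∷ σ)  A⊈σ =
    cong -_ (E-∪ (k ∘ (inside ∷_)) A σ (λ h → A⊈σ (in⊆in h))) ∙ neg0

  -- Both sides run over the sets that contain `σ` as well as `A`.
  E-⊆ : ∀ (k : Subset n → Z) A σ → E (λ τ → ind (A ⊆? τ) * k τ) σ ≡ E k (σ ∪ A)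
  E-⊆ k []      []      = trans (cong (_* k []) (ind-yes ([] ⊆? []) id)) (*-identityˡ _)
  E-⊆ k (a ∷ A) (s ∷ σ) = go a s
    where
    any : ∀ t → E (λ τ → ind ((outside ∷ A) ⊆? (t ∷ τ)) * k (t ∷ τ)) σ ≡ E (k ∘ (t ∷_)) (σ ∪ A)
    any t = trans (E-cong (λ τ → cong (_* k (t ∷ τ)) (ind-⊆ (λ h → drop-∷-⊆ h) (λ h → out⊆ h))) σ)
                  (E-⊆ (k ∘ (t ∷_)) A σ)
    ii : E (λ τ → ind ((inside ∷ A) ⊆? (inside ∷ τ)) * k (inside ∷ τ)) σ ≡ E (k ∘ (inside ∷_)) (σ ∪ A)
    ii = trans (E-cong (λ τ → cong (_* k (inside ∷ τ)) (ind-⊆ (λ h → drop-∷-⊆ h) (λ h → in⊆in h))) σ)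
               (E-⊆ (k ∘ (inside ∷_)) A σ)
    go : ∀ a s → E (λ τ → ind ((a ∷ A) ⊆? τ) * k τ) (s ∷ σ) ≡ E k ((s ∷ σ) ∪ (a ∷ A))
    go outside outside = cong₂ _-_ (any outside) (any inside)
    go outside inside  = cong -_ (any inside)
    go inside  outside = trans (cong₂ _-_
      (E-zero σ (λ τ _ → cong (_* k (outside ∷ τ))
        (ind-no ((inside ∷ A) ⊆? (outside ∷ τ)) (λ h → 0∉outside (h here))) ∙ zeroˡ _)) ii)
      (+-identityˡ _)
    go inside  inside  = cong -_ ii

  -- Eulerian complexes and stellar moves

  ⟦_⟧ : Complex n → Subset n → Z
  ⟦ K ⟧ σ = ind (Face? K σ)

  -- The sign is that of a 2-sphere: a triangle is contained in no other face and counts (-1)³. For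
  -- the empty face the condition is Euler's formula.
  Eulerian : Complex n → Set
  Eulerian K = ∀ {σ} → Face K σ → E ⟦ K ⟧ σ ≡ (- 1#)

  E-∉ : (K : Complex n) → ∀ {σ} → ¬ Face K σ → E ⟦ K ⟧ σ ≡ 0#
  E-∉ K {σ} σ∉K = E-zero σ λ τ σ⊆τ → ind-no (Face? K τ) (λ τ∈K → σ∉K (downward K σ⊆τ τ∈K))

  [1-x]y : ∀ x y → (1# - x) * y ≡ y - x * y
  [1-x]y x y = distribʳ y 1# (- x) ∙ cong₂ _+_ (*-identityˡ y) (sym (-‿distribˡ-* x y))

  -- The correction term is the same for the faces with and without the new vertex, as τ ∪ A = τ when A ⊆ τ.
  module _ (K : Complex n) (A : Subset n) (A≢∅ : Nonempty A) where
    private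
      k = ⟦ K ⟧
      s = ⟦ star-at K A A≢∅ ⟧

    star-outside : ∀ τ → s (outside ∷ τ) ≡ k τ - ind (A ⊆? τ) * k τ
    star-outside τ = begin
      s (outside ∷ τ)                ≡⟨ ind-× (Face? K τ) (¬? (A ⊆? τ)) ⟩
      k τ * ind (¬? (A ⊆? τ))        ≡⟨ cong (k τ *_) (ind-¬ (A ⊆? τ)) ⟩
      k τ * (1# - ind (A ⊆? τ))      ≡⟨ *-comm _ _ ⟩
      (1# - ind (A ⊆? τ)) * k τ      ≡⟨ [1-x]y _ _ ⟩
      k τ - ind (A ⊆? τ) * k τ       ∎
      where open ≡-Reasoning

    star-inside : ∀ τ → s (inside ∷ τ) ≡ k (τ ∪ A) - ind (A ⊆? τ) * k τ
    star-inside τ = begin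
      s (inside ∷ τ)                          ≡⟨ ind-× (Face? K (τ ∪ A)) (¬? (A ⊆? τ)) ⟩
      k (τ ∪ A) * ind (¬? (A ⊆? τ))           ≡⟨ cong (k (τ ∪ A) *_) (ind-¬ (A ⊆? τ)) ⟩
      k (τ ∪ A) * (1# - ind (A ⊆? τ))         ≡⟨ *-comm _ _ ⟩
      (1# - ind (A ⊆? τ)) * k (τ ∪ A)         ≡⟨ [1-x]y _ _ ⟩
      k (τ ∪ A) - ind (A ⊆? τ) * k (τ ∪ A)    ≡⟨ cong (λ x → k (τ ∪ A) - x) (absorb (A ⊆? τ)) ⟩
      k (τ ∪ A) - ind (A ⊆? τ) * k τ          ∎
      where
      open ≡-Reasoning
      absorb : (A⊆τ? : Dec (A ⊆ τ)) → ind A⊆τ? * k (τ ∪ A) ≡ ind A⊆τ? * k τ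
      absorb (yes A⊆τ) = cong (λ τ → 1# * k τ) (∪-absorb A⊆τ)
      absorb (no  _)   = zeroˡ _ ∙ sym (zeroˡ _)

    -- The first term of `star-inside` cancels by `E-∪`; in the second the minus sign of the
    -- correction offsets that of the new vertex.
    E-star-inside : ∀ {σ} → A ⊈ σ → E s (inside ∷ σ) ≡ E k (σ ∪ A)
    E-star-inside {σ} A⊈σ = begin
      - E (s ∘ (inside ∷_)) σ
        ≡⟨ cong -_ (E-cong star-inside σ ∙ E-minus _ _ σ) ⟩
      - (E (λ τ → k (τ ∪ A)) σ - E (λ τ → ind (A ⊆? τ) * k τ) σ)
        ≡⟨ cong -_ (cong₂ _-_ (E-∪ k A σ A⊈σ) (E-⊆ k A σ)) ⟩
      - (0# - E k (σ ∪ A))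
        ≡⟨ cong -_ (+-identityˡ _) ∙ -‿involutive _ ⟩
      E k (σ ∪ A) ∎
      where open ≡-Reasoning

    -- The faces through the new vertex contribute `E k (σ ∪ A)`, exactly what is lost with the
    -- faces containing `A`.
    E-star-outside : ∀ {σ} → A ⊈ σ → E s (outside ∷ σ) ≡ E k σ
    E-star-outside {σ} A⊈σ = begin
      E (s ∘ (outside ∷_)) σ + E s (inside ∷ σ)
        ≡⟨ cong₂ _+_ (E-cong star-outside σ ∙ E-minus _ _ σ) (E-star-inside A⊈σ) ⟩
      (E k σ - E (λ τ → ind (A ⊆? τ) * k τ) σ) + E k (σ ∪ A)
        ≡⟨ cong (λ x → (E k σ - x) + E k (σ ∪ A)) (E-⊆ k A σ) ⟩
      (E k σ - E k (σ ∪ A)) + E k (σ ∪ A)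
        ≡⟨ +-assoc _ _ _ ∙ cong (E k σ +_) (-‿inverseˡ _) ∙ +-identityʳ _ ⟩
      E k σ ∎
      where open ≡-Reasoning

    star-Eulerian : Eulerian K → Eulerian (star-at K A A≢∅)
    star-Eulerian eul {outside ∷ σ} (σ∈K , A⊈σ) = E-star-outside A⊈σ ∙ eul σ∈K
    star-Eulerian eul {inside  ∷ σ} (σ∪A∈K , A⊈σ) = E-star-inside A⊈σ ∙ eul σ∪A∈K

    -- A face `σ` containing `A` does not survive the starring. Its sum is found at the new vertex
    -- joined to `σ` without one vertex `a` of `A`, since adding `A` to that set gives back `σ`.
    unstar-Eulerian : Eulerian (star-at K A A≢∅) → Eulerian K
    unstar-Eulerian eul {σ} σ∈K with A ⊆? σ
    ... | no A⊈σ = sym (E-star-outside A⊈σ) ∙ eul {outside ∷ σ} (σ∈K , A⊈σ)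
    ... | yes A⊆σ =
      cong (E k) (sym eq) ∙ sym (E-star-inside A⊈τ) ∙ eul {inside ∷ τ} (subst (Face K) (sym eq) σ∈K , A⊈τ)
      where
      a = proj₁ A≢∅
      a∈A = proj₂ A≢∅
      τ = σ Subset.- a
      A⊈τ : A ⊈ τ
      A⊈τ A⊆τ = x∉p-x σ a (A⊆τ a∈A)
      eq : τ ∪ A ≡ σ
      eq = ⊆-antisym (∪-lub (p─q⊆p σ ⁅ a ⁆) A⊆σ)
        (λ x∈σ → ∪-lub (p⊆p∪q A) (λ x∈a → q⊆p∪q τ A (⁅x⁆⊆ a∈A x∈a)) (subst (_ ∈_) (sym (p-x∪⁅x⁆≡p (A⊆σ a∈A))) x∈σ))

  -- The maps have to be mutually inverse only where the weights are nonzero: the hypothesis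
  -- identifies the weighted graphs of `f` and `g`, and this one matrix is summed by rows and by
  -- columns. Relabellings need this, as they are bijective on faces but not on all subsets.
  Σ⊆-reindex : (f : Subset n → Subset m) (g : Subset m → Subset n) (k : Subset n → Z) (l : Subset m → Z) →
               (∀ σ τ → ind (f σ ≟ˢ τ) * k σ ≡ ind (g τ ≟ˢ σ) * l τ) → Σ⊆ k ≡ Σ⊆ l
  Σ⊆-reindex f g k l h = begin
    Σ⊆ k                                           ≡⟨ Σ⊆-cong (λ σ → sym (Σ⊆-δ (f σ) (λ _ → k σ))) ⟩
    Σ⊆ (λ σ → Σ⊆ (λ τ → ind (f σ ≟ˢ τ) * k σ))     ≡⟨ Σ⊆-cong (λ σ → Σ⊆-cong (h σ)) ⟩
    Σ⊆ (λ σ → Σ⊆ (λ τ → ind (g τ ≟ˢ σ) * l τ))     ≡⟨ Σ⊆-swap (λ σ τ → ind (g τ ≟ˢ σ) * l τ) ⟩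
    Σ⊆ (λ τ → Σ⊆ (λ σ → ind (g τ ≟ˢ σ) * l τ))     ≡⟨ Σ⊆-cong (λ τ → Σ⊆-δ (g τ) (λ _ → l τ)) ⟩
    Σ⊆ l                                           ∎
    where open ≡-Reasoning

  ind-*-cong : {P Q : Set} (P? : Dec P) (Q? : Dec Q) {x y : Z} → (P → Q) → (Q → P) → (P → x ≡ y) →
               ind P? * x ≡ ind Q? * y
  ind-*-cong (yes p) Q? f g h = cong₂ _*_ (sym (ind-yes Q? (f p))) (h p)
  ind-*-cong (no ¬p) Q? f g h = zeroˡ _ ∙ sym (cong (_* _) (ind-no Q? (¬p ∘ g)) ∙ zeroˡ _)

  alt : ℕ → Z
  alt zero    = 1#
  alt (suc i) = - alt i

  sgn-alt : (σ : Subset n) → sgn σ ≡ alt ∣ σ ∣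
  sgn-alt []            = refl
  sgn-alt (outside ∷ σ) = sgn-alt σ
  sgn-alt (inside  ∷ σ) = cong -_ (sgn-alt σ)

  ≅-Eulerian : {K : Complex n} {L : Complex m} → K ≅ L → Eulerian K → Eulerian L
  ≅-Eulerian {K = K} {L} K≅L eul {ρ} ρ∈L = sym E≡ ∙ eul (from-face ρ∈L)
    where
    open _≅_ K≅L
    h : ∀ {i} → Subset i → Subset i → Z
    h ρ τ = ind (ρ ⊆? τ) * sgn τ

    swap⊆ : ∀ {σ} → Face K σ → image from ρ ⊆ σ → ρ ⊆ image to σ
    swap⊆ {σ} _ h = subst (_⊆ image to σ) (image-from-to (≅-sym K≅L) ρ∈L) (image-mono to h)
    swap⊇ : ∀ {σ} → Face K σ → ρ ⊆ image to σ → image from ρ ⊆ σ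
    swap⊇ {σ} σ∈K h = subst (image from ρ ⊆_) (image-from-to K≅L σ∈K) (image-mono from h)

    weight : ∀ {σ} → Face K σ → h (image from ρ) σ ≡ h ρ (image to σ)
    weight {σ} σ∈K = cong₂ _*_ (ind-⊆ {σ = image from ρ} {σ} {ρ} {image to σ} (swap⊆ σ∈K) (swap⊇ σ∈K))
      (sgn-alt σ ∙ cong alt (sym (∣image-to∣ K≅L σ∈K)) ∙ sym (sgn-alt (image to σ)))

    pointwise : ∀ σ τ → ind (image to σ ≟ˢ τ) * (⟦ K ⟧ σ * h (image from ρ) σ)
                      ≡ ind (image from τ ≟ˢ σ) * (⟦ L ⟧ τ * h ρ τ)
    pointwise σ τ = begin
      ind (image to σ ≟ˢ τ) * (⟦ K ⟧ σ * h (image from ρ) σ)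
        ≡⟨ sym (*-assoc _ _ _) ∙ cong (_* _) (sym (ind-× (image to σ ≟ˢ τ) (Face? K σ))) ⟩
      ind ((image to σ ≟ˢ τ) ×-dec Face? K σ) * h (image from ρ) σ
        ≡⟨ ind-*-cong ((image to σ ≟ˢ τ) ×-dec Face? K σ) ((image from τ ≟ˢ σ) ×-dec Face? L τ)
             (λ { (refl , σ∈K) → image-from-to K≅L σ∈K , to-face σ∈K })
             (λ { (refl , τ∈L) → image-from-to (≅-sym K≅L) τ∈L , from-face τ∈L })
             (λ { (refl , σ∈K) → weight σ∈K }) ⟩
      ind ((image from τ ≟ˢ σ) ×-dec Face? L τ) * h ρ τ
        ≡⟨ cong (_* _) (ind-× (image from τ ≟ˢ σ) (Face? L τ)) ∙ *-assoc _ _ _ ⟩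
      ind (image from τ ≟ˢ σ) * (⟦ L ⟧ τ * h ρ τ) ∎
      where open ≡-Reasoning

    E≡ : E ⟦ K ⟧ (image from ρ) ≡ E ⟦ L ⟧ ρ
    E≡ = E-Σ⊆ ⟦ K ⟧ (image from ρ)
       ∙ Σ⊆-reindex (image to) (image from) _ _ pointwise
       ∙ sym (E-Σ⊆ ⟦ L ⟧ ρ)

  -- Over all supersets of a proper subset the signs cancel. Leaving out `⊤`, which counts (-1)⁴,
  -- leaves -1.
  ∂Δ-Eulerian : Eulerian (∂Δ 3)
  ∂Δ-Eulerian {σ} (_ , x , _ , x∉σ) = begin
    E ⟦ ∂Δ 3 ⟧ σ                                      ≡⟨ E-cong proper σ ⟩
    E (λ τ → 1# - ind (⊤ ⊆? τ) * 1#) σ                ≡⟨ E-minus _ _ σ ⟩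
    E (λ τ → 1#) σ - E (λ τ → ind (⊤ ⊆? τ) * 1#) σ    ≡⟨ cong₂ _-_ (E-∪ (λ _ → 1#) ⊤ σ (λ ⊤⊆σ → x∉σ (⊤⊆σ ∈⊤)))
                                                                   (E-⊆ (λ _ → 1#) ⊤ σ) ⟩
    0# - E (λ τ → 1#) (σ ∪ ⊤)                         ≡⟨ +-identityˡ _ ∙ cong (λ τ → - E (λ _ → 1#) τ) (∪-zeroʳ σ) ⟩
    - (- (- (- (- 1#))))                              ≡⟨ -‿involutive _ ∙ -‿involutive _ ⟩
    - 1#                                              ∎
    where
    open ≡-Reasoning
    proper : ∀ (τ : Subset 4) → ⟦ ∂Δ 3 ⟧ τ ≡ 1# - ind (⊤ ⊆? τ) * 1#
    proper τ = ind-cong {P? = τ ⊂? ⊤} {¬? (⊤ ⊆? τ)} (λ { (_ , x , _ , x∉τ) h → x∉τ (h ∈⊤) }) ⊤⊈⇒⊂⊤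
      ∙ ind-¬ (⊤ ⊆? τ) ∙ cong (λ x → 1# - x) (sym (*-identityʳ _))

  move-Eulerian : ∀ {X Y} → StellarMove X Y → Eulerian (proj₂ X) → Eulerian (proj₂ Y)
  move-Eulerian (relabel K≅L)          = ≅-Eulerian K≅L
  move-Eulerian (starring K A A≢∅ _)   = star-Eulerian K A A≢∅

  unmove-Eulerian : ∀ {X Y} → StellarMove X Y → Eulerian (proj₂ Y) → Eulerian (proj₂ X)
  unmove-Eulerian (relabel K≅L)        = ≅-Eulerian (≅-sym K≅L)
  unmove-Eulerian (starring K A A≢∅ _) = unstar-Eulerian K A A≢∅

  -- The chain leads from `K` to `∂Δ 3` while the property travels back along it, so a forward step
  -- calls for `unmove-Eulerian` and a backward step for `move-Eulerian`.
  sphere-Eulerian : {K : Complex n} → CombinatorialSphere 2 K → Eulerian K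
  sphere-Eulerian = go
    where
    go : ∀ {X} → Star (SymClosure StellarMove) X (_ , ∂Δ 3) → Eulerian (proj₂ X)
    go ε = ∂Δ-Eulerian
    go (fwd move ◅ moves) = unmove-Eulerian move (go moves)
    go (bwd move ◅ moves) = move-Eulerian move (go moves)

  -- As for starrings: the indicator of the link is that of `τ ∪ ⁅ v ⁆` less its part with `v ∈ τ`.
  -- The unrestricted sum cancels by `E-∪`, and the correction brings in the minus sign.
  E-link : (M : Complex n) → ∀ v (v∈M : Face M ⁅ v ⁆) {σ} → v ∉ σ →
           E ⟦ link M v v∈M ⟧ σ ≡ - E ⟦ M ⟧ (σ ∪ ⁅ v ⁆)
  E-link M v v∈M {σ} v∉σ = begin
    E ⟦ link M v v∈M ⟧ σ
      ≡⟨ E-cong linkface σ ∙ E-minus _ _ σ ⟩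
    E (λ τ → μ (τ ∪ ⁅ v ⁆)) σ - E (λ τ → ind (⁅ v ⁆ ⊆? τ) * μ τ) σ
      ≡⟨ cong₂ _-_ (E-∪ μ ⁅ v ⁆ σ (λ v⊆σ → v∉σ (v⊆σ (x∈⁅x⁆ v)))) (E-⊆ μ ⁅ v ⁆ σ) ⟩
    0# - E μ (σ ∪ ⁅ v ⁆)
      ≡⟨ +-identityˡ _ ⟩
    - E μ (σ ∪ ⁅ v ⁆) ∎
    where
    open ≡-Reasoning
    μ = ⟦ M ⟧
    absorb : ∀ τ → (v∈τ? : Dec (v ∈ τ)) → ind v∈τ? * μ (τ ∪ ⁅ v ⁆) ≡ ind v∈τ? * μ τ
    absorb τ (yes v∈τ) = cong (λ τ → 1# * μ τ) (∪-absorb (⁅x⁆⊆ v∈τ))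
    absorb τ (no  _)   = zeroˡ _ ∙ sym (zeroˡ _)
    linkface : ∀ τ → ⟦ link M v v∈M ⟧ τ ≡ μ (τ ∪ ⁅ v ⁆) - ind (⁅ v ⁆ ⊆? τ) * μ τ
    linkface τ = ind-× (¬? (v ∈? τ)) (Face? M (τ ∪ ⁅ v ⁆))
      ∙ cong (_* μ (τ ∪ ⁅ v ⁆)) (ind-¬ (v ∈? τ)) ∙ [1-x]y _ _
      ∙ cong (λ x → μ (τ ∪ ⁅ v ⁆) - x) (absorb τ (v ∈? τ)
        ∙ cong (_* μ τ) (ind-cong {P? = v ∈? τ} {⁅ v ⁆ ⊆? τ} ⁅x⁆⊆ (λ h → h (x∈⁅x⁆ v))))

  -- The sign -1 of a vertex link becomes 1 because `v` adds one element to every set. Non-faces,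
  -- where both sides vanish, are included so that the equation can be weighted and summed over all
  -- nonempty subsets.
  manifold-E : {M : Complex n} → Combinatorial3Manifold M → ∀ {ρ} → Nonempty ρ → E ⟦ M ⟧ ρ ≡ ⟦ M ⟧ ρ
  manifold-E {M = M} manifold {ρ} (v , v∈ρ) with Face? M ρ
  ... | no  ρ∉M = E-∉ M ρ∉M
  ... | yes ρ∈M = begin
    E ⟦ M ⟧ ρ                              ≡⟨ cong (E ⟦ M ⟧) (sym eq) ⟩
    E ⟦ M ⟧ (σ ∪ ⁅ v ⁆)                    ≡⟨ sym (-‿involutive _) ⟩
    - (- E ⟦ M ⟧ (σ ∪ ⁅ v ⁆))              ≡⟨ cong -_ (sym (E-link M v (vertex v) v∉σ)) ⟩
    - E ⟦ link M v (vertex v) ⟧ σ          ≡⟨ cong -_ (sphere-Eulerian (links v) (v∉σ , subst (Face M) (sym eq) ρ∈M)) ⟩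
    - (- 1#)                               ≡⟨ -‿involutive 1# ⟩
    1#                                     ∎
    where
    open ≡-Reasoning
    open Combinatorial3Manifold manifold
    σ = ρ Subset.- v
    v∉σ = x∉p-x ρ v
    eq : σ ∪ ⁅ v ⁆ ≡ ρ
    eq = p-x∪⁅x⁆≡p v∈ρ

  -- Weighted double counting of nested faces

  Σ↓ : (Subset n → Z) → Subset n → Z
  Σ↓ w []            = w []
  Σ↓ w (outside ∷ τ) = Σ↓ (w ∘ (outside ∷_)) τ
  Σ↓ w (inside  ∷ τ) = Σ↓ (w ∘ (outside ∷_)) τ + Σ↓ (w ∘ (inside ∷_)) τ

  Σ↓-⊤ : ∀ (w : Subset n → Z) → Σ↓ w ⊤ ≡ Σ⊆ w
  Σ↓-⊤ {zero}  w = refl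
  Σ↓-⊤ {suc n} w = cong₂ _+_ (Σ↓-⊤ (w ∘ (outside ∷_))) (Σ↓-⊤ (w ∘ (inside ∷_)))

  Σ⊆-split : ∀ (f g h : Subset n → Z) → (∀ σ → h σ ≡ f σ + g σ) → Σ⊆ h ≡ Σ⊆ f + Σ⊆ g
  Σ⊆-split f g h h≡ = Σ⊆-cong h≡ ∙ Σ⊆-+ f g

  -- Exchange of the order of summation over the pairs `σ ⊆ τ`: up to the sign of `τ`, `Σ↓` is the
  -- transpose of `E`.
  duality : ∀ (w k : Subset n → Z) → Σ⊆ (λ σ → w σ * E k σ) ≡ Σ⊆ (λ τ → k τ * (sgn τ * Σ↓ w τ))
  duality {zero}  w k = *-comm (w []) (k []) ∙ cong (k [] *_) (sym (*-identityˡ _))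
  duality {suc n} w k = begin
    Σ⊆ (λ σ → wₒ σ * (E kₒ σ - E kᵢ σ)) + Σ⊆ (λ σ → wᵢ σ * - E kᵢ σ)
      ≡⟨ cong₂ _+_ (Σ⊆-split {n} _ _ _ (λ σ → distribˡ (wₒ σ) (E kₒ σ) (- E kᵢ σ)
                     ∙ cong (wₒ σ * E kₒ σ +_) (sym (-‿distribʳ-* (wₒ σ) (E kᵢ σ)))) ∙ cong (S wₒ kₒ +_) (Σ⊆-neg {n} _))
                   (Σ⊆-cong (λ σ → sym (-‿distribʳ-* (wᵢ σ) (E kᵢ σ))) ∙ Σ⊆-neg {n} _) ⟩
    (S wₒ kₒ + - S wₒ kᵢ) + - S wᵢ kᵢ
      ≡⟨ +-assoc _ _ _ ∙ cong (S wₒ kₒ +_) (-‿+-comm _ _) ⟩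
    S wₒ kₒ + - (S wₒ kᵢ + S wᵢ kᵢ)
      ≡⟨ cong₂ (λ x y → x + - y) (duality wₒ kₒ) (cong₂ _+_ (duality wₒ kᵢ) (duality wᵢ kᵢ)) ⟩
    S′ wₒ kₒ + - (S′ wₒ kᵢ + S′ wᵢ kᵢ)
      ≡⟨ cong (S′ wₒ kₒ +_) (cong -_ (sym (Σ⊆-split {n} _ _ _ (λ τ → cong (kᵢ τ *_) (distribˡ _ _ _) ∙ distribˡ _ _ _)))
           ∙ sym (Σ⊆-neg {n} _) ∙ Σ⊆-cong (λ τ → -‿distribʳ-* (kᵢ τ) _ ∙ cong (kᵢ τ *_) (-‿distribˡ-* (sgn τ) _))) ⟩
    S′ wₒ kₒ + Σ⊆ (λ τ → kᵢ τ * (- sgn τ * (Σ↓ wₒ τ + Σ↓ wᵢ τ))) ∎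
    where
    open ≡-Reasoning
    wₒ = w ∘ (outside ∷_)
    wᵢ = w ∘ (inside ∷_)
    kₒ = k ∘ (outside ∷_)
    kᵢ = k ∘ (inside ∷_)
    S S′ : (Subset n → Z) → (Subset n → Z) → Z
    S w k = Σ⊆ (λ σ → w σ * E k σ)
    S′ w k = Σ⊆ (λ τ → k τ * (sgn τ * Σ↓ w τ))

  -- Δ ω a b = Σ_{i,j} (a choose i) (b choose j) ω i j
  Δ : (ℕ → ℕ → Z) → ℕ → ℕ → Z
  Δ ω zero    zero    = ω 0 0
  Δ ω zero    (suc b) = Δ ω zero b + Δ (λ i j → ω i (suc j)) zero b
  Δ ω (suc a) b       = Δ ω a b + Δ (λ i j → ω (suc i) j) a b

  Δ-suc : ∀ ω a b → Δ ω a (suc b) ≡ Δ ω a b + Δ (λ i j → ω i (suc j)) a b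
  Δ-suc ω zero    b = refl
  Δ-suc ω (suc a) b = cong₂ _+_ (Δ-suc ω a b) (Δ-suc (λ i j → ω (suc i) j) a b) ∙ interchange _ _ _ _

  module _ (V : Subset n) where
    #₁ #₂ : Subset n → ℕ
    #₁ σ = ∣ σ ∩ V ∣
    #₂ σ = ∣ σ ∩ ∁ V ∣

  -- A weight that sees only the numbers of vertices on the two sides of `V` has sums over subsets
  -- that see only these numbers. Relations between face counts thus become identities in two
  -- natural numbers.
  Σ↓-Δ : ∀ (V : Subset n) ω τ → Σ↓ (λ σ → ω (#₁ V σ) (#₂ V σ)) τ ≡ Δ ω (#₁ V τ) (#₂ V τ)
  Σ↓-Δ []            ω []            = refl
  Σ↓-Δ (_ ∷ V)       ω (outside ∷ τ) = Σ↓-Δ V ω τ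
  Σ↓-Δ (inside ∷ V)  ω (inside ∷ τ)  = cong₂ _+_ (Σ↓-Δ V ω τ) (Σ↓-Δ V (λ i j → ω (suc i) j) τ)
  Σ↓-Δ (outside ∷ V) ω (inside ∷ τ)  = cong₂ _+_ (Σ↓-Δ V ω τ) (Σ↓-Δ V (λ i j → ω i (suc j)) τ)
    ∙ sym (Δ-suc ω (#₁ V τ) (#₂ V τ))

  Σ⊆-Δ : ∀ (V : Subset n) ω → Σ⊆ (λ σ → ω (#₁ V σ) (#₂ V σ)) ≡ Δ ω ∣ V ∣ ∣ ∁ V ∣
  Σ⊆-Δ V ω = sym (Σ↓-⊤ (λ σ → ω (#₁ V σ) (#₂ V σ))) ∙ Σ↓-Δ V ω ⊤
    ∙ cong₂ (Δ ω) (cong ∣_∣ (∩-identityˡ V)) (cong ∣_∣ (∩-identityˡ (∁ V)))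

  module Tally (M : Complex n) (V : Subset n) where

    T : (ℕ → ℕ → Z) → Z
    T φ = Σ⊆ (λ σ → ⟦ M ⟧ σ * φ (#₁ V σ) (#₂ V σ))

    T-+ : ∀ φ ψ → T (λ a b → φ a b + ψ a b) ≡ T φ + T ψ
    T-+ φ ψ = Σ⊆-split {n} _ _ _ (λ σ → distribˡ _ _ _)

    T-* : ∀ c φ → T (λ a b → c * φ a b) ≡ c * T φ
    T-* c φ = Σ⊆-cong (λ σ → x∙yz≈y∙xz (⟦ M ⟧ σ) c (φ (#₁ V σ) (#₂ V σ)))
      ∙ Σ⊆-*ˡ {n} c (λ σ → ⟦ M ⟧ σ * φ (#₁ V σ) (#₂ V σ))

    T-full : ∀ {φ} (ψ : ℕ → ℕ → Z) → (∀ {σ} → Face M σ → φ (#₁ V σ) (#₂ V σ) ≡ ψ (#₁ V σ) (#₂ V σ)) →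
             (∀ {σ} → ¬ Face M σ → ψ (#₁ V σ) (#₂ V σ) ≡ 0#) → T φ ≡ Δ ψ ∣ V ∣ ∣ ∁ V ∣
    T-full {φ} ψ φ≗ψ ψ≗0 = Σ⊆-cong (λ σ → at σ (Face? M σ)) ∙ Σ⊆-Δ V ψ
      where
      at : ∀ σ (σ∈M? : Dec (Face M σ)) → ind σ∈M? * φ (#₁ V σ) (#₂ V σ) ≡ ψ (#₁ V σ) (#₂ V σ)
      at σ (yes σ∈M) = *-identityˡ _ ∙ φ≗ψ σ∈M
      at σ (no σ∉M)  = zeroˡ _ ∙ sym (ψ≗0 σ∉M)

    T-cong : ∀ {φ ψ} → (∀ {σ} → Face M σ → φ (#₁ V σ) (#₂ V σ) ≡ ψ (#₁ V σ) (#₂ V σ)) → T φ ≡ T ψ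
    T-cong φ≗ψ = Σ⊆-cong λ σ → ind-*-cong (Face? M σ) (Face? M σ) id id φ≗ψ

    -- These are the Dehn-Sommerville relations of a 3-manifold, refined by the partition. The
    -- condition at `0 0` excludes the empty face, about which the vertex links give no information.
    T-dual : Combinatorial3Manifold M → ∀ ω → ω 0 0 ≡ 0# → T ω ≡ T (λ a b → alt (a ℕ.+ b) * Δ ω a b)
    T-dual manifold ω ω00 = begin
      T ω
        ≡⟨ Σ⊆-cong (λ σ → eulerian σ (nonempty? σ)) ⟩
      Σ⊆ (λ σ → w σ * E ⟦ M ⟧ σ)
        ≡⟨ duality w ⟦ M ⟧ ⟩
      Σ⊆ (λ τ → ⟦ M ⟧ τ * (sgn τ * Σ↓ w τ))
        ≡⟨ Σ⊆-cong (λ τ → cong (⟦ M ⟧ τ *_) (cong₂ _*_ (sgn-alt τ ∙ cong alt (sym (∣∩∣+∣∩∁∣ τ V))) (Σ↓-Δ V ω τ))) ⟩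
      T (λ a b → alt (a ℕ.+ b) * Δ ω a b) ∎
      where
      open ≡-Reasoning
      w : Subset n → Z
      w σ = ω (#₁ V σ) (#₂ V σ)
      eulerian : ∀ σ → Dec (Nonempty σ) → ⟦ M ⟧ σ * w σ ≡ w σ * E ⟦ M ⟧ σ
      eulerian σ (yes σ≢∅) = *-comm _ _ ∙ cong (w σ *_) (sym (manifold-E manifold σ≢∅))
      eulerian σ (no σ≡∅) = cong (⟦ M ⟧ σ *_) w≡0 ∙ zeroʳ _ ∙ sym (cong (_* E ⟦ M ⟧ σ) w≡0 ∙ zeroˡ _)
        where
        none : ∀ W → ∣ σ ∩ W ∣ ≡ 0
        none W with ∣ σ ∩ W ∣ in eq
        ... | zero  = refl
        ... | suc _ with v , v∈ ← ∣∣-nonempty {σ = σ ∩ W} (subst (1 ℕ.≤_) (sym eq) (ℕ.s≤s ℕ.z≤n)) =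
          ⊥-elim (σ≡∅ (v , proj₁ (x∈p∩q⁻ σ W v∈)))
        w≡0 : w σ ≡ 0#
        w≡0 = cong₂ ω (none V) (none (∁ V)) ∙ ω00

  Δ₁ : (ℕ → Z) → ℕ → Z
  Δ₁ ω zero    = ω 0
  Δ₁ ω (suc a) = Δ₁ ω a + Δ₁ (ω ∘ suc) a

  Δ-0 : ∀ ω b → Δ ω 0 b ≡ Δ₁ (ω 0) b
  Δ-0 ω zero    = refl
  Δ-0 ω (suc b) = cong₂ _+_ (Δ-0 ω b) (Δ-0 (λ i j → ω i (suc j)) b)

  -- Vandermonde's identity: a weight of `i + j` does not see how the set is divided.
  Δ-+ : ∀ ω a b → Δ (λ i j → ω (i ℕ.+ j)) a b ≡ Δ₁ ω (a ℕ.+ b)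
  Δ-+ ω zero    b       = Δ-0 (λ i j → ω (i ℕ.+ j)) b
  Δ-+ ω (suc a) b       = cong₂ _+_ (Δ-+ ω a b) (Δ-+ (ω ∘ suc) a b)

  Δ-* : ∀ p q a b → Δ (λ i j → p i * q j) a b ≡ Δ₁ p a * Δ₁ q b
  Δ-* p q zero    zero    = refl
  Δ-* p q zero    (suc b) = cong₂ _+_ (Δ-* p q zero b) (Δ-* p (q ∘ suc) zero b) ∙ sym (distribˡ _ _ _)
  Δ-* p q (suc a) b       = cong₂ _+_ (Δ-* p q a b) (Δ-* (p ∘ suc) q a b) ∙ sym (distribʳ _ _ _)

-- Face numbers

length-filter-map : {P : Pred (Subset m) 0ℓ} (P? : Decidable P) (g : Subset n → Subset m)
                    (L : List (Subset n)) →
                    length (filter P? (map g L)) ≡ length (filter (P? ∘ g) L)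
length-filter-map P? g []      = refl
length-filter-map P? g (σ ∷ L) with does (P? (g σ))
... | inside  = cong suc (length-filter-map P? g L)
... | outside = length-filter-map P? g L

module _ where
  open import Data.Integer.Base using (ℤ; +_; _+_; _*_; _-_; -_; _≤_; 0ℤ; 1ℤ)
  open ℤSolver using (solve-∀)
  open EulerSums ℤ.+-*-isCommutativeRing public

  count-Σ⊆ : {P : Pred (Subset n) 0ℓ} (P? : Decidable P) → + count P? ≡ Σ⊆ (ind ∘ P?)
  count-Σ⊆ {zero} P? with P? []
  ... | yes _ = refl
  ... | no  _ = refl
  count-Σ⊆ {suc n} P? = begin
    + length (filter P? (map (outside ∷_) S ++ map (inside ∷_) S))
      ≡⟨ cong (+_ ∘ length) (List.filter-++ P? (map (outside ∷_) S) _) ⟩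
    + length (filter P? (map (outside ∷_) S) ++ filter P? (map (inside ∷_) S))
      ≡⟨ cong +_ (List.length-++ (filter P? (map (outside ∷_) S))) ⟩
    + length (filter P? (map (outside ∷_) S)) + + length (filter P? (map (inside ∷_) S))
      ≡⟨ cong₂ (λ a b → + a + + b) (length-filter-map P? (outside ∷_) S)
                                   (length-filter-map P? (inside ∷_) S) ⟩
    + count (P? ∘ (outside ∷_)) + + count (P? ∘ (inside ∷_))
      ≡⟨ cong₂ _+_ (count-Σ⊆ (P? ∘ (outside ∷_))) (count-Σ⊆ (P? ∘ (inside ∷_))) ⟩
    Σ⊆ (ind ∘ P?) ∎
    where
    open ≡-Reasoning
    S = subsets n


  δ : ℕ → ℕ → ℤ
  δ zero    zero    = 1ℤ
  δ zero    (suc j) = 0ℤ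
  δ (suc i) zero    = 0ℤ
  δ (suc i) (suc j) = δ i j

  δ-refl : ∀ i → δ i i ≡ 1ℤ
  δ-refl zero    = refl
  δ-refl (suc i) = δ-refl i

  δ-≢ : ∀ i j → i ≢ j → δ i j ≡ 0ℤ
  δ-≢ zero    zero    i≢j = ⊥-elim (i≢j refl)
  δ-≢ zero    (suc j) i≢j = refl
  δ-≢ (suc i) zero    i≢j = refl
  δ-≢ (suc i) (suc j) i≢j = δ-≢ i j (i≢j ∘ cong suc)

  Δ₁-0 : ∀ a → Δ₁ (λ _ → 0ℤ) a ≡ 0ℤ
  Δ₁-0 zero    = refl
  Δ₁-0 (suc a) = cong₂ _+_ (Δ₁-0 a) (Δ₁-0 a)

  Δ₁-δ0 : ∀ a → Δ₁ (δ 0) a ≡ 1ℤ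
  Δ₁-δ0 zero    = refl
  Δ₁-δ0 (suc a) = cong₂ _+_ (Δ₁-δ0 a) (Δ₁-0 a)

  Δ₁-δ1 : ∀ a → Δ₁ (δ 1) a ≡ + a
  Δ₁-δ1 zero    = refl
  Δ₁-δ1 (suc a) = cong₂ _+_ (Δ₁-δ1 a) (Δ₁-δ0 a) ∙ ℤ.+-comm (+ a) 1ℤ

  Δ₁-δ2 : ∀ a → + 2 * Δ₁ (δ 2) a ≡ + a * + a - + a
  Δ₁-δ2 zero    = refl
  Δ₁-δ2 (suc a) = ℤ.*-distribˡ-+ (+ 2) (Δ₁ (δ 2) a) (Δ₁ (δ 1) a)
    ∙ cong₂ _+_ (Δ₁-δ2 a) (cong (+ 2 *_) (Δ₁-δ1 a)) ∙ lem (+ a)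
    where
    lem : ∀ x → (x * x - x) + + 2 * x ≡ (1ℤ + x) * (1ℤ + x) - (1ℤ + x)
    lem = solve-∀

  -- `Δ₁` recurses by Pascal's rule, so a Kronecker delta selects a single binomial coefficient.
  C-Δ₁ : ∀ j a → + (a C j) ≡ Δ₁ (δ j) a
  C-Δ₁ zero    a       = sym (Δ₁-δ0 a)
  C-Δ₁ (suc j) zero    = refl
  C-Δ₁ (suc j) (suc a) = cong +_ (sym (nCk+nC[k+1]≡[n+1]C[k+1] a j) ∙ ℕ.+-comm (a C j) (a C suc j))
    ∙ cong₂ _+_ (C-Δ₁ (suc j) a) (C-Δ₁ j a)

  pos : ℕ → ℤ
  pos zero    = 0ℤ
  pos (suc _) = 1ℤ

  -- The indicators of the faces with i vertices, and of those that also meet both V and its complement,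
  -- as functions of the numbers a and b of vertices in V and in its complement.
  size cross : ℕ → ℕ → ℕ → ℤ
  size  i a b = δ i (a ℕ.+ b)
  cross i a b = (pos a * pos b) * δ i (a ℕ.+ b)

  quad : ℕ → ℕ → ℤ
  quad a b = δ 2 a * δ 2 b

  -- A face of a 3-manifold has at most four vertices, so two weights need to be compared at
  -- finitely many pairs only. The implicit argument is found by running the decision procedure.
  upTo4 : (φ ψ : ℕ → ℕ → ℤ) →
          {True (Fin.all? {n = 5} λ a → Fin.all? {n = 5} λ b →
             (toℕ a ℕ.+ toℕ b ℕ.≤? 4) →-dec (φ (toℕ a) (toℕ b) ℤ.≟ ψ (toℕ a) (toℕ b)))} →
          ∀ a b → a ℕ.+ b ℕ.≤ 4 → φ a b ≡ ψ a b
  upTo4 φ ψ {checked} a b a+b≤4 = subst₂ (λ a b → φ a b ≡ ψ a b) (Fin.toℕ-fromℕ< a<5) (Fin.toℕ-fromℕ< b<5)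
    (toWitness checked (fromℕ< a<5) (fromℕ< b<5)
      (subst₂ (λ a b → a ℕ.+ b ℕ.≤ 4) (sym (Fin.toℕ-fromℕ< a<5)) (sym (Fin.toℕ-fromℕ< b<5)) a+b≤4))
    where
    a<5 = ℕ.s≤s (ℕ.≤-trans (ℕ.m≤m+n a b) a+b≤4)
    b<5 = ℕ.s≤s (ℕ.≤-trans (ℕ.m≤n+m b a) a+b≤4)

  module FaceNumbers (M : Complex n) (manifold : Combinatorial3Manifold M) (V : Subset n) where
    open Combinatorial3Manifold manifold
    open Tally M V

    T-upTo4 : ∀ φ ψ → (∀ a b → a ℕ.+ b ℕ.≤ 4 → φ a b ≡ ψ a b) → T φ ≡ T ψ
    T-upTo4 φ ψ h = T-cong {φ} {ψ} λ {σ} σ∈M → h (#₁ V σ) (#₂ V σ)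
      (subst (ℕ._≤ 4) (sym (∣∩∣+∣∩∁∣ σ V)) (Pure.dimension pure σ∈M))

    -- For a weight supported on faces with a fixed odd number of vertices, the two terms cancel on
    -- these faces, and only larger faces remain.
    doubled : (ℕ → ℕ → ℤ) → ℕ → ℕ → ℤ
    doubled φ a b = φ a b + alt (a ℕ.+ b) * Δ φ a b

    T-double : ∀ φ → φ 0 0 ≡ 0ℤ → T φ + T φ ≡ T (doubled φ)
    T-double φ φ00 = cong (_+_ (T φ)) (T-dual manifold φ φ00) ∙ sym (T-+ φ (λ a b → alt (a ℕ.+ b) * Δ φ a b))

    -- A tetrahedron contributes its crossing triangles: three if it is split as 1 + 3, four if it
    -- is split as 2 + 2, whence the extra `quad`.
    crossing-edges : T (cross 3) + T (cross 3) ≡ + 3 * T (cross 4) + T quad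
    crossing-edges = T-double (cross 3) refl
      ∙ T-upTo4 (doubled (cross 3)) (λ a b → + 3 * cross 4 a b + quad a b) (upTo4 _ _)
      ∙ T-+ (λ a b → + 3 * cross 4 a b) quad ∙ cong (_+ T quad) (T-* (+ 3) (cross 4))

    triangles : T (size 3) + T (size 3) ≡ + 4 * T (size 4)
    triangles = T-double (size 3) refl
      ∙ T-upTo4 (doubled (size 3)) (λ a b → + 4 * size 4 a b) (upTo4 _ _) ∙ T-* (+ 4) (size 4)

    -- In `doubled (size 1)` a face with m ≥ 2 vertices counts (-1)^m m; the negative term for
    -- triangles is moved to the left.
    euler : (T (size 1) + T (size 1)) + + 3 * T (size 3) ≡ + 2 * T (size 2) + + 4 * T (size 4)
    euler = cong₂ _+_ (T-double (size 1) refl) (sym (T-* (+ 3) (size 3)))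
      ∙ sym (T-+ (doubled (size 1)) (λ a b → + 3 * size 3 a b))
      ∙ T-upTo4 (λ a b → doubled (size 1) a b + + 3 * size 3 a b) (λ a b → + 2 * size 2 a b + + 4 * size 4 a b) (upTo4 _ _)
      ∙ T-+ (λ a b → + 2 * size 2 a b) (λ a b → + 4 * size 4 a b)
      ∙ cong₂ _+_ (T-* (+ 2) (size 2)) (T-* (+ 4) (size 4))

    size-δ : ∀ i {σ} → size i (#₁ V σ) (#₂ V σ) ≡ δ i ∣ σ ∣
    size-δ i {σ} = cong (δ i) (∣∩∣+∣∩∁∣ σ V)

    size-vanishes : ∀ i → (∀ σ → ∣ σ ∣ ≡ i → Face M σ) → ∀ {σ} → ¬ Face M σ → size i (#₁ V σ) (#₂ V σ) ≡ 0ℤ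
    size-vanishes i h {σ} σ∉M = size-δ i {σ} ∙ δ-≢ i ∣ σ ∣ (λ e → σ∉M (h σ (sym e)))

    ∣V∣+∣∁V∣≡n : ∣ V ∣ ℕ.+ ∣ ∁ V ∣ ≡ n
    ∣V∣+∣∁V∣≡n = cong₂ ℕ._+_ (cong ∣_∣ (sym (∩-identityˡ V))) (cong ∣_∣ (sym (∩-identityˡ (∁ V))))
      ∙ ∣∩∣+∣∩∁∣ ⊤ V ∙ ∣⊤∣≡n n

    vertices : T (size 1) ≡ + n
    vertices = T-full {size 1} (size 1) (λ _ → refl) (size-vanishes 1 λ σ e →
          let v , eq = ∣σ∣≡1⇒σ≡⁅v⁆ σ e in subst (Face M) (sym eq) (vertex v))
      ∙ Δ-+ (δ 1) ∣ V ∣ ∣ ∁ V ∣ ∙ cong (Δ₁ (δ 1)) ∣V∣+∣∁V∣≡n ∙ Δ₁-δ1 n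

    module _ (neighborly : TwoNeighborly M) where

      edge : ∀ σ → ∣ σ ∣ ≡ 2 → Face M σ
      edge σ e = let v , w , v≢w , eq = ∣σ∣≡2⇒σ≡⁅v,w⁆ σ e in subst (Face M) (sym eq) (neighborly v w v≢w)

      edges : + 2 * T (size 2) ≡ + n * + n - + n
      edges = cong (+ 2 *_) (T-full {size 2} (size 2) (λ _ → refl) (size-vanishes 2 edge)
        ∙ Δ-+ (δ 2) ∣ V ∣ ∣ ∁ V ∣ ∙ cong (Δ₁ (δ 2)) ∣V∣+∣∁V∣≡n) ∙ Δ₁-δ2 n

      -- On all pairs of numbers `cross 2` equals a product of a weight in `a` and a weight in `b`,
      -- and for such a product the sum over all subsets factors. Neighborliness makes the product
      -- vanish off the complex.
      crossing-vertices : T (cross 2) ≡ + ∣ V ∣ * + ∣ ∁ V ∣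
      crossing-vertices = T-full {cross 2} (λ a b → δ 1 a * δ 1 b)
          (λ {σ} _ → cross2 (#₁ V σ) (#₂ V σ)) (λ {σ} σ∉M → vanish σ σ∉M (#₁ V σ) (#₂ V σ) refl refl)
        ∙ Δ-* (δ 1) (δ 1) ∣ V ∣ ∣ ∁ V ∣ ∙ cong₂ _*_ (Δ₁-δ1 ∣ V ∣) (Δ₁-δ1 ∣ ∁ V ∣)
        where
        cross2 : ∀ a b → cross 2 a b ≡ δ 1 a * δ 1 b
        cross2 zero          b             = refl
        cross2 (suc zero)    zero          = refl
        cross2 (suc zero)    (suc zero)    = refl
        cross2 (suc zero)    (suc (suc b)) = refl
        cross2 (suc (suc a)) zero          = refl
        cross2 (suc (suc a)) (suc b)       = cong (λ x → 1ℤ * 1ℤ * δ 0 x) (ℕ.+-suc a b)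
        vanish : ∀ σ → ¬ Face M σ → ∀ a b → #₁ V σ ≡ a → #₂ V σ ≡ b → δ 1 a * δ 1 b ≡ 0ℤ
        vanish σ σ∉M zero          b             _ _ = refl
        vanish σ σ∉M (suc zero)    zero          _ _ = refl
        vanish σ σ∉M (suc zero)    (suc zero)    p q = ⊥-elim (σ∉M (edge σ (sym (∣∩∣+∣∩∁∣ σ V) ∙ cong₂ ℕ._+_ p q)))
        vanish σ σ∉M (suc zero)    (suc (suc b)) _ _ = refl
        vanish σ σ∉M (suc (suc a)) b             _ _ = refl

      tetrahedra : + 2 * T (size 4) ≡ + n * + n - + 3 * + n
      -- The number of triangles has coefficient 3 in `euler` and 2 in `triangles`, so it is
      -- eliminated from twice the former. This causes the extra factor 2.
      tetrahedra = ℤ.*-cancelˡ-≡ (+ 2) _ _ (combine (+ n) (T (size 2)) (T (size 3)) (T (size 4))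
        (cong (λ x → (x + x) + + 3 * T (size 3)) (sym vertices) ∙ euler) triangles edges)
        where
        -- Here fᵢ counts the faces with i vertices.
        combine : ∀ ν f₂ f₃ f₄ → (ν + ν) + + 3 * f₃ ≡ + 2 * f₂ + + 4 * f₄ → f₃ + f₃ ≡ + 4 * f₄ →
                  + 2 * f₂ ≡ ν * ν - ν → + 2 * (+ 2 * f₄) ≡ + 2 * (ν * ν - + 3 * ν)
        combine ν f₂ f₃ f₄ p q r = begin
          + 2 * (+ 2 * f₄)                                              ≡⟨ lem₁ ν f₃ f₄ ⟩
          + 2 * ((ν + ν) + + 3 * f₃) - + 4 * f₄ - + 4 * ν + (+ 8 * f₄ - + 3 * (f₃ + f₃))
            ≡⟨ cong₂ (λ x y → + 2 * x - + 4 * f₄ - + 4 * ν + (+ 8 * f₄ - + 3 * y)) p q ⟩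
          + 2 * (+ 2 * f₂ + + 4 * f₄) - + 4 * f₄ - + 4 * ν + (+ 8 * f₄ - + 3 * (+ 4 * f₄))
            ≡⟨ lem₂ ν f₂ f₄ ⟩
          + 2 * (+ 2 * f₂) - + 4 * ν                                    ≡⟨ cong (λ x → + 2 * x - + 4 * ν) r ⟩
          + 2 * (ν * ν - ν) - + 4 * ν                                   ≡⟨ lem₃ ν ⟩
          + 2 * (ν * ν - + 3 * ν)                                       ∎
          where
          open ≡-Reasoning
          lem₁ : ∀ ν f₃ f₄ → + 2 * (+ 2 * f₄) ≡ + 2 * ((ν + ν) + + 3 * f₃) - + 4 * f₄ - + 4 * ν + (+ 8 * f₄ - + 3 * (f₃ + f₃))
          lem₁ = solve-∀
          lem₂ : ∀ ν f₂ f₄ → + 2 * (+ 2 * f₂ + + 4 * f₄) - + 4 * f₄ - + 4 * ν + (+ 8 * f₄ - + 3 * (+ 4 * f₄)) ≡ + 2 * (+ 2 * f₂) - + 4 * ν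
          lem₂ = solve-∀
          lem₃ : ∀ ν → + 2 * (ν * ν - ν) - + 4 * ν ≡ + 2 * (ν * ν - + 3 * ν)
          lem₃ = solve-∀

    T-mono : ∀ φ ψ → (∀ a b → φ a b ≤ ψ a b) → T φ ≤ T ψ
    T-mono φ ψ φ≤ψ = Σ⊆-mono λ σ → at (Face? M σ) (φ≤ψ (#₁ V σ) (#₂ V σ))
      where
      Σ⊆-mono : ∀ {n} {f g : Subset n → ℤ} → (∀ σ → f σ ≤ g σ) → Σ⊆ f ≤ Σ⊆ g
      Σ⊆-mono {zero}  f≤g = f≤g []
      Σ⊆-mono {suc n} f≤g = ℤ.+-mono-≤ (Σ⊆-mono (f≤g ∘ (outside ∷_))) (Σ⊆-mono (f≤g ∘ (inside ∷_)))
      at : ∀ {P : Set} (P? : Dec P) {x y} → x ≤ y → ind P? * x ≤ ind P? * y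
      at (yes _) {x} {y} x≤y = subst₂ _≤_ (sym (ℤ.*-identityˡ x)) (sym (ℤ.*-identityˡ y)) x≤y
      at (no _)  {x} {y} x≤y = ℤ.≤-refl

    crossing-tetrahedra : T (cross 4) ≤ T (size 4)
    crossing-tetrahedra = T-mono (cross 4) (size 4) at
      where
      δ≥0 : ∀ i j → 0ℤ ≤ δ i j
      δ≥0 zero    zero    = ℤ.+≤+ ℕ.z≤n
      δ≥0 zero    (suc j) = ℤ.≤-refl
      δ≥0 (suc i) zero    = ℤ.≤-refl
      δ≥0 (suc i) (suc j) = δ≥0 i j
      at : ∀ a b → cross 4 a b ≤ size 4 a b
      at zero    b       = δ≥0 4 b
      at (suc a) zero    = δ≥0 4 (suc a ℕ.+ 0)
      at (suc a) (suc b) = ℤ.≤-reflexive (ℤ.*-identityˡ _)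

-- Starring a facet

private
  pattern 0th e = here e
  pattern 1st e = there (here e)
  pattern 2nd e = there (there (here e))
  pattern 3rd e = there (there (there (here e)))

lookup-injective : {A : Set} {xs : List A} → Unique xs → ∀ i j → lookup xs i ≡ lookup xs j → i ≡ j
lookup-injective (x∉ ∷ u) zero    zero    e = refl
lookup-injective {xs = x ∷ xs} (x∉ ∷ u) zero (suc j) e = ⊥-elim (All.lookup x∉ (∈-lookup j) e)
lookup-injective {xs = x ∷ xs} (x∉ ∷ u) (suc i) zero e = ⊥-elim (All.lookup x∉ (∈-lookup i) (sym e))
lookup-injective (x∉ ∷ u) (suc i) (suc j) e = cong suc (lookup-injective u i j e)

⟪_⟫ : List (Fin n) → Subset n
⟪ [] ⟫     = ⊥
⟪ x ∷ xs ⟫ = ⁅ x ⁆ ∪ ⟪ xs ⟫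

∈⟪⟫⁺ : ∀ (xs : List (Fin n)) {w} → w ∈ₗ xs → w ∈ ⟪ xs ⟫
∈⟪⟫⁺ (x ∷ xs) (here refl) = p⊆p∪q ⟪ xs ⟫ (x∈⁅x⁆ x)
∈⟪⟫⁺ (x ∷ xs) (there w∈)  = q⊆p∪q ⁅ x ⁆ ⟪ xs ⟫ (∈⟪⟫⁺ xs w∈)

∈⟪⟫⁻ : ∀ (xs : List (Fin n)) {w} → w ∈ ⟪ xs ⟫ → w ∈ₗ xs
∈⟪⟫⁻ []       w∈ = ⊥-elim (∉⊥ w∈)
∈⟪⟫⁻ (x ∷ xs) w∈ with x∈p∪q⁻ ⁅ x ⁆ ⟪ xs ⟫ w∈
... | inj₁ w∈x  = here (x∈⁅y⁆⇒x≡y x w∈x)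
... | inj₂ w∈xs = there (∈⟪⟫⁻ xs w∈xs)

∣⟪xs⟫∣≤length : (xs : List (Fin n)) → ∣ ⟪ xs ⟫ ∣ ℕ.≤ length xs
∣⟪xs⟫∣≤length {n} [] = ℕ.≤-reflexive (∣⊥∣≡0 n)
∣⟪xs⟫∣≤length (x ∷ xs) = ℕ.≤-trans (∣p∪q∣≤∣p∣+∣q∣ ⁅ x ⁆ ⟪ xs ⟫)
  (ℕ.+-mono-≤ (ℕ.≤-reflexive (∣⁅x⁆∣≡1 x)) (∣⟪xs⟫∣≤length xs))

∣⁅x⁆∪p∣ : ∀ {x} {p : Subset n} → x ∉ p → ∣ ⁅ x ⁆ ∪ p ∣ ≡ suc ∣ p ∣
∣⁅x⁆∪p∣ {x = zero}  {outside ∷ p} x∉p = cong (λ p → suc ∣ p ∣) (∪-identityˡ p)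
∣⁅x⁆∪p∣ {x = zero}  {inside  ∷ p} x∉p = ⊥-elim (x∉p here)
∣⁅x⁆∪p∣ {x = suc x} {outside ∷ p} x∉p = ∣⁅x⁆∪p∣ (x∉p ∘ there)
∣⁅x⁆∪p∣ {x = suc x} {inside  ∷ p} x∉p = cong suc (∣⁅x⁆∪p∣ (x∉p ∘ there))

∣⟪xs⟫∣≡length : {xs : List (Fin n)} → Unique xs → ∣ ⟪ xs ⟫ ∣ ≡ length xs
∣⟪xs⟫∣≡length {n} []                 = ∣⊥∣≡0 n
∣⟪xs⟫∣≡length {xs = x ∷ xs} (x∉ ∷ u) =
  ∣⁅x⁆∪p∣ (λ x∈ → All.lookup x∉ (∈⟪⟫⁻ xs x∈) refl) ∙ cong suc (∣⟪xs⟫∣≡length u)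

-- The proof of `w ∈ σ` is handed on so that entries of `xs` known to be missing from `σ` can be
-- discarded.
within : {σ : Subset n} (xs ys : List (Fin n)) → σ ⊆ ⟪ xs ⟫ → (∀ {w} → w ∈ σ → w ∈ₗ xs → w ∈ₗ ys) → σ ⊆ ⟪ ys ⟫
within xs ys σ⊆xs h w∈σ = ∈⟪⟫⁺ ys (h w∈σ (∈⟪⟫⁻ xs (σ⊆xs w∈σ)))

≅-ext : {K L : Complex n} → (∀ {σ} → Face K σ → Face L σ) → (∀ {σ} → Face L σ → Face K σ) → K ≅ L
≅-ext {K = K} {L} K⇒L L⇒K = record
  { to = id ; from = id
  ; to-face = λ {σ} σ∈K → subst (Face L) (sym (image-id σ)) (K⇒L σ∈K)
  ; from-face = λ {σ} σ∈L → subst (Face K) (sym (image-id σ)) (L⇒K σ∈L)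
  ; from-to = λ _ → refl ; to-from = λ _ → refl }
  where
  image-id : ∀ σ → image id σ ≡ σ
  image-id σ = ⊆-antisym (λ w∈ → let v , v∈ , e = ∈-image⁻ id σ w∈ in subst (_∈ σ) e v∈) (∈-image⁺ id)

-- `K` is the union of a subcomplex `Q` with the simplex `A`, and `K′` the union of `Q` with the
-- cone from `a` over the boundary of `A`. As `A` is not in `Q`, it is a facet of `K`, and starring
-- it changes nothing else. The label `a`, no vertex of `K`, takes the part of the new vertex.
module _ {K K′ : Complex n} {A : Subset n} (A≢∅ : Nonempty A) {a : Fin n} (a∉A : a ∉ A)
         (Q : Subset n → Set) (Q-downward : ∀ {σ τ} → σ ⊆ τ → Q τ → Q σ)
         (a∉Q : ∀ {σ} → Q σ → a ∉ σ) (A∉Q : ¬ Q A)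
         (K⇒ : ∀ {σ} → Face K σ → Q σ ⊎ σ ⊆ A) (K⇐ : ∀ {σ} → Q σ ⊎ σ ⊆ A → Face K σ)
         (K′⇒ : ∀ {σ} → Face K′ σ → Q σ ⊎ (σ ⊆ ⁅ a ⁆ ∪ A × A ⊈ σ))
         (K′⇐ : ∀ {σ} → Q σ ⊎ (σ ⊆ ⁅ a ⁆ ∪ A × A ⊈ σ) → Face K′ σ) where

  star-facet : K′ ≅ star-at K A A≢∅
  star-facet = record
    { to = to ; from = from ; to-face = to-face _ ; from-face = from-face
    ; from-to = λ {v} _ → from-to v ; to-from = to-from }
    where
    to : Fin n → Fin (suc n)
    to w with w Fin.≟ a
    ... | yes _ = zero
    ... | no  _ = suc w

    to-a : to a ≡ zero
    to-a with a Fin.≟ a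
    ... | yes _  = refl
    ... | no a≢a = ⊥-elim (a≢a refl)

    to-≢ : ∀ {w} → w ≢ a → to w ≡ suc w
    to-≢ {w} w≢a with w Fin.≟ a
    ... | yes w≡a = ⊥-elim (w≢a w≡a)
    ... | no  _   = refl

    -- Both `zero` and `suc a` are sent to `a`, but `suc a` is not a vertex of the starring.
    from : Fin (suc n) → Fin n
    from zero    = a
    from (suc w) = w

    from-to : ∀ w → from (to w) ≡ w
    from-to w with w Fin.≟ a
    ... | yes w≡a = sym w≡a
    ... | no  _   = refl

    to-suc : ∀ {v w} → to v ≡ suc w → v ≡ w × w ≢ a
    to-suc {v} e with v Fin.≟ a | e
    ... | yes _  | ()
    ... | no v≢a | refl = refl , v≢a

    to-face : ∀ σ → Face K′ σ → StarredFace K A (image to σ)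
    to-face σ σ∈K′ = go (image to σ) refl (K′⇒ σ∈K′)
      where
      tail : ∀ {s τ w} → image to σ ≡ s ∷ τ → w ∈ τ → w ∈ σ × w ≢ a
      tail e w∈τ with v , v∈σ , tv ← ∈-image⁻ to σ (subst (_ ∈_) (sym e) (there w∈τ))
                 with refl , w≢a ← to-suc tv = v∈σ , w≢a
      a∈ : ∀ {τ} → image to σ ≡ inside ∷ τ → a ∈ σ
      a∈ e with v , v∈σ , tv ← ∈-image⁻ to σ (subst (zero ∈_) (sym e) here) =
        subst (_∈ σ) (sym (from-to v) ∙ cong from tv) v∈σ
      τ⊆A : ∀ {s τ} → image to σ ≡ s ∷ τ → σ ⊆ ⁅ a ⁆ ∪ A → τ ⊆ A
      τ⊆A e σ⊆ w∈τ with w∈σ , w≢a ← tail e w∈τ =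
        [ (λ w∈a → ⊥-elim (w≢a (x∈⁅y⁆⇒x≡y a w∈a))) , id ]′ (x∈p∪q⁻ ⁅ a ⁆ A (σ⊆ w∈σ))
      go : ∀ ρ → image to σ ≡ ρ → Q σ ⊎ (σ ⊆ ⁅ a ⁆ ∪ A × A ⊈ σ) → StarredFace K A ρ
      go (outside ∷ τ) e (inj₁ Qσ) = K⇐ (inj₁ Qτ) , λ A⊆τ → A∉Q (Q-downward A⊆τ Qτ)
        where Qτ = Q-downward (proj₁ ∘ tail e) Qσ
      go (inside  ∷ τ) e (inj₁ Qσ) = ⊥-elim (a∉Q Qσ (a∈ e))
      go (outside ∷ τ) e (inj₂ (σ⊆ , A⊈σ)) = K⇐ (inj₂ (τ⊆A e σ⊆)) , λ A⊆τ → A⊈σ (λ w∈A → proj₁ (tail e (A⊆τ w∈A)))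
      go (inside  ∷ τ) e (inj₂ (σ⊆ , A⊈σ)) =
        K⇐ (inj₂ (∪-lub (τ⊆A e σ⊆) id)) , λ A⊆τ → A⊈σ (λ w∈A → proj₁ (tail e (A⊆τ w∈A)))

    image-suc : ∀ τ → image (from ∘ suc) τ ⊆ τ
    image-suc τ w∈ with _ , v∈ , refl ← ∈-image⁻ (from ∘ suc) τ w∈ = v∈

    from-face : ∀ {ρ} → StarredFace K A ρ → Face K′ (image from ρ)
    from-face {outside ∷ τ} (τ∈K , A⊈τ) with K⇒ τ∈K
    ... | inj₁ Qτ  = K′⇐ (inj₁ (Q-downward (image-suc τ) Qτ))
    ... | inj₂ τ⊆A = K′⇐ (inj₂ ((λ w∈ → q⊆p∪q ⁅ a ⁆ A (τ⊆A (image-suc τ w∈))) , λ A⊆ → A⊈τ (λ w∈A → image-suc τ (A⊆ w∈A))))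
    from-face {inside  ∷ τ} (τ∪A∈K , A⊈τ) with K⇒ τ∪A∈K
    ... | inj₁ Qτ∪A = ⊥-elim (A∉Q (Q-downward (q⊆p∪q τ A) Qτ∪A))
    ... | inj₂ τ∪A⊆A = K′⇐ (inj₂ (∪-lub (p⊆p∪q A) (λ w∈ → q⊆p∪q ⁅ a ⁆ A (τ∪A⊆A (p⊆p∪q A (image-suc τ w∈)))) , missing))
      where
      missing : A ⊈ image from (inside ∷ τ)
      missing A⊆ = A⊈τ λ {w} w∈A → [ (λ w∈a → ⊥-elim (a∉A (subst (_∈ A) (x∈⁅y⁆⇒x≡y a w∈a) w∈A))) , image-suc τ ]′
        (x∈p∪q⁻ ⁅ a ⁆ (image (from ∘ suc) τ) (A⊆ w∈A))

    to-from : ∀ {w} → StarredFace K A ⁅ w ⁆ → to (from w) ≡ w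
    to-from {zero}  _ = to-a
    to-from {suc w} (w∈K , _) = to-≢ λ { refl →
      [ (λ Qa → a∉Q Qa (x∈⁅x⁆ w)) , (λ a⊆A → a∉A (a⊆A (x∈⁅x⁆ w))) ]′ (K⇒ w∈K) }

simplex-boundary : ∀ {K : Complex n} x (xs : List (Fin n)) → Unique (x ∷ xs) →
                   (∀ {σ} → Face K σ → σ ⊆ ⟪ x ∷ xs ⟫ × ⟪ x ∷ xs ⟫ ⊈ σ) →
                   (∀ {σ} → σ ⊆ ⟪ x ∷ xs ⟫ × ⟪ x ∷ xs ⟫ ⊈ σ → Face K σ) → K ≅ ∂Δ (length xs)
simplex-boundary {n} {K} x xs u K⇒ K⇐ = record
  { to = to ; from = from
  ; to-face = λ {σ} σ∈K → ⊤⊈⇒⊂⊤ λ ⊤⊆ → proj₂ (K⇒ σ∈K) (λ v∈A → reflect σ (proj₁ (K⇒ σ∈K)) v∈A (⊤⊆ ∈⊤))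
  ; from-face = λ {τ} (_ , i , _ , i∉τ) → K⇐
      ( (λ w∈ → let j , _ , e = ∈-image⁻ from τ w∈ in subst (_∈ ⟪ x ∷ xs ⟫) e (∈⟪⟫⁺ (x ∷ xs) (∈-lookup {xs = x ∷ xs} j)))
      , λ A⊆ → let j , j∈τ , e = ∈-image⁻ from τ (A⊆ (∈⟪⟫⁺ (x ∷ xs) (∈-lookup {xs = x ∷ xs} i)))
               in i∉τ (subst (_∈ τ) (lookup-injective u j i e) j∈τ) )
  ; from-to = λ {v} v∈K → from-to (∈⟪⟫⁻ (x ∷ xs) (proj₁ (K⇒ v∈K) (x∈⁅x⁆ v)))
  ; to-from = λ {i} _ → lookup-injective u _ i (from-to (∈-lookup i)) }
  where
  open import Data.List.Membership.DecPropositional (Fin._≟_ {n}) using () renaming (_∈?_ to _∈ₗ?_)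
  from : Fin (suc (length xs)) → Fin n
  from = lookup (x ∷ xs)
  index : ∀ {w} → Dec (w ∈ₗ x ∷ xs) → Fin (suc (length xs))
  index (yes w∈) = Any.index w∈
  -- A label outside the list is not a vertex of `K`, so any value will do.
  index (no  _)  = zero
  to : Fin n → Fin (suc (length xs))
  to w = index (w ∈ₗ? x ∷ xs)
  from-to : ∀ {w} → w ∈ₗ x ∷ xs → from (to w) ≡ w
  from-to {w} w∈ with w ∈ₗ? x ∷ xs
  ... | yes w∈′ = sym (lookup-index w∈′)
  ... | no  w∉  = ⊥-elim (w∉ w∈)
  reflect : ∀ σ → σ ⊆ ⟪ x ∷ xs ⟫ → ∀ {v} → v ∈ ⟪ x ∷ xs ⟫ → to v ∈ image to σ → v ∈ σ
  reflect σ σ⊆A v∈A tv∈ with w , w∈σ , e ← ∈-image⁻ to σ tv∈ =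
    subst (_∈ σ) (sym (from-to (∈⟪⟫⁻ (x ∷ xs) (σ⊆A w∈σ))) ∙ cong from e ∙ from-to (∈⟪⟫⁻ (x ∷ xs) v∈A)) w∈σ

-- Spheres spanned by a path and its end points

chain : {A : Set} → A → List A → A → List (A × A)
chain x []       z = (x , z) ∷ []
chain x (y ∷ ys) z = (x , y) ∷ chain y ys z

chain-++ : {A : Set} (x : A) (xs : List A) (y : A) (ys : List A) (z : A) →
           chain x (xs ++ y ∷ ys) z ≡ chain x xs y ++ chain y ys z
chain-++ x []        y ys z = refl
chain-++ x (x₁ ∷ xs) y ys z = cong ((x , x₁) ∷_) (chain-++ x₁ xs y ys z)

chain-members : {A : Set} {x z : A} {xs : List A} {s t : A} → (s , t) ∈ₗ chain x xs z →
                s ∈ₗ x ∷ xs × t ∈ₗ z ∷ xs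
chain-members {xs = []}     (here refl) = here refl , here refl
chain-members {xs = y ∷ xs} (here refl) = here refl , there (here refl)
chain-members {xs = y ∷ xs} (there e) with s∈ , t∈ ← chain-members {xs = xs} e = there s∈ , skip t∈
  where
  skip : ∀ {A : Set} {t z y : A} {xs} → t ∈ₗ z ∷ xs → t ∈ₗ z ∷ y ∷ xs
  skip (here e)   = here e
  skip (there t∈) = there (there t∈)

-- The link of a vertex v of the cyclic polytope: the path p, R, q runs through the other vertices in
-- cyclic order, and the triangles join the edges of this path to its end points.
module _ (p : Fin n) where

  -- At the first and the last edge of the path one of the two sets repeats a label and is only an
  -- edge. It lies in the other set of the same pair, so the complex is still pure.
  PathFace : Fin n → Subset n → List (Fin n × Fin n) → Set
  PathFace q σ = Any (λ (x , y) → σ ⊆ ⟪ p ∷ x ∷ y ∷ [] ⟫ ⊎ σ ⊆ ⟪ q ∷ x ∷ y ∷ [] ⟫)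

  path-downward : ∀ {q σ τ L} → σ ⊆ τ → PathFace q τ L → PathFace q σ L
  path-downward σ⊆τ = Any.map λ where
    (inj₁ h) → inj₁ (λ w∈ → h (σ⊆τ w∈))
    (inj₂ h) → inj₂ (λ w∈ → h (σ⊆τ w∈))

  path : Fin n → List (Fin n) → Complex n
  path q R = record
    { Face     = λ σ → PathFace q σ (chain p R q)
    ; Face?    = λ σ → any? (λ (x , y) → (σ ⊆? ⟪ p ∷ x ∷ y ∷ [] ⟫) ⊎-dec (σ ⊆? ⟪ q ∷ x ∷ y ∷ [] ⟫)) (chain p R q)
    ; ∅-face   = nonempty R
    ; downward = path-downward
    }
    where
    nonempty : ∀ R → PathFace q ⊥ (chain p R q)
    nonempty []      = here (inj₁ (⊥-elim ∘ ∉⊥))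
    nonempty (_ ∷ _) = here (inj₁ (⊥-elim ∘ ∉⊥))

  path-avoids : ∀ {q σ b R a} → a ≢ p → a ∉ₗ q ∷ b ∷ R → PathFace q σ (chain b R q) → a ∉ σ
  path-avoids {q} {σ} {b} {R} {a} a≢p a∉ h a∈σ with (x , y) , e∈ , faces ← find h
    with x∈ , y∈ ← chain-members e∈ =
      [ (λ f → in₁ (∈⟪⟫⁻ (p ∷ x ∷ y ∷ []) (f a∈σ))) , (λ f → in₂ (∈⟪⟫⁻ (q ∷ x ∷ y ∷ []) (f a∈σ))) ]′ faces
    where
    skip : a ∈ₗ q ∷ R → a ∈ₗ q ∷ b ∷ R
    skip (here e)   = here e
    skip (there a∈) = there (there a∈)
    in₁ : a ∉ₗ p ∷ x ∷ y ∷ []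
    in₁ (here a≡p)                = a≢p a≡p
    in₁ (there (here refl))         = a∉ (there x∈)
    in₁ (there (there (here refl))) = a∉ (skip y∈)
    in₂ : a ∉ₗ q ∷ x ∷ y ∷ []
    in₂ (here a≡q)                = a∉ (here a≡q)
    in₂ (there (here refl))         = a∉ (there x∈)
    in₂ (there (there (here refl))) = a∉ (skip y∈)

  -- With two inner vertices the genuine triangles are `q p a`, `p a b`, `q a b` and `p b q`, all
  -- four on these labels.
  path-base : ∀ q a b → Unique (p ∷ q ∷ a ∷ b ∷ []) → path q (a ∷ b ∷ []) ≅ ∂Δ 3
  path-base q a b u@((p≢q ∷ p≢a ∷ p≢b ∷ []) ∷ (q≢a ∷ q≢b ∷ []) ∷ (a≢b ∷ []) ∷ [] ∷ []) =
    simplex-boundary p (q ∷ a ∷ b ∷ []) u to from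
    where
    all = p ∷ q ∷ a ∷ b ∷ []
    A = ⟪ all ⟫
    proper : ∀ {σ} xs → σ ⊆ ⟪ xs ⟫ → (∀ {w} → w ∈ₗ xs → w ∈ₗ p ∷ q ∷ a ∷ b ∷ []) →
             ∀ {v} → v ∈ₗ p ∷ q ∷ a ∷ b ∷ [] → v ∉ₗ xs → σ ⊆ A × A ⊈ σ
    proper xs h sub v∈ v∉ = within xs all h (λ _ → sub) , λ A⊆σ → v∉ (∈⟪⟫⁻ xs (h (A⊆σ (∈⟪⟫⁺ all v∈))))

    to : ∀ {σ} → PathFace q σ (chain p (a ∷ b ∷ []) q) → σ ⊆ A × A ⊈ σ
    to (here (inj₁ h)) = proper (p ∷ p ∷ a ∷ []) h (λ { (0th e) → 0th e ; (1st e) → 0th e ; (2nd e) → 2nd e })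
      (1st refl) λ { (0th e) → p≢q (sym e) ; (1st e) → p≢q (sym e) ; (2nd e) → q≢a e }
    to (here (inj₂ h)) = proper (q ∷ p ∷ a ∷ []) h (λ { (0th e) → 1st e ; (1st e) → 0th e ; (2nd e) → 2nd e })
      (3rd refl) λ { (0th e) → q≢b (sym e) ; (1st e) → p≢b (sym e) ; (2nd e) → a≢b (sym e) }
    to (there (here (inj₁ h))) = proper (p ∷ a ∷ b ∷ []) h (λ { (0th e) → 0th e ; (1st e) → 2nd e ; (2nd e) → 3rd e })
      (1st refl) λ { (0th e) → p≢q (sym e) ; (1st e) → q≢a e ; (2nd e) → q≢b e }
    to (there (here (inj₂ h))) = proper (q ∷ a ∷ b ∷ []) h (λ { (0th e) → 1st e ; (1st e) → 2nd e ; (2nd e) → 3rd e })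
      (0th refl) λ { (0th e) → p≢q e ; (1st e) → p≢a e ; (2nd e) → p≢b e }
    to (there (there (here (inj₁ h)))) = proper (p ∷ b ∷ q ∷ []) h (λ { (0th e) → 0th e ; (1st e) → 3rd e ; (2nd e) → 1st e })
      (2nd refl) λ { (0th e) → p≢a (sym e) ; (1st e) → a≢b e ; (2nd e) → q≢a (sym e) }
    to (there (there (here (inj₂ h)))) = proper (q ∷ b ∷ q ∷ []) h (λ { (0th e) → 1st e ; (1st e) → 3rd e ; (2nd e) → 1st e })
      (0th refl) λ { (0th e) → p≢q e ; (1st e) → p≢b e ; (2nd e) → p≢q e }

    from : ∀ {σ} → σ ⊆ A × A ⊈ σ → PathFace q σ (chain p (a ∷ b ∷ []) q)
    from {σ} (σ⊆A , A⊈σ) = go (p ∈? σ) (q ∈? σ) (a ∈? σ) (b ∈? σ)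
      where
      go : Dec (p ∈ σ) → Dec (q ∈ σ) → Dec (a ∈ σ) → Dec (b ∈ σ) → PathFace q σ (chain p (a ∷ b ∷ []) q)
      go (no p∉) _ _ _ = there (here (inj₂ (within all (q ∷ a ∷ b ∷ []) σ⊆A λ w∈ →
          λ { (0th refl) → ⊥-elim (p∉ w∈) ; (1st e) → 0th e ; (2nd e) → 1st e ; (3rd e) → 2nd e })))
      go (yes _) (no q∉) _ _ = there (here (inj₁ (within all (p ∷ a ∷ b ∷ []) σ⊆A λ w∈ →
          λ { (0th e) → 0th e ; (1st refl) → ⊥-elim (q∉ w∈) ; (2nd e) → 1st e ; (3rd e) → 2nd e })))
      go (yes _) (yes _) (no a∉) _ = there (there (here (inj₁ (within all (p ∷ b ∷ q ∷ []) σ⊆A λ w∈ →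
          λ { (0th e) → 0th e ; (1st e) → 2nd e ; (2nd refl) → ⊥-elim (a∉ w∈) ; (3rd e) → 1st e }))))
      go (yes _) (yes _) (yes _) (no b∉) = here (inj₂ (within all (q ∷ p ∷ a ∷ []) σ⊆A λ w∈ →
          λ { (0th e) → 1st e ; (1st e) → 0th e ; (2nd e) → 2nd e ; (3rd refl) → ⊥-elim (b∉ w∈) }))
      go (yes p∈) (yes q∈) (yes a∈) (yes b∈) = ⊥-elim (A⊈σ λ w∈ → at (∈⟪⟫⁻ all w∈))
        where
        at : ∀ {w} → w ∈ₗ p ∷ q ∷ a ∷ b ∷ [] → w ∈ σ
        at (0th refl) = p∈
        at (1st refl) = q∈
        at (2nd refl) = a∈
        at (3rd refl) = b∈

  -- The vertex next to p has degree three: it subdivides the triangle that its three neighbours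
  -- span in the shorter path.
  path-star : ∀ q a b c R → Unique (p ∷ q ∷ a ∷ b ∷ c ∷ R) →
              path q (a ∷ b ∷ c ∷ R) ≅ star-at (path q (b ∷ c ∷ R)) ⟪ p ∷ q ∷ b ∷ [] ⟫ (p , ∈⟪⟫⁺ (p ∷ q ∷ b ∷ []) (here refl))
  path-star q a b c R ((p≢q ∷ p≢a ∷ p≢b ∷ p∉) ∷ (q≢a ∷ q≢b ∷ q∉) ∷ (a≢b ∷ a∉) ∷ b∉ ∷ _) =
    star-facet {A = A} (p , ∈⟪⟫⁺ (p ∷ q ∷ b ∷ []) (here refl)) (λ a∈ → a∉A (∈⟪⟫⁻ (p ∷ q ∷ b ∷ []) a∈))
      Q path-downward a∉Q A∉Q K⇒ K⇐ K′⇒ K′⇐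
    where
    A = ⟪ p ∷ q ∷ b ∷ [] ⟫
    Q : Subset n → Set
    Q σ = PathFace q σ (chain b (c ∷ R) q)
    a∉A : a ∉ₗ p ∷ q ∷ b ∷ []
    a∉A (here e)                 = p≢a (sym e)
    a∉A (there (here e))         = q≢a (sym e)
    a∉A (there (there (here e))) = a≢b e
    a∉Q : ∀ {σ} → Q σ → a ∉ σ
    a∉Q = path-avoids (p≢a ∘ sym) λ where
      (here e)          → q≢a (sym e)
      (there (here e))  → a≢b e
      (there (there a∈)) → All.lookup a∉ a∈ refl
    A∉Q : ¬ Q A
    A∉Q (here (inj₁ h)) with ∈⟪⟫⁻ (p ∷ b ∷ c ∷ []) (h {q} (∈⟪⟫⁺ (p ∷ q ∷ b ∷ []) (there (here refl))))
    ... | here e                 = p≢q (sym e)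
    ... | there (here e)         = q≢b e
    ... | there (there (here e)) = All.lookup q∉ (here refl) e
    A∉Q (here (inj₂ h)) with ∈⟪⟫⁻ (q ∷ b ∷ c ∷ []) (h {p} (∈⟪⟫⁺ (p ∷ q ∷ b ∷ []) (here refl)))
    ... | here e                 = p≢q e
    ... | there (here e)         = p≢b e
    ... | there (there (here e)) = All.lookup p∉ (here refl) e
    A∉Q (there h) = path-avoids {R = R} (p≢b ∘ sym)
      (λ { (here e) → q≢b (sym e) ; (there b∈) → All.lookup b∉ b∈ refl }) h (∈⟪⟫⁺ (p ∷ q ∷ b ∷ []) (there (there (here refl))))

    K⇒ : ∀ {σ} → Face (path q (b ∷ c ∷ R)) σ → Q σ ⊎ σ ⊆ A
    K⇒ (here (inj₁ h)) = inj₂ (within (p ∷ p ∷ b ∷ []) (p ∷ q ∷ b ∷ []) h λ _ → λ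
      { (here e) → here e ; (there (here e)) → here e ; (there (there (here e))) → there (there (here e)) })
    K⇒ (here (inj₂ h)) = inj₂ (within (q ∷ p ∷ b ∷ []) (p ∷ q ∷ b ∷ []) h λ _ → λ
      { (here e) → there (here e) ; (there (here e)) → here e ; (there (there (here e))) → there (there (here e)) })
    K⇒ (there h)       = inj₁ h
    K⇐ : ∀ {σ} → Q σ ⊎ σ ⊆ A → Face (path q (b ∷ c ∷ R)) σ
    K⇐ (inj₁ h) = there h
    K⇐ (inj₂ h) = here (inj₂ (within (p ∷ q ∷ b ∷ []) (q ∷ p ∷ b ∷ []) h λ _ → λ
      { (here e) → there (here e) ; (there (here e)) → here e ; (there (there (here e))) → there (there (here e)) }))

    a∪A : ∀ {σ} xs → σ ⊆ ⟪ xs ⟫ → (∀ {w} → w ∈ₗ xs → w ∈ₗ a ∷ p ∷ q ∷ b ∷ []) →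
          ∀ {v} → v ∈ₗ p ∷ q ∷ b ∷ [] → v ∉ₗ xs → σ ⊆ ⁅ a ⁆ ∪ A × A ⊈ σ
    a∪A xs h sub v∈ v∉ = within xs (a ∷ p ∷ q ∷ b ∷ []) h (λ _ → sub) ,
      λ A⊆σ → v∉ (∈⟪⟫⁻ xs (h (A⊆σ (∈⟪⟫⁺ (p ∷ q ∷ b ∷ []) v∈))))

    K′⇒ : ∀ {σ} → Face (path q (a ∷ b ∷ c ∷ R)) σ → Q σ ⊎ (σ ⊆ ⁅ a ⁆ ∪ A × A ⊈ σ)
    K′⇒ (here (inj₁ h)) = inj₂ (a∪A (p ∷ p ∷ a ∷ []) h (λ { (0th e) → 1st e ; (1st e) → 1st e ; (2nd e) → 0th e })
      (1st refl) λ { (0th e) → p≢q (sym e) ; (1st e) → p≢q (sym e) ; (2nd e) → q≢a e })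
    K′⇒ (here (inj₂ h)) = inj₂ (a∪A (q ∷ p ∷ a ∷ []) h (λ { (0th e) → 2nd e ; (1st e) → 1st e ; (2nd e) → 0th e })
      (2nd refl) λ { (0th e) → q≢b (sym e) ; (1st e) → p≢b (sym e) ; (2nd e) → a≢b (sym e) })
    K′⇒ (there (here (inj₁ h))) = inj₂ (a∪A (p ∷ a ∷ b ∷ []) h (λ { (0th e) → 1st e ; (1st e) → 0th e ; (2nd e) → 3rd e })
      (1st refl) λ { (0th e) → p≢q (sym e) ; (1st e) → q≢a e ; (2nd e) → q≢b e })
    K′⇒ (there (here (inj₂ h))) = inj₂ (a∪A (q ∷ a ∷ b ∷ []) h (λ { (0th e) → 2nd e ; (1st e) → 0th e ; (2nd e) → 3rd e })
      (0th refl) λ { (0th e) → p≢q e ; (1st e) → p≢a e ; (2nd e) → p≢b e })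
    K′⇒ (there (there h)) = inj₁ h
    K′⇐ : ∀ {σ} → Q σ ⊎ (σ ⊆ ⁅ a ⁆ ∪ A × A ⊈ σ) → Face (path q (a ∷ b ∷ c ∷ R)) σ
    K′⇐ (inj₁ h) = there (there h)
    K′⇐ {σ} (inj₂ (h , A⊈σ)) = go (p ∈? σ) (q ∈? σ) (b ∈? σ)
      where
      go : Dec (p ∈ σ) → Dec (q ∈ σ) → Dec (b ∈ σ) → Face (path q (a ∷ b ∷ c ∷ R)) σ
      go (no p∉) _ _ = there (here (inj₂ (within (a ∷ p ∷ q ∷ b ∷ []) (q ∷ a ∷ b ∷ []) h λ w∈ →
          λ { (0th e) → 1st e ; (1st refl) → ⊥-elim (p∉ w∈) ; (2nd e) → 0th e ; (3rd e) → 2nd e })))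
      go (yes _) (no q∉) _ = there (here (inj₁ (within (a ∷ p ∷ q ∷ b ∷ []) (p ∷ a ∷ b ∷ []) h λ w∈ →
          λ { (0th e) → 1st e ; (1st e) → 0th e ; (2nd refl) → ⊥-elim (q∉ w∈) ; (3rd e) → 2nd e })))
      go (yes _) (yes _) (no b∉) = here (inj₂ (within (a ∷ p ∷ q ∷ b ∷ []) (q ∷ p ∷ a ∷ []) h λ w∈ →
          λ { (0th e) → 2nd e ; (1st e) → 1st e ; (2nd e) → 0th e ; (3rd refl) → ⊥-elim (b∉ w∈) }))
      go (yes p∈) (yes q∈) (yes b∈) = ⊥-elim (A⊈σ λ w∈ → at (∈⟪⟫⁻ (p ∷ q ∷ b ∷ []) w∈))
        where
        at : ∀ {w} → w ∈ₗ p ∷ q ∷ b ∷ [] → w ∈ σ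
        at (0th refl) = p∈
        at (1st refl) = q∈
        at (2nd refl) = b∈

  path-sphere : ∀ q a b R → Unique (p ∷ q ∷ a ∷ b ∷ R) → CombinatorialSphere 2 (path q (a ∷ b ∷ R))
  path-sphere q a b []      u = fwd (relabel (path-base q a b u)) ◅ ε
  path-sphere q a b (c ∷ R) u@((p≢q ∷ _ ∷ p∉) ∷ (_ ∷ q∉) ∷ _ ∷ uR) =
    fwd (relabel (path-star q a b c R u)) ◅
    bwd (starring (path q (b ∷ c ∷ R)) ⟪ p ∷ q ∷ b ∷ [] ⟫ (p , ∈⟪⟫⁺ (p ∷ q ∷ b ∷ []) (here refl))
      (here (inj₂ (within (p ∷ q ∷ b ∷ []) (q ∷ p ∷ b ∷ []) id λ _ → λ
        { (here e) → there (here e) ; (there (here e)) → here e ; (there (there (here e))) → there (there (here e)) })))) ◅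
    path-sphere q b c R ((p≢q ∷ p∉) ∷ q∉ ∷ uR)

-- The cyclic 4-polytope

chain-distinct : {A : Set} {x z : A} {xs : List A} → Unique (z ∷ x ∷ xs) →
                 ∀ {s t} → (s , t) ∈ₗ chain x xs z → s ≢ t
chain-distinct {xs = []}     ((z≢x ∷ _) ∷ _)                     (here refl) e = z≢x (sym e)
chain-distinct {xs = y ∷ xs} (_ ∷ (x≢y ∷ _) ∷ _)                 (here refl) e = x≢y e
chain-distinct {xs = y ∷ xs} ((z≢x ∷ z∉) ∷ _ ∷ u)                (there e∈)    = chain-distinct (z∉ ∷ u) e∈

PathTriangle : Fin n → Fin n → List (Fin n) → Subset n → Set
PathTriangle p q R σ =
  ∃ λ t → Unique t × length t ≡ 3 × All (_∈ₗ p ∷ q ∷ R) t × σ ⊆ ⟪ t ⟫ × Face (path p q R) ⟪ t ⟫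

-- Purity of the link, which passes to the polytope boundary by adding `v`. Only the degenerate sets
-- at the two ends have to be replaced by a larger one.
path-triangle : ∀ {p q a b : Fin n} {R} → Unique (p ∷ q ∷ a ∷ b ∷ R) → ∀ {σ} → Face (path p q (a ∷ b ∷ R)) σ →
                PathTriangle p q (a ∷ b ∷ R) σ
path-triangle {p = p} {q} {a} {b} {R} ((p≢q ∷ p∉@(p≢a ∷ _)) ∷ u@((q≢a ∷ q∉) ∷ _)) {σ} = go
  where
  qpa : σ ⊆ ⟪ q ∷ p ∷ a ∷ [] ⟫ → PathTriangle p q (a ∷ b ∷ R) σ
  qpa h = q ∷ p ∷ a ∷ [] , ((p≢q ∘ sym) ∷ q≢a ∷ []) ∷ (p≢a ∷ []) ∷ [] ∷ [] , refl
        , there (here refl) ∷ here refl ∷ there (there (here refl)) ∷ [] , h , here (inj₂ id)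
  go : PathFace p q σ (chain p (a ∷ b ∷ R) q) → PathTriangle p q (a ∷ b ∷ R) σ
  go (here (inj₁ h)) = qpa (within (p ∷ p ∷ a ∷ []) (q ∷ p ∷ a ∷ []) h λ _ → λ
    { (here e) → there (here e) ; (there (here e)) → there (here e) ; (there (there e)) → there (there e) })
  go (here (inj₂ h)) = qpa h
  go (there faces) with (y , z) , e∈ , h ← find faces with y∈ , z∈ ← chain-members e∈ = at z∈ h
    where
    p≢ : ∀ {w} → w ∈ₗ a ∷ b ∷ R → p ≢ w
    p≢ = All.lookup p∉
    q≢ : ∀ {w} → w ∈ₗ a ∷ b ∷ R → q ≢ w
    q≢ = All.lookup (q≢a ∷ q∉)
    y≢z = chain-distinct u e∈
    pyz : z ∈ₗ q ∷ b ∷ R → p ≢ z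
    pyz (here refl)  = p≢q
    pyz (there z∈R)  = p≢ (there z∈R)
    zin : z ∈ₗ q ∷ b ∷ R → z ∈ₗ p ∷ q ∷ a ∷ b ∷ R
    zin (here e)    = there (here e)
    zin (there z∈R) = there (there (there z∈R))
    at : z ∈ₗ q ∷ b ∷ R → σ ⊆ ⟪ p ∷ y ∷ z ∷ [] ⟫ ⊎ σ ⊆ ⟪ q ∷ y ∷ z ∷ [] ⟫ → PathTriangle p q (a ∷ b ∷ R) σ
    first : σ ⊆ ⟪ p ∷ y ∷ z ∷ [] ⟫ → PathTriangle p q (a ∷ b ∷ R) σ
    first h = p ∷ y ∷ z ∷ [] , (p≢ y∈ ∷ pyz z∈ ∷ []) ∷ (y≢z ∷ []) ∷ [] ∷ [] , refl
            , here refl ∷ there (there y∈) ∷ zin z∈ ∷ [] , h , there (lose e∈ (inj₁ id))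
    at _ (inj₁ h) = first h
    at (here refl) (inj₂ h) = first (within (q ∷ y ∷ q ∷ []) (p ∷ y ∷ q ∷ []) h λ _ → λ
      { (here e) → there (there (here e)) ; (there e) → there e })
    at (there z∈R) (inj₂ h) = q ∷ y ∷ z ∷ [] , (q≢ y∈ ∷ q≢ (there z∈R) ∷ []) ∷ (y≢z ∷ []) ∷ [] ∷ [] , refl
            , there (here refl) ∷ there (there y∈) ∷ zin (there z∈R) ∷ [] , h , there (lose e∈ (inj₂ id))

ends : Fin n × Fin n → Fin n × Fin n → List (Fin n)
ends (s , t) (s′ , t′) = s ∷ t ∷ s′ ∷ t′ ∷ []

-- By Gale's evenness condition the boundary of the cyclic 4-polytope consists of the sets contained
-- in the union of two edges of the cycle x, xs of its vertices.
module Cyclic {n} (x : Fin n) (xs : List (Fin n)) (unique : Unique (x ∷ xs)) (covers : ∀ v → v ∈ₗ x ∷ xs)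
              (long : 5 ℕ.≤ length xs) where

  -- Ending the chain at its own starting point closes the path to a cycle.
  edges : List (Fin n × Fin n)
  edges = chain x xs x

  -- The two edges may meet or coincide; their union then has fewer than four vertices and is a face
  -- of lower dimension.
  CyclicFace : Subset n → Set
  CyclicFace σ = Any (λ e → Any (λ e′ → σ ⊆ ⟪ ends e e′ ⟫) edges) edges

  face⁺ : ∀ {σ e e′} → e ∈ₗ edges → e′ ∈ₗ edges → σ ⊆ ⟪ ends e e′ ⟫ → CyclicFace σ
  face⁺ e∈ e′∈ h = lose e∈ (lose e′∈ h)

  face⁻ : ∀ {σ} → CyclicFace σ → ∃₂ λ e e′ → e ∈ₗ edges × e′ ∈ₗ edges × σ ⊆ ⟪ ends e e′ ⟫
  face⁻ faces with e , e∈ , f ← find faces with e′ , e′∈ , h ← find f = e , e′ , e∈ , e′∈ , h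

  out-edge : ∀ v → ∃ λ w → (v , w) ∈ₗ edges
  out-edge v = go x xs (covers v)
    where
    go : ∀ y ys {z} → v ∈ₗ y ∷ ys → ∃ λ w → (v , w) ∈ₗ chain y ys z
    go y []        (here refl) = _ , here refl
    go y (y′ ∷ ys) (here refl) = _ , here refl
    go y (y′ ∷ ys) (there v∈) with w , e∈ ← go y′ ys v∈ = w , there e∈

  boundary : Complex n
  boundary = record
    { Face     = CyclicFace
    ; Face?    = λ σ → any? (λ e → any? (λ e′ → σ ⊆? ⟪ ends e e′ ⟫) edges) edges
    ; ∅-face   = face⁺ (proj₂ (out-edge x)) (proj₂ (out-edge x)) (⊥-elim ∘ ∉⊥)
    ; downward = λ σ⊆τ faces → let e , e′ , e∈ , e′∈ , h = face⁻ faces in face⁺ e∈ e′∈ (λ w∈ → h (σ⊆τ w∈))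
    }

  -- Each of the two vertices starts an edge of the cycle, and any two edges span a face.
  neighborly : ∀ v w → CyclicFace (⁅ v ⁆ ∪ ⁅ w ⁆)
  neighborly v w = face⁺ (proj₂ (out-edge v)) (proj₂ (out-edge w))
    (∪-lub (⁅x⁆⊆ (∈⟪⟫⁺ (ends (v , _) (w , _)) (here refl))) (⁅x⁆⊆ (∈⟪⟫⁺ (ends (v , _) (w , _)) (there (there (here refl))))))

  vertex : ∀ v → CyclicFace ⁅ v ⁆
  vertex v = downward boundary (p⊆p∪q ⁅ v ⁆) (neighborly v v)

  -- The cycle read from `v` is `v`, `p`, `a`, `b`, `R`, `q`: two edges at `v` and a path through
  -- the other vertices. In `unique-at` the end `q` is moved forward to agree with `path-sphere`.
  record Rotation (v : Fin n) : Set where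
    field
      p q a b   : Fin n
      R         : List (Fin n)
      unique-at : Unique (v ∷ p ∷ q ∷ a ∷ b ∷ R)
      first     : (v , p) ∈ₗ edges
      last      : (q , v) ∈ₗ edges
      middle    : ∀ {e} → e ∈ₗ chain p (a ∷ b ∷ R) q → e ∈ₗ edges
      split     : ∀ {e} → e ∈ₗ edges → e ≡ (v , p) ⊎ e ≡ (q , v) ⊎ e ∈ₗ chain p (a ∷ b ∷ R) q

  start-at : ∀ v → ∃ λ ws → v ∷ ws ↭ x ∷ xs × (∀ {e} → e ∈ₗ chain v ws v → e ∈ₗ edges)
                                            × (∀ {e} → e ∈ₗ edges → e ∈ₗ chain v ws v)
  start-at v = go (covers v)
    where
    swap-++ : {A : Set} (ys zs : List A) {e : A} → e ∈ₗ ys ++ zs → e ∈ₗ zs ++ ys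
    swap-++ ys zs e∈ = [ ∈-++⁺ʳ zs , ∈-++⁺ˡ ]′ (∈-++⁻ ys e∈)
    go : v ∈ₗ x ∷ xs → ∃ λ ws → v ∷ ws ↭ x ∷ xs × (∀ {e} → e ∈ₗ chain v ws v → e ∈ₗ edges)
                                                 × (∀ {e} → e ∈ₗ edges → e ∈ₗ chain v ws v)
    go (here refl) = xs , ↭.refl , id , id
    -- The cycle `x`, `ys`, `v`, `zs` is reread as `v`, `zs`, `x`, `ys`; its edge list consists of
    -- the same two chains in the opposite order.
    go (there v∈) with ys , zs , refl ← ∈-∃++ v∈ = zs ++ x ∷ ys , ↭.++-comm (v ∷ zs) (x ∷ ys)
      , (λ {e} e∈ → subst (e ∈ₗ_) (sym (chain-++ x ys v zs x))
          (swap-++ (chain v zs x) (chain x ys v) (subst (e ∈ₗ_) (chain-++ v zs x ys v) e∈)))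
      , (λ {e} e∈ → subst (e ∈ₗ_) (sym (chain-++ v zs x ys v))
          (swap-++ (chain x ys v) (chain v zs x) (subst (e ∈ₗ_) (chain-++ x ys v zs x) e∈)))

  rotation : ∀ v → Rotation v
  rotation v with ws , perm , to , from ← start-at v =
    go ws (ℕ.≤-trans long (ℕ.≤-reflexive (sym (ℕ.suc-injective (↭.↭-length perm)))))
       (↭ₛ.Unique-resp-↭ (setoid (Fin n)) (↭⇒↭ₛ (↭-sym perm)) unique) to from
    where
    close : ∀ {p a b rest} → InitLast rest → 1 ℕ.≤ length rest → Unique (v ∷ p ∷ a ∷ b ∷ rest) →
            (∀ {e} → e ∈ₗ chain v (p ∷ a ∷ b ∷ rest) v → e ∈ₗ edges) →
            (∀ {e} → e ∈ₗ edges → e ∈ₗ chain v (p ∷ a ∷ b ∷ rest) v) → Rotation v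
    close {p} {a} {b} (R ∷ʳ′ q) _ u to from = record
      { p = p ; q = q ; a = a ; b = b ; R = R
      ; unique-at = ↭ₛ.Unique-resp-↭ (setoid (Fin n)) (↭⇒↭ₛ (prep v (prep p (↭.++-comm (a ∷ b ∷ R) [ q ])))) u
      ; first  = to (here refl)
      ; last   = to (there (subst ((q , v) ∈ₗ_) (sym split-last) (∈-++⁺ʳ (chain p (a ∷ b ∷ R) q) (here refl))))
      ; middle = λ {e} e∈ → to (there (subst (e ∈ₗ_) (sym split-last) (∈-++⁺ˡ e∈)))
      ; split  = λ {e} e∈ → cases (from e∈)
      }
      where
      split-last : chain p (a ∷ b ∷ (R ∷ʳ q)) v ≡ chain p (a ∷ b ∷ R) q ++ [ (q , v) ]
      split-last = chain-++ p (a ∷ b ∷ R) q [] v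
      cases : ∀ {e} → e ∈ₗ (v , p) ∷ chain p (a ∷ b ∷ (R ∷ʳ q)) v →
              e ≡ (v , p) ⊎ e ≡ (q , v) ⊎ e ∈ₗ chain p (a ∷ b ∷ R) q
      cases (here e≡) = inj₁ e≡
      cases {e} (there e∈) with ∈-++⁻ (chain p (a ∷ b ∷ R) q) (subst (e ∈ₗ_) split-last e∈)
      ... | inj₁ e∈′       = inj₂ (inj₂ e∈′)
      ... | inj₂ (here e≡) = inj₂ (inj₁ e≡)
    go : ∀ ws → 5 ℕ.≤ length ws → Unique (v ∷ ws) → (∀ {e} → e ∈ₗ chain v ws v → e ∈ₗ edges) →
         (∀ {e} → e ∈ₗ edges → e ∈ₗ chain v ws v) → Rotation v
    go (p ∷ a ∷ b ∷ rest) (ℕ.s≤s (ℕ.s≤s (ℕ.s≤s h))) = close (initLast rest) (ℕ.≤-trans (ℕ.s≤s ℕ.z≤n) h)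
    go (_ ∷ [])     (ℕ.s≤s ())
    go (_ ∷ _ ∷ []) (ℕ.s≤s (ℕ.s≤s ()))

  module AtVertex (v : Fin n) where
    open Rotation (rotation v)

    v∉ : ∀ {w} → w ∈ₗ p ∷ q ∷ a ∷ b ∷ R → v ≢ w
    v∉ w∈ with v∉′ ∷ _ ← unique-at = All.lookup v∉′ w∈

    unique-path : Unique (p ∷ q ∷ a ∷ b ∷ R)
    unique-path with _ ∷ u ← unique-at = u

    chain-∌ : ∀ {s t} → (s , t) ∈ₗ chain p (a ∷ b ∷ R) q → v ≢ s × v ≢ t
    chain-∌ e∈ with s∈ , t∈ ← chain-members e∈ = v∉ (skip s∈) , v∉ (there t∈)
      where
      skip : ∀ {s} → s ∈ₗ p ∷ a ∷ b ∷ R → s ∈ₗ p ∷ q ∷ a ∷ b ∷ R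
      skip (here e)   = here e
      skip (there s∈) = there (there s∈)

    -- One of the two edges passes through `v`, hence it is `(v , p)` or `(q , v)` and leaves only
    -- `p` or `q` to `σ`. If the other edge lies on the path, this is a triangle of the link; if it
    -- passes through `v` too, then `σ` has at most the vertices `p` and `q`, which lie in the
    -- triangle `q p a`.
    to-path : ∀ {σ} → v ∉ σ → CyclicFace (σ ∪ ⁅ v ⁆) → Face (path p q (a ∷ b ∷ R)) σ
    to-path {σ} v∉σ faces with face⁻ faces
    ... | (s , t) , (s′ , t′) , e∈ , e′∈ , h = by-end (∈⟪⟫⁻ (s ∷ t ∷ s′ ∷ t′ ∷ []) (h (q⊆p∪q σ ⁅ v ⁆ (x∈⁅x⁆ v))))
      where
      σ⊆ : σ ⊆ ⟪ s ∷ t ∷ s′ ∷ t′ ∷ [] ⟫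
      σ⊆ w∈ = h (p⊆p∪q ⁅ v ⁆ w∈)
      p∈e : σ ⊆ ⟪ q ∷ p ∷ a ∷ [] ⟫ → Face (path p q (a ∷ b ∷ R)) σ
      p∈e h = here (inj₂ h)
      drop-v : {w : Fin n} {ys : List (Fin n)} → w ∈ σ → w ∈ₗ v ∷ ys → w ∈ₗ ys
      drop-v w∈σ (here refl) = ⊥-elim (v∉σ w∈σ)
      drop-v w∈σ (there w∈)  = w∈
      other : ∀ {r s′ t′} → (s′ , t′) ∈ₗ edges → r ≡ p ⊎ r ≡ q → σ ⊆ ⟪ r ∷ s′ ∷ t′ ∷ [] ⟫ → Face (path p q (a ∷ b ∷ R)) σ
      other {r} e′∈ r≡ h with split e′∈ | r≡
      ... | inj₁ refl | inj₁ refl = p∈e (within (p ∷ v ∷ p ∷ []) (q ∷ p ∷ a ∷ []) h λ w∈ → λ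
              { (here e) → there (here e) ; (there (here refl)) → ⊥-elim (v∉σ w∈) ; (there (there (here e))) → there (here e) })
      ... | inj₁ refl | inj₂ refl = p∈e (within (q ∷ v ∷ p ∷ []) (q ∷ p ∷ a ∷ []) h λ w∈ → λ
              { (here e) → here e ; (there (here refl)) → ⊥-elim (v∉σ w∈) ; (there (there (here e))) → there (here e) })
      ... | inj₂ (inj₁ refl) | inj₁ refl = p∈e (within (p ∷ q ∷ v ∷ []) (q ∷ p ∷ a ∷ []) h λ w∈ → λ
              { (here e) → there (here e) ; (there (here e)) → here e ; (there (there (here refl))) → ⊥-elim (v∉σ w∈) })
      ... | inj₂ (inj₁ refl) | inj₂ refl = p∈e (within (q ∷ q ∷ v ∷ []) (q ∷ p ∷ a ∷ []) h λ w∈ → λ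
              { (here e) → here e ; (there (here e)) → here e ; (there (there (here refl))) → ⊥-elim (v∉σ w∈) })
      ... | inj₂ (inj₂ e″∈) | inj₁ refl = lose e″∈ (inj₁ h)
      ... | inj₂ (inj₂ e″∈) | inj₂ refl = lose e″∈ (inj₂ h)
      through : ∀ {s t s′ t′} → (s , t) ∈ₗ edges → (s′ , t′) ∈ₗ edges → v ≡ s ⊎ v ≡ t →
                σ ⊆ ⟪ s ∷ t ∷ s′ ∷ t′ ∷ [] ⟫ → Face (path p q (a ∷ b ∷ R)) σ
      through {s′ = s′} {t′} e∈ e′∈ v∈e h with split e∈
      ... | inj₁ refl = other e′∈ (inj₁ refl) (within (v ∷ p ∷ s′ ∷ t′ ∷ []) (p ∷ s′ ∷ t′ ∷ []) h drop-v)
      ... | inj₂ (inj₁ refl) = other e′∈ (inj₂ refl) (within (q ∷ v ∷ s′ ∷ t′ ∷ []) (q ∷ s′ ∷ t′ ∷ []) h λ w∈ → λ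
              { (here e) → here e ; (there w∈′) → there (drop-v w∈ w∈′) })
      ... | inj₂ (inj₂ e″∈) = ⊥-elim ([ proj₁ (chain-∌ e″∈) , proj₂ (chain-∌ e″∈) ]′ v∈e)
      σ⊆′ : σ ⊆ ⟪ s′ ∷ t′ ∷ s ∷ t ∷ [] ⟫
      σ⊆′ = within (s ∷ t ∷ s′ ∷ t′ ∷ []) (s′ ∷ t′ ∷ s ∷ t ∷ []) σ⊆ λ _ w∈ →
        [ ∈-++⁺ʳ (s′ ∷ t′ ∷ []) , ∈-++⁺ˡ ]′ (∈-++⁻ (s ∷ t ∷ []) w∈)
      by-end : v ∈ₗ s ∷ t ∷ s′ ∷ t′ ∷ [] → Face (path p q (a ∷ b ∷ R)) σ
      by-end (here e)                         = through e∈ e′∈ (inj₁ e) σ⊆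
      by-end (there (here e))                 = through e∈ e′∈ (inj₂ e) σ⊆
      by-end (there (there (here e)))         = through e′∈ e∈ (inj₁ e) σ⊆′
      by-end (there (there (there (here e)))) = through e′∈ e∈ (inj₂ e) σ⊆′

    -- The end point `p` or `q` of the triangle is joined to `v` by an edge of the cycle; together
    -- with the path edge it spans a face containing the triangle and `v`.
    from-path : ∀ {σ} → Face (path p q (a ∷ b ∷ R)) σ → v ∉ σ × CyclicFace (σ ∪ ⁅ v ⁆)
    from-path {σ} faces with (s , t) , e∈ , h ← find faces with v≢s , v≢t ← chain-∌ e∈ = at h
      where
      at : σ ⊆ ⟪ p ∷ s ∷ t ∷ [] ⟫ ⊎ σ ⊆ ⟪ q ∷ s ∷ t ∷ [] ⟫ → v ∉ σ × CyclicFace (σ ∪ ⁅ v ⁆)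
      at (inj₁ h) = (λ v∈ → absurd (∈⟪⟫⁻ (p ∷ s ∷ t ∷ []) (h v∈)))
        , face⁺ first (middle e∈) (∪-lub (within (p ∷ s ∷ t ∷ []) (v ∷ p ∷ s ∷ t ∷ []) h (λ _ → there))
            (⁅x⁆⊆ (∈⟪⟫⁺ (v ∷ p ∷ s ∷ t ∷ []) (here refl))))
        where
        absurd : v ∉ₗ p ∷ s ∷ t ∷ []
        absurd (here e)                 = v∉ (here refl) e
        absurd (there (here e))         = v≢s e
        absurd (there (there (here e))) = v≢t e
      at (inj₂ h) = (λ v∈ → absurd (∈⟪⟫⁻ (q ∷ s ∷ t ∷ []) (h v∈)))
        , face⁺ last (middle e∈) (∪-lub (within (q ∷ s ∷ t ∷ []) (q ∷ v ∷ s ∷ t ∷ []) h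
              (λ _ → λ { (here e) → here e ; (there w∈) → there (there w∈) }))
            (⁅x⁆⊆ (∈⟪⟫⁺ (q ∷ v ∷ s ∷ t ∷ []) (there (here refl)))))
        where
        absurd : v ∉ₗ q ∷ s ∷ t ∷ []
        absurd (here e)                 = v∉ (there (here refl)) e
        absurd (there (here e))         = v≢s e
        absurd (there (there (here e))) = v≢t e

    link-sphere : CombinatorialSphere 2 (link boundary v (vertex v))
    link-sphere = fwd (relabel (≅-ext (λ (v∉σ , faces) → to-path v∉σ faces) from-path)) ◅ path-sphere p q a b R unique-path

    facet : ∀ {σ} → CyclicFace (σ ∪ ⁅ v ⁆) → ∃ λ τ → σ ⊆ τ × CyclicFace τ × ∣ τ ∣ ≡ 4
    facet {σ} σ∪v∈M =
      let t , ut , len , t⊆ , σ⊆ , t∈ = path-triangle unique-path (to-path (x∉p-x σ v) rest) in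
      ⟪ v ∷ t ⟫ , (λ {w} w∈ → covered σ⊆ w w∈)
      , downward boundary (∪-lub (q⊆p∪q ⟪ t ⟫ ⁅ v ⁆) (p⊆p∪q ⁅ v ⁆)) (proj₂ (from-path t∈))
      , (∣⟪xs⟫∣≡length (All.map v∉ t⊆ ∷ ut) ∙ cong suc len)
      where
      rest : CyclicFace ((σ Subset.- v) ∪ ⁅ v ⁆)
      rest = downward boundary (∪-monoˡ-⊆ ⁅ v ⁆ (p─q⊆p σ ⁅ v ⁆)) σ∪v∈M
      covered : ∀ {τ} → σ Subset.- v ⊆ τ → ∀ w → w ∈ σ → w ∈ ⁅ v ⁆ ∪ τ
      covered {τ} σ⊆ w w∈σ with w ∈? ⁅ v ⁆
      ... | yes w∈v = p⊆p∪q τ w∈v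
      ... | no  w∉v = q⊆p∪q ⁅ v ⁆ τ (σ⊆ (x∈p∧x∉q⇒x∈p─q w∈σ w∉v))

  manifold : Combinatorial3Manifold boundary
  manifold = record
    { vertex = vertex
    ; pure   = record
      { dimension = λ {σ} σ∈M → let e , e′ , _ , _ , h = face⁻ σ∈M in
          ℕ.≤-trans (p⊆q⇒∣p∣≤∣q∣ h) (∣⟪xs⟫∣≤length (ends e e′))
      ; facet = λ {σ} → facet σ
      }
    ; links  = AtVertex.link-sphere
    }
    where
    facet : ∀ σ → CyclicFace σ → ∃ λ τ → σ ⊆ τ × CyclicFace τ × ∣ τ ∣ ≡ 4
    facet σ σ∈M with nonempty? σ
    ... | yes (v , v∈σ) = AtVertex.facet v (subst CyclicFace (sym (∪-absorb (⁅x⁆⊆ v∈σ))) σ∈M)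
    ... | no σ≡∅ = AtVertex.facet x (downward boundary (∪-lub (λ w∈ → ⊥-elim (σ≡∅ (_ , w∈))) id) (vertex x))

-- The two halves of the labels, alternating along the cycle

low : ∀ k m → Subset (k ℕ.+ m)
low zero    m = ⊥
low (suc k) m = inside ∷ low k m

∣low∣ : ∀ k m → ∣ low k m ∣ ≡ k
∣low∣ zero    m = ∣⊥∣≡0 m
∣low∣ (suc k) m = cong suc (∣low∣ k m)

∣∁low∣ : ∀ k m → ∣ ∁ (low k m) ∣ ≡ m
∣∁low∣ k m = ∣∁p∣≡n∸∣p∣ (low k m) ∙ cong (k ℕ.+ m ℕ.∸_) (∣low∣ k m) ∙ ℕ.m+n∸m≡n k m

low-< : ∀ k m {w} → w ∈ low k m → toℕ w ℕ.< k
low-< zero    m w∈                   = ⊥-elim (∉⊥ w∈)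
low-< (suc k) m {zero}  _             = ℕ.s≤s ℕ.z≤n
low-< (suc k) m {suc w} (there w∈) = ℕ.s≤s (low-< k m w∈)

∁low-≥ : ∀ k m {w} → w ∈ ∁ (low k m) → k ℕ.≤ toℕ w
∁low-≥ zero    m _                      = ℕ.z≤n
∁low-≥ (suc k) m {suc w} (there w∈) = ℕ.s≤s (∁low-≥ k m w∈)

↑ˡ-∈low : ∀ {k} m (i : Fin k) → i ↑ˡ m ∈ low k m
↑ˡ-∈low m zero    = here
↑ˡ-∈low m (suc i) = there (↑ˡ-∈low m i)

↑ʳ-∈∁low : ∀ k {m} (j : Fin m) → k ↑ʳ j ∈ ∁ (low k m)
↑ʳ-∈∁low zero    j = x∉p⇒x∈∁p ∉⊥
↑ʳ-∈∁low (suc k) j = there (↑ʳ-∈∁low k j)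

module Weave (k : ℕ) where
  -- `2 ℕ.* k` unfolds to `k ℕ.+ (k ℕ.+ 0)`, hence the embeddings past a summand `0`.
  inl inr : Fin k → Fin (2 ℕ.* k)
  inl i = i ↑ˡ (k ℕ.+ 0)
  inr i = k ↑ʳ (i ↑ˡ 0)

  low-half : Subset (2 ℕ.* k)
  low-half = low k (k ℕ.+ 0)

  -- The alternation is put into the order of the cycle rather than into the parts: these remain
  -- intervals of labels, so a function increasing in the label separates them.
  weave : List (Fin k) → List (Fin (2 ℕ.* k))
  weave []       = []
  weave (i ∷ is) = inl i ∷ inr i ∷ weave is

  inl-injective : ∀ {i j} → inl i ≡ inl j → i ≡ j
  inl-injective = Fin.↑ˡ-injective (k ℕ.+ 0) _ _

  inr-injective : ∀ {i j} → inr i ≡ inr j → i ≡ j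
  inr-injective e = Fin.↑ˡ-injective 0 _ _ (Fin.↑ʳ-injective k _ _ e)

  inl≢inr : ∀ {i j} → inl i ≢ inr j
  inl≢inr {i} {j} e = x∈∁p⇒x∉p (↑ʳ-∈∁low k (j ↑ˡ 0)) (subst (_∈ low-half) e (↑ˡ-∈low (k ℕ.+ 0) i))

  weave-fresh : ∀ {i is} → All (i ≢_) is → All (inl i ≢_) (weave is) × All (inr i ≢_) (weave is)
  weave-fresh []         = [] , []
  weave-fresh (i≢j ∷ i∉) with l , r ← weave-fresh i∉ =
    (i≢j ∘ inl-injective) ∷ inl≢inr ∷ l , (inl≢inr ∘ sym) ∷ (i≢j ∘ inr-injective) ∷ r

  weave-unique : ∀ {is} → Unique is → Unique (weave is)
  weave-unique []       = []
  weave-unique (i∉ ∷ u) with l , r ← weave-fresh i∉ = (inl≢inr ∷ l) ∷ r ∷ weave-unique u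

  inl-∈ : ∀ {i is} → i ∈ₗ is → inl i ∈ₗ weave is
  inl-∈ (here refl) = here refl
  inl-∈ (there i∈)  = there (there (inl-∈ i∈))

  inr-∈ : ∀ {i is} → i ∈ₗ is → inr i ∈ₗ weave is
  inr-∈ (here refl) = there (here refl)
  inr-∈ (there i∈)  = there (there (inr-∈ i∈))

  length-weave : ∀ is → length (weave is) ≡ 2 ℕ.* length is
  length-weave []       = refl
  length-weave (i ∷ is) = cong (λ l → suc (suc l)) (length-weave is) ∙ sym (ℕ.*-suc 2 (length is))

  weave-covers : ∀ w → w ∈ₗ weave (allFin k)
  weave-covers w with splitAt k w in e
  ... | inj₁ i = subst (_∈ₗ weave (allFin k)) (Fin.splitAt⁻¹-↑ˡ e) (inl-∈ (∈-allFin i))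
  ... | inj₂ j with splitAt k j in e′
  ... | inj₁ i = subst (_∈ₗ weave (allFin k)) (cong (k ↑ʳ_) (Fin.splitAt⁻¹-↑ˡ e′) ∙ Fin.splitAt⁻¹-↑ʳ e) (inr-∈ (∈-allFin i))

  Bicolored : Fin (2 ℕ.* k) × Fin (2 ℕ.* k) → Set
  Bicolored (s , t) = (s ∈ low-half × t ∈ ∁ low-half) ⊎ (s ∈ ∁ low-half × t ∈ low-half)

  weave-bicolored : ∀ i is {z e} → e ∈ₗ chain (inl i) (inr i ∷ weave is) (inl z) → Bicolored e
  weave-bicolored i is (here refl) = inj₁ (↑ˡ-∈low (k ℕ.+ 0) i , ↑ʳ-∈∁low k (i ↑ˡ 0))
  weave-bicolored i []       {z} (there (here refl)) = inj₂ (↑ʳ-∈∁low k (i ↑ˡ 0) , ↑ˡ-∈low (k ℕ.+ 0) z)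
  weave-bicolored i (j ∷ is)     (there (here refl)) = inj₂ (↑ʳ-∈∁low k (i ↑ˡ 0) , ↑ˡ-∈low (k ℕ.+ 0) j)
  weave-bicolored i (j ∷ is)     (there (there e∈))  = weave-bicolored j is e∈

-- The slicing

module _ where
  open import Data.Integer.Base using (ℤ; +_)
  open import Data.Rational using (ℚ; _+_; _*_; _-_; -_; ½; _<_; _≤_; _≥_; _/_; 0ℚ)
  import Data.Rational as ℚ
  import Data.Rational.Properties as ℚ
  open import Data.Rational.Unnormalised.Base as ℚᵘ using (mkℚᵘ; *≡*; *≤*; *<*)
  import Data.Rational.Unnormalised.Properties as ℚᵘ
  open Bipartition using (V₁; V₂)
  open Slicing using (quadrilaterals; HasGenus; cell?; quadrilateral?; χ)

  -- The embedding of the integers into the rationals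

  ι : ℤ → ℚ
  ι i = i / 1

  toℚᵘ-ι : ∀ i → ℚ.toℚᵘ (ι i) ℚᵘ.≃ mkℚᵘ i 0
  toℚᵘ-ι i = ℚ.toℚᵘ-fromℚᵘ (mkℚᵘ i 0)

  ι-+ : ∀ i j → ι i + ι j ≡ ι (i ℤ.+ j)
  ι-+ i j = ℚ.toℚᵘ-injective (ℚᵘ.≃-trans (ℚ.toℚᵘ-homo-+ (ι i) (ι j))
    (ℚᵘ.≃-trans (ℚᵘ.+-cong (toℚᵘ-ι i) (toℚᵘ-ι j))
    (ℚᵘ.≃-trans (*≡* (lem i j)) (ℚᵘ.≃-sym (toℚᵘ-ι (i ℤ.+ j))))))
    where
    lem : ∀ i j → (i ℤ.* + 1 ℤ.+ j ℤ.* + 1) ℤ.* + 1 ≡ (i ℤ.+ j) ℤ.* + 1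
    lem = ℤSolver.solve-∀

  ι-* : ∀ i j → ι i * ι j ≡ ι (i ℤ.* j)
  ι-* i j = ℚ.toℚᵘ-injective (ℚᵘ.≃-trans (ℚ.toℚᵘ-homo-* (ι i) (ι j))
    (ℚᵘ.≃-trans (ℚᵘ.*-cong (toℚᵘ-ι i) (toℚᵘ-ι j)) (ℚᵘ.≃-sym (toℚᵘ-ι (i ℤ.* j)))))

  ι-minus : ∀ i j → ι i - ι j ≡ ι (i ℤ.- j)
  ι-minus i j = cong (_- ι j) (cong ι (lem i j) ∙ sym (ι-+ (i ℤ.- j) j)) ∙ cancel (ι (i ℤ.- j)) (ι j)
    where
    lem : ∀ i j → i ≡ (i ℤ.- j) ℤ.+ j
    lem = ℤSolver.solve-∀
    cancel : ∀ x y → (x + y) - y ≡ x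
    cancel = solve 2 (λ x y → (x :+ y) :- y := x) refl
      where open +-*-Solver

  ι-≤ : ∀ {i j} → i ℤ.≤ j → ι i ≤ ι j
  ι-≤ {i} {j} i≤j = ℚ.toℚᵘ-cancel-≤ (ℚᵘ.≤-respˡ-≃ (ℚᵘ.≃-sym (toℚᵘ-ι i)) (ℚᵘ.≤-respʳ-≃ (ℚᵘ.≃-sym (toℚᵘ-ι j))
    (*≤* (ℤ.*-monoʳ-≤-nonNeg (+ 1) i≤j))))

  ι-< : ∀ {i j} → i ℤ.< j → ι i < ι j
  ι-< {i} {j} i<j = ℚ.toℚᵘ-cancel-< (ℚᵘ.<-respˡ-≃ (ℚᵘ.≃-sym (toℚᵘ-ι i)) (ℚᵘ.<-respʳ-≃ (ℚᵘ.≃-sym (toℚᵘ-ι j))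
    (*<* (ℤ.*-monoʳ-<-pos (+ 1) i<j))))

  ι-injective : ∀ {i j} → ι i ≡ ι j → i ≡ j
  ι-injective {i} {j} e with *≡* i≡j ← ℚᵘ.≃-trans (ℚᵘ.≃-sym (toℚᵘ-ι i)) (ℚᵘ.≃-trans (ℚ.toℚᵘ-cong e) (toℚᵘ-ι j)) =
    sym (ℤ.*-identityʳ i) ∙ i≡j ∙ ℤ.*-identityʳ j

  -- Cell numbers of a slicing and the lower bound

  module SlicingCounts (M : Complex n) {P : Bipartition n} (s : SeparatingRsl P) where
    open Tally M (V₁ P)

    private
      V₂≡∁V₁ : V₂ P ≡ ∁ (V₁ P)
      V₂≡∁V₁ = complement (V₁ P) (V₂ P) (Bipartition.cover P) (Bipartition.disjoint P)

      ∣∩V₂∣ : ∀ σ → ∣ σ ∩ V₂ P ∣ ≡ #₂ (V₁ P) σ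
      ∣∩V₂∣ σ = cong (λ V → ∣ σ ∩ V ∣) V₂≡∁V₁

      ind-nonempty : (σ : Subset n) → ind (nonempty? σ) ≡ pos ∣ σ ∣
      ind-nonempty σ with ∣ σ ∣ in eq
      ... | zero  = ind-no (nonempty? σ) (λ σ≢∅ → ℕ.1+n≰n (subst (1 ℕ.≤_) eq (nonempty-∣∣ σ≢∅)))
      ... | suc _ = ind-yes (nonempty? σ) (∣∣-nonempty (subst (1 ℕ.≤_) (sym eq) (ℕ.s≤s ℕ.z≤n)))

      ind-≟ : ∀ i j → ind (i ℕ.≟ j) ≡ δ j i
      ind-≟ i j with i ℕ.≟ j
      ... | yes refl = sym (δ-refl i)
      ... | no i≢j   = sym (δ-≢ j i (i≢j ∘ sym))

    -- Whether the level set meets a face depends only on the face having vertices in both parts, so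
    -- the values of the rsl-function disappear from the count.
    count-cell : ∀ d → + count (cell? M s d) ≡ T (cross (2 ℕ.+ d))
    count-cell d = count-Σ⊆ (cell? M s d) ∙ Σ⊆-cong λ σ →
      ind-× (Face? M σ) (meetsLevel? s σ ×-dec (∣ σ ∣ ℕ.≟ 2 ℕ.+ d))
      ∙ cong (⟦ M ⟧ σ ℤ.*_) (ind-× (meetsLevel? s σ) (∣ σ ∣ ℕ.≟ 2 ℕ.+ d) ∙ cong₂ ℤ._*_
        (ind-cong {P? = meetsLevel? s σ} {nonempty? (σ ∩ V₁ P) ×-dec nonempty? (σ ∩ V₂ P)}
            (meets⇒bothSides s) (bothSides⇒meets s)
          ∙ ind-× (nonempty? (σ ∩ V₁ P)) (nonempty? (σ ∩ V₂ P))
          ∙ cong₂ ℤ._*_ (ind-nonempty (σ ∩ V₁ P)) (ind-nonempty (σ ∩ V₂ P) ∙ cong pos (∣∩V₂∣ σ)))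
        (ind-≟ ∣ σ ∣ (2 ℕ.+ d) ∙ cong (δ (2 ℕ.+ d)) (sym (∣∩∣+∣∩∁∣ σ (V₁ P)))))

    -- Two vertices in each part already force four vertices and a nonempty section.
    count-quadrilaterals : + quadrilaterals M s ≡ T quad
    count-quadrilaterals = count-Σ⊆ (quadrilateral? M s) ∙ Σ⊆-cong λ σ →
      ind-cong {P? = quadrilateral? M s σ} {Face? M σ ×-dec ((∣ σ ∩ V₁ P ∣ ℕ.≟ 2) ×-dec (∣ σ ∩ V₂ P ∣ ℕ.≟ 2))}
        (λ ((σ∈M , _) , a , b) → σ∈M , a , b)
        (λ (σ∈M , a , b) → (σ∈M , bothSides⇒meets s (two a , two b) , size4 σ a b) , a , b)
      ∙ ind-× (Face? M σ) ((∣ σ ∩ V₁ P ∣ ℕ.≟ 2) ×-dec (∣ σ ∩ V₂ P ∣ ℕ.≟ 2))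
      ∙ cong (⟦ M ⟧ σ ℤ.*_) (ind-× (∣ σ ∩ V₁ P ∣ ℕ.≟ 2) (∣ σ ∩ V₂ P ∣ ℕ.≟ 2)
        ∙ cong₂ ℤ._*_ (ind-≟ ∣ σ ∩ V₁ P ∣ 2) (ind-≟ ∣ σ ∩ V₂ P ∣ 2 ∙ cong (δ 2) (∣∩V₂∣ σ)))
      where
      two : {σ : Subset n} → ∣ σ ∣ ≡ 2 → Nonempty σ
      two e = ∣∣-nonempty (subst (1 ℕ.≤_) (sym e) (ℕ.s≤s ℕ.z≤n))
      size4 : ∀ σ → ∣ σ ∩ V₁ P ∣ ≡ 2 → ∣ σ ∩ V₂ P ∣ ≡ 2 → ∣ σ ∣ ≡ 4
      size4 σ a b = sym (∣∩∣+∣∩∁∣ σ (V₁ P)) ∙ cong₂ ℕ._+_ a (sym (∣∩V₂∣ σ) ∙ b)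

    χ-T : ι (χ M s) ≡ (ι (T (cross 2)) - ι (T (cross 3))) + ι (T (cross 4))
    χ-T = cong ι (cong₂ ℤ._+_ (cong₂ ℤ._-_ (count-cell 0) (count-cell 1)) (count-cell 2))
      ∙ sym (ι-+ (T (cross 2) ℤ.- T (cross 3)) (T (cross 4)))
      ∙ cong (_+ ι (T (cross 4))) (sym (ι-minus (T (cross 2)) (T (cross 3))))

    module FaceRelations (manifold : Combinatorial3Manifold M) (neighborly : TwoNeighborly M) where
      open FaceNumbers M manifold (V₁ P)

      -- v, e and f count the cells of the slicing by dimension, f₄ all faces of M with four vertices.
      ν ν₁ ν₂ v e f f₄ q : ℚ
      ν  = fromℕ n
      ν₁ = fromℕ ∣ V₁ P ∣
      ν₂ = fromℕ ∣ V₂ P ∣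
      v  = ι (T (cross 2))
      e  = ι (T (cross 3))
      f  = ι (T (cross 4))
      f₄ = ι (T (size 4))
      q  = fromℕ (quadrilaterals M s)

      ν-split : ν ≡ ν₁ + ν₂
      ν-split = cong fromℕ (sym ∣V∣+∣∁V∣≡n ∙ cong (λ V → ∣ V₁ P ∣ ℕ.+ ∣ V ∣) (sym V₂≡∁V₁))
        ∙ sym (ι-+ (+ ∣ V₁ P ∣) (+ ∣ V₂ P ∣))

      v-eq : v ≡ ν₁ * ν₂
      v-eq = cong ι (crossing-vertices neighborly ∙ cong (λ V → + ∣ V₁ P ∣ ℤ.* + ∣ V ∣) (sym V₂≡∁V₁))
        ∙ sym (ι-* (+ ∣ V₁ P ∣) (+ ∣ V₂ P ∣))

      e-eq : e + e ≡ fromℕ 3 * f + q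
      e-eq = ι-+ (T (cross 3)) (T (cross 3)) ∙ cong ι crossing-edges
        ∙ sym (ι-+ (+ 3 ℤ.* T (cross 4)) (T quad))
        ∙ cong₂ _+_ (sym (ι-* (+ 3) (T (cross 4)))) (cong ι (sym count-quadrilaterals))

      f₄-eq : fromℕ 2 * f₄ ≡ ν * ν - fromℕ 3 * ν
      f₄-eq = ι-* (+ 2) (T (size 4)) ∙ cong ι (tetrahedra neighborly)
        ∙ sym (ι-minus (+ n ℤ.* + n) (+ 3 ℤ.* + n))
        ∙ cong₂ _-_ (sym (ι-* (+ n) (+ n))) (sym (ι-* (+ 3) (+ n)))

      f≤f₄ : f ≤ f₄
      f≤f₄ = ι-≤ crossing-tetrahedra

      module _ (c g : ℚ) (balanced : ν₁ + c ≡ ν₂ - c) (genus : HasGenus M s g) where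

        genus-defect : (fromℕ 4 * g + fromℕ (3 ℕ.* n) * ½) - (fromℕ 4 + fromℕ 2 * (c * c)) ≡ (q + f) - f₄
        genus-defect = begin
          (fromℕ 4 * g + fromℕ (3 ℕ.* n) * ½) - (fromℕ 4 + fromℕ 2 * (c * c))
            ≡⟨ cong (λ x → (fromℕ 4 * g + x * ½) - (fromℕ 4 + fromℕ 2 * (c * c)))
                 (cong ι (ℤ.pos-* 3 n) ∙ sym (ι-* (+ 3) (+ n)) ∙ cong (fromℕ 3 *_) ν-split) ⟩
          (fromℕ 4 * g + fromℕ 3 * (ν₁ + ν₂) * ½) - (fromℕ 4 + fromℕ 2 * (c * c))
            -- Each added bracket is the difference of the two sides of a known relation: genus,
            -- edges, vertices, tetrahedra and balance. The multiplier of the balance relation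
            -- completes it to half of (ν₁ - ν₂)² - 4c².
            ≡⟨ expand g v e f q f₄ ν₁ ν₂ c ⟩
          ((q + f) - f₄)
            + (((fromℕ 2 * (((v - e) + f) - (fromℕ 2 - fromℕ 2 * g))
            + ((e + e) - (fromℕ 3 * f + q)))
            - fromℕ 2 * (v - ν₁ * ν₂))
            + ½ * (fromℕ 2 * f₄ - ((ν₁ + ν₂) * (ν₁ + ν₂) - fromℕ 3 * (ν₁ + ν₂)))
            + ½ * ((ν₁ - ν₂) - fromℕ 2 * c) * ((ν₁ + c) - (ν₂ - c)))
            ≡⟨ cong (λ x → ((q + f) - f₄) + x) (cong₂ _+_ (cong₂ _+_ (cong₂ _-_ (cong₂ _+_
                 (cong (fromℕ 2 *_) (vanish (sym χ-T ∙ genus)))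
                 (vanish e-eq)) (cong (fromℕ 2 *_) (vanish v-eq)))
                 (cong (½ *_) (vanish (f₄-eq ∙ cong₂ _-_ (cong₂ _*_ ν-split ν-split) (cong (fromℕ 3 *_) ν-split)))))
                 (cong (½ * ((ν₁ - ν₂) - fromℕ 2 * c) *_) (vanish balanced))) ⟩
          ((q + f) - f₄) + (((fromℕ 2 * 0ℚ + 0ℚ) - fromℕ 2 * 0ℚ) + ½ * 0ℚ + ½ * ((ν₁ - ν₂) - fromℕ 2 * c) * 0ℚ)
            ≡⟨ zeros ((q + f) - f₄) (½ * ((ν₁ - ν₂) - fromℕ 2 * c)) ⟩
          (q + f) - f₄ ∎
          where
          open ≡-Reasoning
          vanish : ∀ {x y} → x ≡ y → x - y ≡ 0ℚ
          vanish {x} refl = ℚ.+-inverseʳ x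
          zeros : ∀ x y → x + (((fromℕ 2 * 0ℚ + 0ℚ) - fromℕ 2 * 0ℚ) + ½ * 0ℚ + y * 0ℚ) ≡ x
          zeros = solve 2 (λ x y → x :+ (((con (fromℕ 2) :* con 0ℚ :+ con 0ℚ) :- con (fromℕ 2) :* con 0ℚ)
                    :+ con ½ :* con 0ℚ :+ y :* con 0ℚ) := x) refl
            where open +-*-Solver
          expand : ∀ g v e f q f₄ ν₁ ν₂ c →
            (fromℕ 4 * g + fromℕ 3 * (ν₁ + ν₂) * ½) - (fromℕ 4 + fromℕ 2 * (c * c)) ≡
            ((q + f) - f₄)
            + (((fromℕ 2 * (((v - e) + f) - (fromℕ 2 - fromℕ 2 * g))
            + ((e + e) - (fromℕ 3 * f + q)))
            - fromℕ 2 * (v - ν₁ * ν₂))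
            + ½ * (fromℕ 2 * f₄ - ((ν₁ + ν₂) * (ν₁ + ν₂) - fromℕ 3 * (ν₁ + ν₂)))
            + ½ * ((ν₁ - ν₂) - fromℕ 2 * c) * ((ν₁ + c) - (ν₂ - c)))
          expand = solve 9 (λ g v e f q f₄ ν₁ ν₂ c →
            (con (fromℕ 4) :* g :+ con (fromℕ 3) :* (ν₁ :+ ν₂) :* con ½) :- (con (fromℕ 4) :+ con (fromℕ 2) :* (c :* c)) :=
            ((q :+ f) :- f₄)
            :+ (((con (fromℕ 2) :* (((v :- e) :+ f) :- (con (fromℕ 2) :- con (fromℕ 2) :* g))
            :+ ((e :+ e) :- (con (fromℕ 3) :* f :+ q)))
            :- con (fromℕ 2) :* (v :- ν₁ :* ν₂))
            :+ con ½ :* (con (fromℕ 2) :* f₄ :- ((ν₁ :+ ν₂) :* (ν₁ :+ ν₂) :- con (fromℕ 3) :* (ν₁ :+ ν₂)))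
            :+ con ½ :* ((ν₁ :- ν₂) :- con (fromℕ 2) :* c) :* ((ν₁ :+ c) :- (ν₂ :- c)))) refl
            where open +-*-Solver

        quadrilateral-bound : q ≥ (fromℕ 4 * g + fromℕ (3 ℕ.* n) * ½) - (fromℕ 4 + fromℕ 2 * (c * c))
        quadrilateral-bound = begin
          (fromℕ 4 * g + fromℕ (3 ℕ.* n) * ½) - (fromℕ 4 + fromℕ 2 * (c * c))  ≡⟨ genus-defect ⟩
          (q + f) - f₄                                                         ≤⟨ ℚ.+-monoˡ-≤ (- f₄) (ℚ.+-monoʳ-≤ q f≤f₄) ⟩
          (q + f₄) - f₄                                                        ≡⟨ cancel q f₄ ⟩
          q                                                                    ∎
          where
          open ℚ.≤-Reasoning
          cancel : ∀ x y → (x + y) - y ≡ x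
          cancel = solve 2 (λ x y → (x :+ y) :- y := x) refl
            where open +-*-Solver

  -- If every tetrahedron gives a quadrilateral, then e = 2q and χ = κ² - q with q = 2κ² - 3κ. So χ
  -- = 3κ - κ², which for κ = 1 + μ is 2 - (μ² - μ); this is where the binomial genus comes from.
  -- The quantities are variables so that matching on `refl` can eliminate them.
  balanced-arithmetic : ∀ {v e f f₄ q κ ν g μ : ℚ} → v ≡ κ * κ → e + e ≡ fromℕ 3 * f + q →
    fromℕ 2 * f₄ ≡ ν * ν - fromℕ 3 * ν → ν ≡ κ + κ → κ ≡ fromℕ 1 + μ → fromℕ 2 * g ≡ μ * μ - μ →
    q ≡ f → q ≡ f₄ →
    (v - e) + f ≡ fromℕ 2 - fromℕ 2 * g × q ≡ (fromℕ 4 * g + fromℕ 3 * κ) - fromℕ 4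
  balanced-arithmetic {e = e} {q = q} {κ} {g = g} {μ} refl e-eq q-eq refl refl 2g refl refl = χ-eq , q-eq′
    where
    open ≡-Reasoning
    open +-*-Solver
    χ-eq : (κ * κ - e) + q ≡ fromℕ 2 - fromℕ 2 * g
    χ-eq = begin
      (κ * κ - e) + q
        ≡⟨ solve 3 (λ e q μ → ((con (fromℕ 1) :+ μ) :* (con (fromℕ 1) :+ μ) :- e) :+ q
             := ((con (fromℕ 1) :+ μ) :* (con (fromℕ 1) :+ μ) :- con ½ :* (e :+ e)) :+ con ½ :* (con (fromℕ 2) :* q)) refl e q μ ⟩
      (κ * κ - ½ * (e + e)) + ½ * (fromℕ 2 * q)
        ≡⟨ cong (λ x → (κ * κ - ½ * x) + ½ * (fromℕ 2 * q)) e-eq ⟩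
      (κ * κ - ½ * (fromℕ 3 * q + q)) + ½ * (fromℕ 2 * q)
        ≡⟨ solve 2 (λ q μ → ((con (fromℕ 1) :+ μ) :* (con (fromℕ 1) :+ μ) :- con ½ :* (con (fromℕ 3) :* q :+ q)) :+ con ½ :* (con (fromℕ 2) :* q)
             := (con (fromℕ 1) :+ μ) :* (con (fromℕ 1) :+ μ) :- con ½ :* (con (fromℕ 2) :* q)) refl q μ ⟩
      κ * κ - ½ * (fromℕ 2 * q)
        ≡⟨ cong (λ x → κ * κ - ½ * x) q-eq ⟩
      κ * κ - ½ * ((κ + κ) * (κ + κ) - fromℕ 3 * (κ + κ))
        ≡⟨ solve 1 (λ μ → let κ = con (fromℕ 1) :+ μ in
             κ :* κ :- con ½ :* ((κ :+ κ) :* (κ :+ κ) :- con (fromℕ 3) :* (κ :+ κ)) := con (fromℕ 2) :- (μ :* μ :- μ)) refl μ ⟩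
      fromℕ 2 - (μ * μ - μ)
        ≡⟨ cong (λ x → fromℕ 2 - x) (sym 2g) ⟩
      fromℕ 2 - fromℕ 2 * g ∎
    q-eq′ : q ≡ (fromℕ 4 * g + fromℕ 3 * κ) - fromℕ 4
    q-eq′ = begin
      q
        ≡⟨ solve 1 (λ q → q := con ½ :* (con (fromℕ 2) :* q)) refl q ⟩
      ½ * (fromℕ 2 * q)
        ≡⟨ cong (½ *_) q-eq ⟩
      ½ * ((κ + κ) * (κ + κ) - fromℕ 3 * (κ + κ))
        ≡⟨ solve 1 (λ μ → let κ = con (fromℕ 1) :+ μ in
             con ½ :* ((κ :+ κ) :* (κ :+ κ) :- con (fromℕ 3) :* (κ :+ κ))
             := (con (fromℕ 2) :* (μ :* μ :- μ) :+ con (fromℕ 3) :* κ) :- con (fromℕ 4)) refl μ ⟩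
      (fromℕ 2 * (μ * μ - μ) + fromℕ 3 * κ) - fromℕ 4
        ≡⟨ cong (λ x → (fromℕ 2 * x + fromℕ 3 * κ) - fromℕ 4) (sym 2g) ⟩
      (fromℕ 2 * (fromℕ 2 * g) + fromℕ 3 * κ) - fromℕ 4
        ≡⟨ solve 2 (λ g μ → let κ = con (fromℕ 1) :+ μ in
             (con (fromℕ 2) :* (con (fromℕ 2) :* g) :+ con (fromℕ 3) :* κ) :- con (fromℕ 4)
             := (con (fromℕ 4) :* g :+ con (fromℕ 3) :* κ) :- con (fromℕ 4)) refl g μ ⟩
      (fromℕ 4 * g + fromℕ 3 * κ) - fromℕ 4 ∎

  -- Equality for the alternating partition

  module Halves (m : ℕ) (m≥2 : 2 ℕ.≤ m) where
    k = suc m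
    open Weave k

    open Cyclic (inl zero) (inr zero ∷ weave (tabulate suc)) (weave-unique (Unique.allFin⁺ k)) weave-covers
      -- As `k` is at least 3, the cycle has at least six labels, and the list without its first
      -- entry at least five.
      (ℕ.s≤s⁻¹ (ℕ.≤-trans (ℕ.*-monoʳ-≤ 2 (ℕ.s≤s m≥2))
        (ℕ.≤-reflexive (sym (length-weave (allFin k) ∙ cong (2 ℕ.*_) (List.length-tabulate {n = k} id))))))
      public

    split-edge : ∀ {s t} → (s , t) ∈ₗ edges → ∃₂ λ u w → u ∈ low-half × w ∈ ∁ low-half ×
                 (∀ {x} → x ≡ s ⊎ x ≡ t → x ≡ u ⊎ x ≡ w)
    split-edge {s} {t} e∈ with weave-bicolored zero (tabulate suc) e∈
    ... | inj₁ (s∈ , t∈) = s , t , s∈ , t∈ , id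
    ... | inj₂ (s∈ , t∈) = t , s , t∈ , s∈ , [ inj₂ , inj₁ ]′

    -- Each of the two edges spanning the face has one end in either half. A face with four vertices
    -- must therefore be split as 2 + 2.
    ∣σ∩V∣≤2 : ∀ {σ} → CyclicFace σ → ∣ σ ∩ low-half ∣ ℕ.≤ 2 × ∣ σ ∩ ∁ low-half ∣ ℕ.≤ 2
    ∣σ∩V∣≤2 {σ} σ∈M with (s , t) , (s′ , t′) , e∈ , e′∈ , h ← face⁻ σ∈M
      with u , w , u∈ , w∈ , sub ← split-edge e∈ | u′ , w′ , u′∈ , w′∈ , sub′ ← split-edge e′∈ =
        bound u u′ (λ x∈ x∈V → on-low (ends-of x∈) x∈V) , bound w w′ (λ x∈ x∈V → on-high (ends-of x∈) x∈V)
      where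
      bound : ∀ y y′ {V} → (∀ {x} → x ∈ σ → x ∈ V → x ∈ₗ y ∷ y′ ∷ []) → ∣ σ ∩ V ∣ ℕ.≤ 2
      bound y y′ {V} h′ = ℕ.≤-trans
        (p⊆q⇒∣p∣≤∣q∣ {p = σ ∩ V} {⟪ y ∷ y′ ∷ [] ⟫} λ x∈ →
          let x∈σ , x∈V = x∈p∩q⁻ σ V x∈ in ∈⟪⟫⁺ (y ∷ y′ ∷ []) (h′ x∈σ x∈V))
        (∣⟪xs⟫∣≤length (y ∷ y′ ∷ []))
      ends-of : ∀ {x} → x ∈ σ → (x ≡ u ⊎ x ≡ w) ⊎ (x ≡ u′ ⊎ x ≡ w′)
      ends-of x∈ with ∈⟪⟫⁻ (s ∷ t ∷ s′ ∷ t′ ∷ []) (h x∈)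
      ... | here e                         = inj₁ (sub (inj₁ e))
      ... | there (here e)                 = inj₁ (sub (inj₂ e))
      ... | there (there (here e))         = inj₂ (sub′ (inj₁ e))
      ... | there (there (there (here e))) = inj₂ (sub′ (inj₂ e))
      on-low : ∀ {x} → (x ≡ u ⊎ x ≡ w) ⊎ (x ≡ u′ ⊎ x ≡ w′) → x ∈ low-half → x ∈ₗ u ∷ u′ ∷ []
      on-low (inj₁ (inj₁ e))    _   = here e
      on-low (inj₁ (inj₂ refl)) x∈V = ⊥-elim (x∈∁p⇒x∉p w∈ x∈V)
      on-low (inj₂ (inj₁ e))    _   = there (here e)
      on-low (inj₂ (inj₂ refl)) x∈V = ⊥-elim (x∈∁p⇒x∉p w′∈ x∈V)
      on-high : ∀ {x} → (x ≡ u ⊎ x ≡ w) ⊎ (x ≡ u′ ⊎ x ≡ w′) → x ∈ ∁ low-half → x ∈ₗ w ∷ w′ ∷ []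
      on-high (inj₁ (inj₁ refl)) x∈V = ⊥-elim (x∈∁p⇒x∉p x∈V u∈)
      on-high (inj₁ (inj₂ e))    _   = here e
      on-high (inj₂ (inj₁ refl)) x∈V = ⊥-elim (x∈∁p⇒x∉p x∈V u′∈)
      on-high (inj₂ (inj₂ e))    _   = there (here e)

    halves : Bipartition (2 ℕ.* k)
    halves = record
      { V₁ = low-half ; V₂ = ∁ low-half
      ; cover = p∪∁p≡⊤ low-half ; disjoint = disjoint low-half
      ; V₁≢∅ = inl zero , ↑ˡ-∈low (k ℕ.+ 0) zero ; V₂≢∅ = inr zero , ↑ʳ-∈∁low k (zero ↑ˡ 0) }
      where
      disjoint : ∀ {n} (p : Subset n) → p ∩ ∁ p ≡ ⊥
      disjoint []            = refl
      disjoint (outside ∷ p) = cong (outside ∷_) (disjoint p)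
      disjoint (inside  ∷ p) = cong (outside ∷_) (disjoint p)

    separating : SeparatingRsl halves
    separating = record
      { f = λ v → fromℕ (suc (2 ℕ.* toℕ v))
      ; f-injective = λ e → Fin.toℕ-injective (ℕ.*-cancelˡ-≡ _ _ 2 (ℕ.suc-injective (ℤ.+-injective (ι-injective e))))
      ; x₀ = fromℕ (2 ℕ.* k)
      ; below = λ {v} v∈ → ι-< (ℤ.+<+
        (ℕ.≤-trans (ℕ.≤-reflexive (sym (ℕ.*-suc 2 (toℕ v)))) (ℕ.*-monoʳ-≤ 2 (low-< k (k ℕ.+ 0) v∈))))
      ; above = λ {v} v∈ → ι-< (ℤ.+<+ (ℕ.s≤s (ℕ.*-monoʳ-≤ 2 (∁low-≥ k (k ℕ.+ 0) v∈))))
      }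

    ∣V₁∣ : ∣ V₁ halves ∣ ≡ k
    ∣V₁∣ = ∣low∣ k (k ℕ.+ 0)

    ∣V₂∣ : ∣ V₂ halves ∣ ≡ k
    ∣V₂∣ = ∣∁low∣ k (k ℕ.+ 0) ∙ ℕ.+-identityʳ k

    two-neighborly : TwoNeighborly boundary
    two-neighborly v w _ = neighborly v w

    open SlicingCounts boundary separating
    open FaceRelations manifold two-neighborly
    open Tally boundary low-half

    ≤2-split : ∀ a b → a ℕ.≤ 2 → b ℕ.≤ 2 → size 4 a b ≡ quad a b × cross 4 a b ≡ quad a b
    ≤2-split 0 0 _ _ = refl , refl
    ≤2-split 0 1 _ _ = refl , refl
    ≤2-split 0 2 _ _ = refl , refl
    ≤2-split 1 0 _ _ = refl , refl
    ≤2-split 1 1 _ _ = refl , refl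
    ≤2-split 1 2 _ _ = refl , refl
    ≤2-split 2 0 _ _ = refl , refl
    ≤2-split 2 1 _ _ = refl , refl
    ≤2-split 2 2 _ _ = refl , refl
    ≤2-split (suc (suc (suc _))) _ (ℕ.s≤s (ℕ.s≤s ())) _
    ≤2-split 0 (suc (suc (suc _))) _ (ℕ.s≤s (ℕ.s≤s ()))
    ≤2-split 1 (suc (suc (suc _))) _ (ℕ.s≤s (ℕ.s≤s ()))
    ≤2-split 2 (suc (suc (suc _))) _ (ℕ.s≤s (ℕ.s≤s ()))

    q≡f : q ≡ f
    q≡f = cong ι (count-quadrilaterals ∙ sym (T-cong {cross 4} {quad} λ {σ} σ∈M →
      let a≤2 , b≤2 = ∣σ∩V∣≤2 σ∈M in proj₂ (≤2-split (#₁ low-half σ) (#₂ low-half σ) a≤2 b≤2)))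

    q≡f₄ : q ≡ f₄
    q≡f₄ = cong ι (count-quadrilaterals ∙ sym (T-cong {size 4} {quad} λ {σ} σ∈M →
      let a≤2 , b≤2 = ∣σ∩V∣≤2 σ∈M in proj₁ (≤2-split (#₁ low-half σ) (#₂ low-half σ) a≤2 b≤2)))

    g μ κ : ℚ
    g = fromℕ (m C 2)
    μ = fromℕ m
    κ = fromℕ 1 + μ

    2g : fromℕ 2 * g ≡ μ * μ - μ
    2g = ι-* (+ 2) (+ (m C 2)) ∙ cong (λ x → ι (+ 2 ℤ.* x)) (C-Δ₁ 2 m) ∙ cong ι (Δ₁-δ2 m)
      ∙ sym (ι-minus (+ m ℤ.* + m) (+ m)) ∙ cong (_- μ) (sym (ι-* (+ m) (+ m)))

    ν₁≡κ : ν₁ ≡ κ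
    ν₁≡κ = cong fromℕ ∣V₁∣ ∙ sym (ι-+ (+ 1) (+ m))

    ν₂≡κ : ν₂ ≡ κ
    ν₂≡κ = cong fromℕ ∣V₂∣ ∙ sym (ι-+ (+ 1) (+ m))

    ν≡2κ : ν ≡ κ + κ
    ν≡2κ = ν-split ∙ cong₂ _+_ ν₁≡κ ν₂≡κ

    arithmetic : (v - e) + f ≡ fromℕ 2 - fromℕ 2 * g × q ≡ (fromℕ 4 * g + fromℕ 3 * κ) - fromℕ 4
    arithmetic = balanced-arithmetic {v} {e} {f} {f₄} {q} {κ} {ν} {g} {μ}
      (v-eq ∙ cong₂ _*_ ν₁≡κ ν₂≡κ) e-eq f₄-eq ν≡2κ refl 2g q≡f q≡f₄

    genus : HasGenus boundary separating g
    genus = χ-T ∙ proj₁ arithmetic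

    sharp : q ≡ (fromℕ 4 * g + fromℕ 3 * fromℕ k) - fromℕ 4
    sharp = proj₂ arithmetic ∙ cong (λ x → (fromℕ 4 * g + fromℕ 3 * x) - fromℕ 4) (ι-+ (+ 1) (+ m))

open import Data.Rational using (ℚ; _+_; _*_; _-_; ½; _≥_)
open Bipartition using (V₁; V₂)
open Slicing using (quadrilaterals; HasGenus)

theorem4p2 : (∀ (n : ℕ) (M : Complex n) → Combinatorial3Manifold M → TwoNeighborly M →
    ∀ (P : Bipartition n) (j : ℕ) → let c = fromℕ j * ½ in
    fromℕ ∣ V₁ P ∣ + c ≡ fromℕ ∣ V₂ P ∣ - c →
    ∀ (s : SeparatingRsl P) (g : ℚ) → HasGenus M s g →
    fromℕ (quadrilaterals M s)
    ≥ (fromℕ 4 * g + fromℕ (3 ℕ.* n) * ½) - (fromℕ 4 + fromℕ 2 * (c * c)))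
    ×
    (∀ (k : ℕ) → k ℕ.≥ 3 →
    ∃ λ (M : Complex (2 ℕ.* k)) → Combinatorial3Manifold M × TwoNeighborly M ×
    ∃ λ (P : Bipartition (2 ℕ.* k)) → ∣ V₁ P ∣ ≡ k × ∣ V₂ P ∣ ≡ k ×
    Σ (SeparatingRsl P) λ s → let g = fromℕ ((k ℕ.∸ 1) C 2) in
    HasGenus M s g ×
    fromℕ (quadrilaterals M s) ≡ (fromℕ 4 * g + fromℕ 3 * fromℕ k) - fromℕ 4)
theorem4p2 =
  (λ n M manifold neighborly P j balanced s g genus →
    SlicingCounts.FaceRelations.quadrilateral-bound M s manifold neighborly (fromℕ j * ½) g balanced genus) ,
  λ { (suc m) (ℕ.s≤s m≥2) → let open Halves m m≥2 in
    boundary , manifold , two-neighborly , halves , ∣V₁∣ , ∣V₂∣ , separating , genus , sharp }
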